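{- Let $m,n$ be positive integers and let $C$ be an $n\times n$ integer matrix. Let \[ \mathcal{T}_m(\mathcal{M}_n(\mathbb{Z};H),C)=\{(A_1,\ldots,A_m)\in \mathcal{M}_n(\mathbb{Z};H)^m : A_1\cdots A_m=C\}. \] Then, uniformly in $C$, as $H\to\infty$, \[ \#\mathcal{T}_m(\mathcal{M}_n(\mathbb{Z};H),C)\le \begin{cases} H^{(m-1)(n^2-n)+o(1)}, & \text{if } C \text{ is nonsingular (for all } m),\\ H^{n^2+o(1)}, & \text{if } C\neq O_n \text{ is singular and } m=2,\\ H^{mn^2-n}, & \text{if } C\neq O_n \text{ is singular and } m\ge 3. \end{cases} \] Furthermore, when $C=O_n$ is the $n\times n$ zero matrix, \[ H^{(m-1)n^2}\ll \#\mathcal{T}_m(\mathcal{M}_n(\mathbb{Z};H),O_n)\le H^{(m-1)n^2+o(1)}. \]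
   Context: For positive integers $n,H$, $\mathcal{M}_n(\mathbb{Z};H)$ denotes the set of $n\times n$ integer matrices all of whose entries have absolute value at most $H$. $O_n$ is the $n\times n$ zero matrix. A bound $X\le H^{a+o(1)}$ means: for every $\varepsilon>0$, $X\le H^{a+\varepsilon}$ for all sufficiently large $H$. $U\ll V$ means $|U|\le cV$ for a constant $c>0$ depending only on $m$ and $n$. -}

module Defs where

open import Data.Nat as ℕ using (ℕ; zero; suc)
open import Data.Integer as ℤ using (ℤ; +_; -_)
open import Data.Fin using (Fin; zero; suc; punchIn)
open import Data.List using (List; []; _∷_; map; concatMap; length; filter; upTo)
open import Data.Vec using (Vec; []; _∷_; lookup; tabulate)
open import Data.Vec.Properties using (≡-dec)
open import Relation.Binary.PropositionalEquality using (_≡_)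
open import Relation.Nullary using (Dec)

Matrix : ℕ → Set
Matrix n = Vec (Vec ℤ n) n

entry : ∀ {n} → Matrix n → Fin n → Fin n → ℤ
entry A i j = lookup (lookup A i) j

sumFin : ∀ n → (Fin n → ℤ) → ℤ
sumFin zero    f = + 0
sumFin (suc n) f = f zero ℤ.+ sumFin n (λ k → f (suc k))

_⊗_ : ∀ {n} → Matrix n → Matrix n → Matrix n
_⊗_ {n} A B = tabulate λ i → tabulate λ j → sumFin n (λ k → entry A i k ℤ.* entry B k j)

identity : ∀ n → Matrix n
identity n = tabulate λ i → tabulate λ j → Data.Fin._≟_ i j |> λ where
    (Relation.Nullary.yes _) → + 1
    (Relation.Nullary.no _)  → + 0
  where open import Function using (_|>_)

prodMats : ∀ {n m} → Vec (Matrix n) m → Matrix n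
prodMats {n} []       = identity n
prodMats     (A ∷ As) = A ⊗ prodMats As

zeroMat : ∀ n → Matrix n
zeroMat n = tabulate λ _ → tabulate λ _ → + 0

detF : ∀ n → (Fin n → Fin n → ℤ) → ℤ
detF zero    A = + 1
detF (suc n) A = sumFin (suc n) λ j →
  sign j ℤ.* (A zero j ℤ.* detF n (λ i k → A (suc i) (punchIn j k)))
  where
  sign : ∀ {k} → Fin k → ℤ
  sign zero    = + 1
  sign (suc j) = - sign j

det : ∀ {n} → Matrix n → ℤ
det {n} A = detF n (entry A)

range : ℕ → List ℤ
range H = map (λ k → (+ k) ℤ.- (+ H)) (upTo (suc (2 ℕ.* H)))

vecsOf : ∀ {A : Set} k → List A → List (Vec A k)
vecsOf zero    xs = [] ∷ []
vecsOf (suc k) xs = concatMap (λ x → map (x ∷_) (vecsOf k xs)) xs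

-- M_n(Z;H), as a (duplicate-free) list
boundedMats : ∀ n → ℕ → List (Matrix n)
boundedMats n H = vecsOf n (vecsOf n (range H))

_≟M_ : ∀ {n} (A B : Matrix n) → Dec (A ≡ B)
_≟M_ = ≡-dec (≡-dec ℤ._≟_)

countT : ∀ m n → ℕ → Matrix n → ℕ
countT m n H C = length (filter (λ As → prodMats As ≟M C) (vecsOf m (boundedMats n H)))

{-# OPTIONS --safe #-}
module Submission where

-- Everything rests on counting integer matrices of given rank, or of given determinant d ≠ 0,
-- with entries at most H.  The rows of a matrix of rank r lie in a primitive lattice L of rank r.  Give L a
-- basis b₁, …, b_k (k ≤ r) reduced in the sense of Minkowski: bᵢ has size about 2^eᵢ, and a vector of L with
-- entries below 2^eᵢ lies in the span of b₁, …, bᵢ₋₁.  Then a vector of L in the box is determined by its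
-- coordinates modulo the numbers 2^(h - eᵢ), where 2^h is about H, so L has O(∏ H / 2^eᵢ) vectors in the box,
-- whereas there are O(∏ 2^(n eᵢ)) such bases.  The eᵢ cancel, so there are O(H^(nr) log^r H) matrices of rank
-- at most r.  If instead det A = d ≠ 0, apply this to all rows of A but one; modulo the resulting hyperplane
-- lattice the remaining row is a divisor of d, and d has H^o(1) divisors.
-- Nonsingular C: every factor Aᵢ satisfies Aᵢ Gᵢ = det C for some integral Gᵢ.  C = 0: by Sylvester the ranks
-- of the factors add up to at most (m - 1) n.  m = 2: a factor A₁ of rank r leaves O(H^(n (n - r))) choices of
-- A₂.  m ≥ 3: either A₁ is injective and cancels, or A₁ is singular and A₁ ⋯ Aₘ₋₁ ≠ 0 restricts each column of
-- Aₘ to a proper affine subspace.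

open import Defs
open import Algebra.Properties.AbelianGroup using (∙-cancelʳ)
open import Data.Empty using (⊥-elim)
open import Data.Fin as Fin using (Fin; zero; suc; punchIn; punchOut)
import Data.Fin.Properties as Finₚ
open import Data.Integer as ℤ using (ℤ; +_; -_; ∣_∣; 0ℤ; 1ℤ)
open import Data.Integer.DivMod as ℤ/ using ()
import Data.Integer.Properties as ℤₚ
open import Data.Integer.Tactic.RingSolver using (solve-∀)
open import Data.List as List using (List; []; _∷_; length)
open import Data.List.Membership.Propositional using (_∈_; find)
import Data.List.Membership.Propositional.Properties as ∈ₚ
import Data.List.Properties as Listₚ
open import Data.List.Relation.Unary.All as All using (All; []; _∷_)
import Data.List.Relation.Unary.All.Properties as Allₚ
open import Data.List.Relation.Unary.AllPairs using ([]; _∷_)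
open import Data.List.Relation.Unary.Any as Any using (Any; here; there)
open import Data.List.Relation.Unary.Unique.Propositional using (Unique)
import Data.List.Relation.Unary.Unique.DecPropositional.Properties as DecUniqueₚ
import Data.List.Relation.Unary.Unique.Propositional.Properties as Uniqueₚ
open import Data.Nat using (ℕ; zero; suc; _+_; _*_; _∸_; _^_; _⊔_; _!; _≤_; _<_; _≥_; z≤n; s≤s; s≤s⁻¹; >-nonZero; nonTrivial⇒n>1)
open import Data.Nat.Divisibility using (divides; ∣-trans; ∣⇒≤; m∣m*n; n∣m*n) renaming (_∣_ to _∣ℕ_; _∣?_ to _∣ℕ?_)
open import Data.Nat.Induction using (<-wellFounded)
open import Data.Nat.ListAction using (product)
open import Data.Nat.Primality using (Prime; prime?; euclidsLemma; prime⇒nonZero; prime⇒nonTrivial)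
open import Data.Nat.Primality.Factorisation using (factorise; PrimeFactorisation)
import Data.Nat.Properties as ℕₚ
open import Data.Nat.Tactic.RingSolver using () renaming (solve-∀ to solve-∀ℕ)
open import Data.Product using (_×_; ∃; ∃-syntax; Σ-syntax; _,_; proj₁; proj₂)
import Data.Sign as Sign
open import Data.Sum using (_⊎_; inj₁; inj₂)
open import Data.Unit using (⊤; tt)
open import Data.Vec as Vec using (Vec; []; _∷_; head; tail; lookup; replicate; tabulate; zipWith)
import Data.Vec.Properties as Vecₚ
open import Data.Vec.Relation.Unary.All as VAll using ([]; _∷_)
import Data.Vec.Relation.Unary.All.Properties as VAllₚ
open import Function using (_∋_)
open import Induction.WellFounded using (Acc; acc)
open import Relation.Binary.Definitions using (DecidableEquality)
open import Relation.Binary.PropositionalEquality using (_≡_; _≢_; refl; sym; trans; cong; cong₂; subst; module ≡-Reasoning)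
open import Relation.Nullary using (¬_; Dec; yes; no)
open import Relation.Nullary.Decidable using (_×-dec_; ¬?; decidable-stable)

-- Integer vectors and elementary operations

-- Neither volumes nor real successive minima occur. A basis vector has an integer level instead of
-- a length, and rounding lengths to powers of two makes the moduli 2^(h - eᵢ) divide one another,
-- which is what permits the divisions in the point count. The price is the number of possible
-- levels, a power of log H, and constants depending on n. Both are harmless where H^o(1) is
-- allowed. For m ≥ 3 no o(1) is allowed, but there the argument yields the exponent m n² - 2n, and
-- the spare factor Hⁿ absorbs them. Uniformity in C is delicate only when divisors of det C enter.
-- If C has a factorisation at all, it is a product of bounded matrices, so det C is polynomially
-- bounded in H. Matrices mostly act as linear maps on integer vectors: what remains of a product
-- once a factor is fixed is just a map, and an integral G with A G = d replaces the inverse over ℚ.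
-- The ε of the o(1) is (p + 1) / (q + 1), cleared by raising the count to the power q + 1.

infixl 6 _⊕_ _⊖_
infixr 7 _⊙_

_⊕_ : ∀ {n} → Vec ℤ n → Vec ℤ n → Vec ℤ n
_⊕_ = zipWith ℤ._+_

_⊙_ : ∀ {n} → ℤ → Vec ℤ n → Vec ℤ n
c ⊙ x = Vec.map (c ℤ.*_) x

_⊖_ : ∀ {n} → Vec ℤ n → Vec ℤ n → Vec ℤ n
x ⊖ y = x ⊕ (- 1ℤ) ⊙ y

𝟘 : ∀ {n} → Vec ℤ n
𝟘 = replicate _ 0ℤ

⊕-comm : ∀ {n} (x y : Vec ℤ n) → x ⊕ y ≡ y ⊕ x
⊕-comm []      []      = refl
⊕-comm (a ∷ x) (b ∷ y) = cong₂ _∷_ (ℤₚ.+-comm a b) (⊕-comm x y)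

⊕-assoc : ∀ {n} (x y z : Vec ℤ n) → (x ⊕ y) ⊕ z ≡ x ⊕ (y ⊕ z)
⊕-assoc []      []      []      = refl
⊕-assoc (a ∷ x) (b ∷ y) (c ∷ z) = cong₂ _∷_ (ℤₚ.+-assoc a b c) (⊕-assoc x y z)

⊕-identityʳ : ∀ {n} (x : Vec ℤ n) → x ⊕ 𝟘 ≡ x
⊕-identityʳ []      = refl
⊕-identityʳ (a ∷ x) = cong₂ _∷_ (ℤₚ.+-identityʳ a) (⊕-identityʳ x)

⊕-identityˡ : ∀ {n} (x : Vec ℤ n) → 𝟘 ⊕ x ≡ x
⊕-identityˡ []      = refl
⊕-identityˡ (a ∷ x) = cong₂ _∷_ (ℤₚ.+-identityˡ a) (⊕-identityˡ x)

⊙-distribˡ : ∀ {n} c (x y : Vec ℤ n) → c ⊙ (x ⊕ y) ≡ c ⊙ x ⊕ c ⊙ y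
⊙-distribˡ c []      []      = refl
⊙-distribˡ c (a ∷ x) (b ∷ y) = cong₂ _∷_ (ℤₚ.*-distribˡ-+ c a b) (⊙-distribˡ c x y)

⊙-distribʳ : ∀ {n} c d (x : Vec ℤ n) → (c ℤ.+ d) ⊙ x ≡ c ⊙ x ⊕ d ⊙ x
⊙-distribʳ c d []      = refl
⊙-distribʳ c d (a ∷ x) = cong₂ _∷_ (ℤₚ.*-distribʳ-+ a c d) (⊙-distribʳ c d x)

⊙-assoc : ∀ {n} c d (x : Vec ℤ n) → c ⊙ d ⊙ x ≡ (c ℤ.* d) ⊙ x
⊙-assoc c d []      = refl
⊙-assoc c d (a ∷ x) = cong₂ _∷_ (sym (ℤₚ.*-assoc c d a)) (⊙-assoc c d x)

⊙-swap : ∀ {n} c d (x : Vec ℤ n) → c ⊙ d ⊙ x ≡ d ⊙ c ⊙ x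
⊙-swap c d x = trans (⊙-assoc c d x) (trans (cong (_⊙ x) (ℤₚ.*-comm c d)) (sym (⊙-assoc d c x)))

⊙-zeroˡ : ∀ {n} (x : Vec ℤ n) → 0ℤ ⊙ x ≡ 𝟘
⊙-zeroˡ []      = refl
⊙-zeroˡ (a ∷ x) = cong (0ℤ ∷_) (⊙-zeroˡ x)

⊙-zeroʳ : ∀ c {n} → c ⊙ 𝟘 {n} ≡ 𝟘
⊙-zeroʳ c {zero}  = refl
⊙-zeroʳ c {suc n} = cong₂ _∷_ (ℤₚ.*-zeroʳ c) (⊙-zeroʳ c)

⊕-interchange : ∀ {n} (a b c d : Vec ℤ n) → (a ⊕ b) ⊕ (c ⊕ d) ≡ (a ⊕ c) ⊕ (b ⊕ d)
⊕-interchange []      []      []      []      = refl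
⊕-interchange (a ∷ x) (b ∷ y) (c ∷ z) (d ∷ w) = cong₂ _∷_ (eq a b c d) (⊕-interchange x y z w)
  where
  eq : ∀ a b c d → (a ℤ.+ b) ℤ.+ (c ℤ.+ d) ≡ (a ℤ.+ c) ℤ.+ (b ℤ.+ d)
  eq = solve-∀

x⊖x≡𝟘 : ∀ {n} (x : Vec ℤ n) → x ⊖ x ≡ 𝟘
x⊖x≡𝟘 []      = refl
x⊖x≡𝟘 (a ∷ x) = cong₂ _∷_ (eq a) (x⊖x≡𝟘 x)
  where
  eq : ∀ a → a ℤ.+ (- 1ℤ) ℤ.* a ≡ 0ℤ
  eq = solve-∀

x⊖y⊕y≡x : ∀ {n} (x y : Vec ℤ n) → (x ⊖ y) ⊕ y ≡ x
x⊖y⊕y≡x []      []      = refl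
x⊖y⊕y≡x (a ∷ x) (b ∷ y) = cong₂ _∷_ (eq a b) (x⊖y⊕y≡x x y)
  where
  eq : ∀ a b → (a ℤ.+ (- 1ℤ) ℤ.* b) ℤ.+ b ≡ a
  eq = solve-∀

x⊕y⊖x≡y : ∀ {n} (x y : Vec ℤ n) → (x ⊕ y) ⊖ x ≡ y
x⊕y⊖x≡y []      []      = refl
x⊕y⊖x≡y (a ∷ x) (b ∷ y) = cong₂ _∷_ (eq a b) (x⊕y⊖x≡y x y)
  where
  eq : ∀ a b → (a ℤ.+ b) ℤ.+ (- 1ℤ) ℤ.* a ≡ b
  eq = solve-∀

⊖-⊖ : ∀ {n} (x y z : Vec ℤ n) → (x ⊖ z) ⊖ (y ⊖ z) ≡ x ⊖ y
⊖-⊖ []      []      []      = refl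
⊖-⊖ (a ∷ x) (b ∷ y) (c ∷ z) = cong₂ _∷_ (eq a b c) (⊖-⊖ x y z)
  where
  eq : ∀ a b c → (a ℤ.+ (- 1ℤ) ℤ.* c) ℤ.+ (- 1ℤ) ℤ.* (b ℤ.+ (- 1ℤ) ℤ.* c) ≡ a ℤ.+ (- 1ℤ) ℤ.* b
  eq = solve-∀

x⊖y≡𝟘⇒x≡y : ∀ {n} (x y : Vec ℤ n) → x ⊖ y ≡ 𝟘 → x ≡ y
x⊖y≡𝟘⇒x≡y x y e = trans (sym (x⊖y⊕y≡x x y)) (trans (cong (_⊕ y) e) (⊕-identityˡ y))

⊙≡𝟘⇒≡𝟘 : ∀ {n} {c} → c ≢ 0ℤ → (x : Vec ℤ n) → c ⊙ x ≡ 𝟘 → x ≡ 𝟘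
⊙≡𝟘⇒≡𝟘 c≢0 []      _ = refl
⊙≡𝟘⇒≡𝟘 {c = c} c≢0 (a ∷ x) e with ℤₚ.i*j≡0⇒i≡0∨j≡0 c (cong head e)
... | inj₁ c≡0 = ⊥-elim (c≢0 c≡0)
... | inj₂ a≡0 = cong₂ _∷_ a≡0 (⊙≡𝟘⇒≡𝟘 c≢0 x (cong tail e))

⊙-cancel : ∀ {n} {c} → c ≢ 0ℤ → (x y : Vec ℤ n) → c ⊙ x ≡ c ⊙ y → x ≡ y
⊙-cancel {c = c} c≢0 x y e = x⊖y≡𝟘⇒x≡y x y (⊙≡𝟘⇒≡𝟘 c≢0 _ (begin
  c ⊙ (x ⊖ y)               ≡⟨ ⊙-distribˡ c x _ ⟩
  c ⊙ x ⊕ c ⊙ (- 1ℤ) ⊙ y    ≡⟨ cong₂ _⊕_ e (⊙-swap c (- 1ℤ) y) ⟩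
  c ⊙ y ⊖ c ⊙ y             ≡⟨ x⊖x≡𝟘 _ ⟩
  𝟘                         ∎))
  where open ≡-Reasoning

record Linear {m n} (f : Vec ℤ m → Vec ℤ n) : Set where
  field
    ⊕-homo : ∀ x y → f (x ⊕ y) ≡ f x ⊕ f y
    ⊙-homo : ∀ c x → f (c ⊙ x) ≡ c ⊙ f x

  𝟘-homo : f 𝟘 ≡ 𝟘
  𝟘-homo = trans (cong f (sym (⊙-zeroˡ 𝟘))) (trans (⊙-homo 0ℤ 𝟘) (⊙-zeroˡ _))

  ⊖-homo : ∀ x y → f (x ⊖ y) ≡ f x ⊖ f y
  ⊖-homo x y = trans (⊕-homo x _) (cong (f x ⊕_) (⊙-homo (- 1ℤ) y))

open Linear public

∘-linear : ∀ {l m n} {f : Vec ℤ m → Vec ℤ n} {g : Vec ℤ l → Vec ℤ m} →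
  Linear f → Linear g → Linear (λ x → f (g x))
∘-linear {f = f} F G = record
  { ⊕-homo = λ x y → trans (cong f (⊕-homo G x y)) (⊕-homo F _ _)
  ; ⊙-homo = λ c x → trans (cong f (⊙-homo G c x)) (⊙-homo F c _) }

tail-linear : ∀ {n} → Linear (tail {A = ℤ} {n})
tail-linear = record { ⊕-homo = λ { (_ ∷ _) (_ ∷ _) → refl } ; ⊙-homo = λ { _ (_ ∷ _) → refl } }

head-⊕ : ∀ {n} (x y : Vec ℤ (suc n)) → head (x ⊕ y) ≡ head x ℤ.+ head y
head-⊕ (_ ∷ _) (_ ∷ _) = refl

head-⊙ : ∀ {n} c (x : Vec ℤ (suc n)) → head (c ⊙ x) ≡ c ℤ.* head x
head-⊙ c (_ ∷ _) = refl

dot : ∀ {n} → Vec ℤ n → Vec ℤ n → ℤ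
dot []      []      = 0ℤ
dot (a ∷ x) (b ∷ y) = a ℤ.* b ℤ.+ dot x y

dot-comm : ∀ {n} (x y : Vec ℤ n) → dot x y ≡ dot y x
dot-comm []      []      = refl
dot-comm (a ∷ x) (b ∷ y) = cong₂ ℤ._+_ (ℤₚ.*-comm a b) (dot-comm x y)

dot-⊕ʳ : ∀ {n} (x y z : Vec ℤ n) → dot x (y ⊕ z) ≡ dot x y ℤ.+ dot x z
dot-⊕ʳ []      []      []      = refl
dot-⊕ʳ (a ∷ x) (b ∷ y) (c ∷ z) rewrite dot-⊕ʳ x y z = eq a b c (dot x y) (dot x z)
  where
  eq : ∀ a b c u v → a ℤ.* (b ℤ.+ c) ℤ.+ (u ℤ.+ v) ≡ (a ℤ.* b ℤ.+ u) ℤ.+ (a ℤ.* c ℤ.+ v)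
  eq = solve-∀

dot-⊙ʳ : ∀ {n} c (x y : Vec ℤ n) → dot x (c ⊙ y) ≡ c ℤ.* dot x y
dot-⊙ʳ c []      []      = sym (ℤₚ.*-zeroʳ c)
dot-⊙ʳ c (a ∷ x) (b ∷ y) rewrite dot-⊙ʳ c x y = eq a b c (dot x y)
  where
  eq : ∀ a b c u → a ℤ.* (c ℤ.* b) ℤ.+ c ℤ.* u ≡ c ℤ.* (a ℤ.* b ℤ.+ u)
  eq = solve-∀

dot-⊕ˡ : ∀ {n} (x y z : Vec ℤ n) → dot (x ⊕ y) z ≡ dot x z ℤ.+ dot y z
dot-⊕ˡ x y z = trans (dot-comm _ z) (trans (dot-⊕ʳ z x y) (cong₂ ℤ._+_ (dot-comm z x) (dot-comm z y)))

dot-⊙ˡ : ∀ {n} c (x y : Vec ℤ n) → dot (c ⊙ x) y ≡ c ℤ.* dot x y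
dot-⊙ˡ c x y = trans (dot-comm _ y) (trans (dot-⊙ʳ c y x) (cong (c ℤ.*_) (dot-comm y x)))

dot-𝟘ʳ : ∀ {n} (x : Vec ℤ n) → dot x 𝟘 ≡ 0ℤ
dot-𝟘ʳ []      = refl
dot-𝟘ʳ (a ∷ x) = cong₂ ℤ._+_ (ℤₚ.*-zeroʳ a) (dot-𝟘ʳ x)

dot-𝟘ˡ : ∀ {n} (x : Vec ℤ n) → dot 𝟘 x ≡ 0ℤ
dot-𝟘ˡ x = trans (dot-comm 𝟘 x) (dot-𝟘ʳ x)

comb : ∀ {k n} → Vec ℤ k → Vec (Vec ℤ n) k → Vec ℤ n
comb []      []      = 𝟘
comb (z ∷ zs) (b ∷ bs) = z ⊙ b ⊕ comb zs bs

comb-linear : ∀ {k n} (bs : Vec (Vec ℤ n) k) → Linear (λ z → comb z bs)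
comb-linear bs = record { ⊕-homo = add bs ; ⊙-homo = scl bs }
  where
  add : ∀ {k n} (bs : Vec (Vec ℤ n) k) x y → comb (x ⊕ y) bs ≡ comb x bs ⊕ comb y bs
  add []       []      []      = sym (⊕-identityʳ 𝟘)
  add (b ∷ bs) (c ∷ x) (d ∷ y) =
    trans (cong₂ _⊕_ (⊙-distribʳ c d b) (add bs x y)) (⊕-interchange _ _ _ _)
  scl : ∀ {k n} (bs : Vec (Vec ℤ n) k) c x → comb (c ⊙ x) bs ≡ c ⊙ comb x bs
  scl []       c []      = sym (⊙-zeroʳ c)
  scl (b ∷ bs) c (d ∷ x) =
    trans (cong₂ _⊕_ (sym (⊙-assoc c d b)) (scl bs c x)) (sym (⊙-distribˡ c _ _))

linear-comb : ∀ {k m n} {f : Vec ℤ m → Vec ℤ n} → Linear f → ∀ (z : Vec ℤ k) bs →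
  VAll.All (λ b → f b ≡ 𝟘) bs → f (comb z bs) ≡ 𝟘
linear-comb F []      []       []       = 𝟘-homo F
linear-comb {f = f} F (z ∷ zs) (b ∷ bs) (p ∷ ps) = begin
  f (z ⊙ b ⊕ comb zs bs)      ≡⟨ ⊕-homo F _ _ ⟩
  f (z ⊙ b) ⊕ f (comb zs bs)  ≡⟨ cong₂ _⊕_ (⊙-homo F z b) (linear-comb F zs bs ps) ⟩
  z ⊙ f b ⊕ 𝟘                 ≡⟨ ⊕-identityʳ _ ⟩
  z ⊙ f b                     ≡⟨ cong (z ⊙_) p ⟩
  z ⊙ 𝟘                       ≡⟨ ⊙-zeroʳ z ⟩
  𝟘                           ∎
  where open ≡-Reasoning

dot-comb : ∀ {k n} (z : Vec ℤ k) (bs : Vec (Vec ℤ n) k) y →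
  VAll.All (λ b → dot b y ≡ 0ℤ) bs → dot (comb z bs) y ≡ 0ℤ
dot-comb []      []       y []       = dot-𝟘ˡ y
dot-comb (z ∷ zs) (b ∷ bs) y (p ∷ ps) = begin
  dot (z ⊙ b ⊕ comb zs bs) y              ≡⟨ dot-⊕ˡ (z ⊙ b) (comb zs bs) y ⟩
  dot (z ⊙ b) y ℤ.+ dot (comb zs bs) y    ≡⟨ cong₂ ℤ._+_ (dot-⊙ˡ z b y) (dot-comb zs bs y ps) ⟩
  z ℤ.* dot b y ℤ.+ 0ℤ                    ≡⟨ ℤₚ.+-identityʳ _ ⟩
  z ℤ.* dot b y                           ≡⟨ cong (z ℤ.*_) p ⟩
  z ℤ.* 0ℤ                                ≡⟨ ℤₚ.*-zeroʳ z ⟩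
  0ℤ                                      ∎
  where open ≡-Reasoning

-- Products of elementary row operations: unimodular matrices, given syntactically so that inverse
-- and inverse transpose are again of this form.
data El : ℕ → Set where
  idᴱ   : ∀ {n} → El n
  _⨾_   : ∀ {n} → El n → El n → El n
  shear : ∀ {n} → ℤ → El (suc (suc n))
  swap  : ∀ {n} → El (suc (suc n))
  lift  : ∀ {n} → El n → El (suc n)

to : ∀ {n} → El n → Vec ℤ n → Vec ℤ n
to idᴱ       x           = x
to (e ⨾ f)   x           = to f (to e x)
to (shear q) (a ∷ b ∷ x) = a ℤ.+ q ℤ.* b ∷ b ∷ x
to swap      (a ∷ b ∷ x) = b ∷ a ∷ x
to (lift e)  (a ∷ x)     = a ∷ to e x

inv : ∀ {n} → El n → El n
inv idᴱ       = idᴱ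
inv (e ⨾ f)   = inv f ⨾ inv e
inv (shear q) = shear (- q)
inv swap      = swap
inv (lift e)  = lift (inv e)

-- The inverse transpose, as `dot-dual` confirms. Transposing a shear moves its entry across the
-- diagonal; conjugation with `swap` does this, since `shear` itself only adds to the first
-- coordinate.
dual : ∀ {n} → El n → El n
dual idᴱ       = idᴱ
dual (e ⨾ f)   = dual e ⨾ dual f
dual (shear q) = swap ⨾ (shear (- q) ⨾ swap)
dual swap      = swap
dual (lift e)  = lift (dual e)

to-linear : ∀ {n} (e : El n) → Linear (to e)
to-linear idᴱ       = record { ⊕-homo = λ _ _ → refl ; ⊙-homo = λ _ _ → refl }
to-linear (e ⨾ f)   = ∘-linear (to-linear f) (to-linear e)
to-linear (shear q) = record
  { ⊕-homo = λ { (a ∷ b ∷ x) (c ∷ d ∷ y) → cong (_∷ _) (eq q a b c d) }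
  ; ⊙-homo = λ { c (a ∷ b ∷ x) → cong (_∷ _) (eq′ q c a b) } }
  where
  eq : ∀ q a b c d → (a ℤ.+ c) ℤ.+ q ℤ.* (b ℤ.+ d) ≡ (a ℤ.+ q ℤ.* b) ℤ.+ (c ℤ.+ q ℤ.* d)
  eq = solve-∀
  eq′ : ∀ q c a b → c ℤ.* a ℤ.+ q ℤ.* (c ℤ.* b) ≡ c ℤ.* (a ℤ.+ q ℤ.* b)
  eq′ = solve-∀
to-linear swap      = record
  { ⊕-homo = λ { (_ ∷ _ ∷ _) (_ ∷ _ ∷ _) → refl } ; ⊙-homo = λ { _ (_ ∷ _ ∷ _) → refl } }
to-linear (lift e)  = record
  { ⊕-homo = λ { (_ ∷ x) (_ ∷ y) → cong (_ ∷_) (⊕-homo (to-linear e) x y) }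
  ; ⊙-homo = λ { c (_ ∷ x) → cong (_ ∷_) (⊙-homo (to-linear e) c x) } }

inv-to : ∀ {n} (e : El n) x → to (inv e) (to e x) ≡ x
inv-to idᴱ       x           = refl
inv-to (e ⨾ f)   x           = trans (cong (to (inv e)) (inv-to f (to e x))) (inv-to e x)
inv-to (shear q) (a ∷ b ∷ x) = cong (_∷ _) (eq q a b)
  where
  eq : ∀ q a b → (a ℤ.+ q ℤ.* b) ℤ.+ (- q) ℤ.* b ≡ a
  eq = solve-∀
inv-to swap      (a ∷ b ∷ x) = refl
inv-to (lift e)  (a ∷ x)     = cong (a ∷_) (inv-to e x)

to-inv : ∀ {n} (e : El n) x → to e (to (inv e) x) ≡ x
to-inv idᴱ       x           = refl
to-inv (e ⨾ f)   x           = trans (cong (to f) (to-inv e (to (inv f) x))) (to-inv f x)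
to-inv (shear q) (a ∷ b ∷ x) = cong (_∷ _) (eq q a b)
  where
  eq : ∀ q a b → (a ℤ.+ (- q) ℤ.* b) ℤ.+ q ℤ.* b ≡ a
  eq = solve-∀
to-inv swap      (a ∷ b ∷ x) = refl
to-inv (lift e)  (a ∷ x)     = cong (a ∷_) (to-inv e x)

dot-dual : ∀ {n} (e : El n) x y → dot (to e x) (to (dual e) y) ≡ dot x y
dot-dual idᴱ       x           y           = refl
dot-dual (e ⨾ f)   x           y           = trans (dot-dual f _ _) (dot-dual e x y)
dot-dual (shear q) (a ∷ b ∷ x) (c ∷ d ∷ y) = eq q a b c d (dot x y)
  where
  eq : ∀ q a b c d u →
    (a ℤ.+ q ℤ.* b) ℤ.* c ℤ.+ (b ℤ.* (d ℤ.+ (- q) ℤ.* c) ℤ.+ u) ≡ a ℤ.* c ℤ.+ (b ℤ.* d ℤ.+ u)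
  eq = solve-∀
dot-dual swap      (a ∷ b ∷ x) (c ∷ d ∷ y) = eq (a ℤ.* c) (b ℤ.* d) (dot x y)
  where
  eq : ∀ a b u → b ℤ.+ (a ℤ.+ u) ≡ a ℤ.+ (b ℤ.+ u)
  eq = solve-∀
dot-dual (lift e)  (a ∷ x)     (c ∷ y)     = cong (λ t → a ℤ.* c ℤ.+ t) (dot-dual e x y)

to-injective : ∀ {n} (e : El n) x → to e x ≡ 𝟘 → x ≡ 𝟘
to-injective e x p = trans (sym (inv-to e x)) (trans (cong (to (inv e)) p) (𝟘-homo (to-linear (inv e))))

euclid : ∀ {n} a b → Acc _<_ ∣ b ∣ →
  ∃[ e ] ∃[ g ] ∀ (x : Vec ℤ n) → to e (a ∷ b ∷ x) ≡ g ∷ 0ℤ ∷ x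
euclid a b (acc rs) with b ℤ.≟ 0ℤ
... | yes refl = idᴱ , a , λ _ → refl
... | no b≢0 =
  let instance _ = ℤ.≢-nonZero b≢0
      q = a ℤ/./ b
      r = a ℤ/.% b
      e , g , h = euclid b (+ r) (rs (ℤ/.n%d<d a b))
  in (shear (- q) ⨾ swap) ⨾ e , g , λ x → trans (cong (λ t → to e (b ∷ t ∷ x)) (begin
       a ℤ.+ (- q) ℤ.* b                    ≡⟨ cong (ℤ._+ (- q) ℤ.* b) (ℤ/.a≡a%n+[a/n]*n a b) ⟩
       (+ r ℤ.+ q ℤ.* b) ℤ.+ (- q) ℤ.* b    ≡⟨ eq (+ r) q b ⟩
       + r                                  ∎)) (h x)
  where
  open ≡-Reasoning
  eq : ∀ r q b → (r ℤ.+ q ℤ.* b) ℤ.+ (- q) ℤ.* b ≡ r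
  eq = solve-∀

-- Euclid's algorithm, from the last coordinate upwards; up to sign `g` is the gcd of the entries.
-- This one normal form replaces those of Hermite and Smith: `x` is `g` times a member of a basis of
-- the whole of ℤⁿ.
reduce-vector : ∀ {n} (x : Vec ℤ (suc n)) → ∃[ e ] ∃[ g ] to e x ≡ g ∷ 𝟘
reduce-vector (a ∷ [])    = idᴱ , a , refl
reduce-vector (a ∷ b ∷ x) =
  let e , g , p = reduce-vector (b ∷ x)
      f , g′ , p′ = euclid a g (<-wellFounded _)
  in lift e ⨾ f , g′ , trans (cong (λ t → to f (a ∷ t)) p) (p′ 𝟘)

-- Each row costs one coordinate. In coordinates where the first row is `g ∷ 𝟘`, a vector with first
-- dual coordinate 0 is orthogonal to it, whatever `g` is, and pairs with the other rows through
-- their tails.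
orthogonal-vector : ∀ {n} (rows : List (Vec ℤ n)) → List.length rows < n →
  ∃[ w ] w ≢ 𝟘 × All (λ a → dot a w ≡ 0ℤ) rows
orthogonal-vector {suc n} []         _         = 1ℤ ∷ 𝟘 , (λ ()) , []
orthogonal-vector {suc n} (a ∷ rows) (s≤s len) =
  let e , g , p = reduce-vector a
      proj = λ b → tail (to e b)
      w , w≢0 , ws = orthogonal-vector (List.map proj rows)
        (subst (_< n) (sym (Listₚ.length-map proj rows)) len)
      v = to (inv (dual e)) (0ℤ ∷ w)
      v* = to-inv (dual e) (0ℤ ∷ w)
      pair : ∀ b → dot b v ≡ dot (tail (to e b)) w
      pair b = trans (sym (dot-dual e b v)) (trans (cong (dot (to e b)) v*) (lem (to e b) w))
  in v , (λ v≡0 → w≢0 (cong tail (trans (sym v*) (trans (cong (to (dual e)) v≡0) (𝟘-homo (to-linear (dual e)))))))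
     , trans (pair a) (trans (cong (λ t → dot (tail t) w) p) (dot-𝟘ˡ w))
     ∷ All.map (λ {b} q → trans (pair b) q) (Allₚ.map⁻ ws)
  where

  lem : ∀ {n} (x : Vec ℤ (suc n)) w → dot x (0ℤ ∷ w) ≡ dot (tail x) w
  lem (a ∷ x) w = trans (cong (ℤ._+ dot x w) (ℤₚ.*-zeroʳ a)) (ℤₚ.+-identityˡ _)

-- Counting

-- A bound on the number of elements of P that makes sense without P being decidable.
Atmost : {X : Set} → (X → Set) → ℕ → Set
Atmost P N = ∀ xs → Unique xs → All P xs → length xs ≤ N

atmost-≤ : ∀ {X : Set} {P : X → Set} {M N} → M ≤ N → Atmost P M → Atmost P N
atmost-≤ M≤N h xs u p = ℕₚ.≤-trans (h xs u p) M≤N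

atmost-⊆ : ∀ {X : Set} {P Q : X → Set} {N} → (∀ {x} → P x → Q x) → Atmost Q N → Atmost P N
atmost-⊆ P⊆Q h xs u p = h xs u (All.map P⊆Q p)

-- A bound may be proved in the presence of a solution, since the empty list satisfies every bound.
-- The solution serves as base point of a coset, or certifies side conditions (on ranks, levels, the
-- size of det C) on which the bound depends.
atmost-inhabited : ∀ {X : Set} {P : X → Set} {N} → (∀ x → P x → Atmost P N) → Atmost P N
atmost-inhabited h []         _ _       = z≤n
atmost-inhabited h xs@(x ∷ _) u (p ∷ q) = h x p xs u (p ∷ q)

atmost-1 : ∀ {X : Set} {P : X → Set} → (∀ x y → P x → P y → x ≡ y) → Atmost P 1
atmost-1 h []          _ _ = z≤n
atmost-1 h (x ∷ [])    _ _ = s≤s z≤n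
atmost-1 h (x ∷ y ∷ _) ((x≢y ∷ _) ∷ _) (p ∷ q ∷ _) = ⊥-elim (x≢y (h x y p q))

atmost-injection : ∀ {X Y : Set} {P : X → Set} {Q : Y → Set} {N} (f : X → Y) →
  (∀ {x} → P x → Q (f x)) → (∀ {x y} → P x → P y → f x ≡ f y → x ≡ y) → Atmost Q N → Atmost P N
atmost-injection {P = P} {Q} {N} f PQ inj h xs u p =
  subst (_≤ N) (Listₚ.length-map f xs) (h (List.map f xs) (unique xs u p) (Allₚ.map⁺ (All.map PQ p)))
  where
  distinct : ∀ {x} → P x → ∀ ys → All P ys → All (x ≢_) ys → All (f x ≢_) (List.map f ys)
  distinct px []       []       []       = []
  distinct px (y ∷ ys) (q ∷ qs) (r ∷ rs) = (λ e → r (inj px q e)) ∷ distinct px ys qs rs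
  unique : ∀ xs → Unique xs → All P xs → Unique (List.map f xs)
  unique []       []       []       = []
  unique (x ∷ xs) (d ∷ u) (p ∷ ps) = distinct p xs ps d ∷ unique xs u ps

-- The last component says in effect that both parts consist of members of `xs`. The recursion
-- applies it to `x ≢_` to keep the parts duplicate-free.
split-⊎ : ∀ {X : Set} {P Q : X → Set} xs → Unique xs → All (λ x → P x ⊎ Q x) xs →
  ∃[ ys ] ∃[ zs ] Unique ys × Unique zs × All P ys × All Q zs × length xs ≡ length ys + length zs
    × (∀ {R : X → Set} → All R xs → All R ys × All R zs)
split-⊎ []       []      []              = [] , [] , [] , [] , [] , [] , refl , λ _ → [] , []
split-⊎ (x ∷ xs) (d ∷ u) (inj₁ p ∷ ps) with split-⊎ xs u ps
... | ys , zs , uy , uz , py , pz , len , sub =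
  x ∷ ys , zs , proj₁ (sub d) ∷ uy , uz , p ∷ py , pz , cong suc len ,
  λ { (r ∷ rs) → r ∷ proj₁ (sub rs) , proj₂ (sub rs) }
split-⊎ (x ∷ xs) (d ∷ u) (inj₂ q ∷ ps) with split-⊎ xs u ps
... | ys , zs , uy , uz , py , pz , len , sub =
  ys , x ∷ zs , uy , proj₂ (sub d) ∷ uz , py , q ∷ pz ,
  trans (cong suc len) (sym (ℕₚ.+-suc (length ys) (length zs))) ,
  λ { (r ∷ rs) → proj₁ (sub rs) , r ∷ proj₂ (sub rs) }

atmost-⊎ : ∀ {X : Set} {P Q : X → Set} {M N} → Atmost P M → Atmost Q N → Atmost (λ x → P x ⊎ Q x) (M + N)
atmost-⊎ hP hQ xs u p with split-⊎ xs u p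
... | ys , zs , uy , uz , py , pz , len , _ =
  ℕₚ.≤-trans (ℕₚ.≤-reflexive len) (ℕₚ.+-mono-≤ (hP ys uy py) (hQ zs uz pz))

-- The union bound. `R` may relate an element to several `y` and may contain existential witnesses,
-- so covers by bases that are far from unique are allowed.
atmost-cover : ∀ {X Y : Set} {P : X → Set} {M} (R : X → Y → Set) (ys : List Y) →
  (∀ {x} → P x → Any (R x) ys) → (∀ y → Atmost (λ x → P x × R x y) M) → Atmost P (length ys * M)
atmost-cover {X} {Y} {P} {M} R ys cover fibre =
  atmost-⊆ (λ p → p , cover p) (go ys)
  where
  go : ∀ ys → Atmost (λ x → P x × Any (R x) ys) (length ys * M)
  go []       = λ { [] _ _ → z≤n ; (_ ∷ _) _ ((_ , ()) ∷ _) }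
  go (y ∷ ys) = atmost-⊆ (λ { (p , here r) → inj₁ (p , r) ; (p , there r) → inj₂ (p , r) })
    (atmost-⊎ (fibre y) (go ys))

atmost-list : ∀ {X : Set} {P : X → Set} (ys : List X) → (∀ {x} → P x → x ∈ ys) → Atmost P (length ys)
atmost-list ys cover = atmost-≤ (ℕₚ.≤-reflexive (ℕₚ.*-identityʳ _))
  (atmost-cover _≡_ ys cover λ y → atmost-1 λ { _ _ (_ , p) (_ , q) → trans p (sym q) })

-- No list of all elements of `Q` is at hand, only a bound for duplicate-free ones. The image of
-- `xs` without repetitions is such a list, and removing repetitions is what the decidable equality
-- is for.
atmost-fibre : ∀ {X Y : Set} {P : X → Set} {Q : Y → Set} {M N} → DecidableEquality Y → (f : X → Y) →
  (∀ {x} → P x → Q (f x)) → Atmost Q N → (∀ y → Atmost (λ x → P x × f x ≡ y) M) → Atmost P (N * M)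
atmost-fibre {X} {Y} {P} {Q} {M} {N} _≟_ f PQ hQ fibre xs u p = ℕₚ.≤-trans
  (atmost-cover (λ x y → f x ≡ y) ys (λ {x} → cover {x}) (λ y → atmost-⊆ (λ { ((q , _) , e) → q , e }) (fibre y))
    xs u (All.tabulate λ x∈ → All.lookup p x∈ , x∈))
  (ℕₚ.*-monoˡ-≤ M (hQ ys (DecUniqueₚ.deduplicate-! _≟_ _)
    (All.tabulate λ y∈ → image (∈ₚ.∈-map⁻ f (∈ₚ.∈-deduplicate⁻ _≟_ (List.map f xs) y∈)))))
  where
  ys = List.deduplicate _≟_ (List.map f xs)
  image : ∀ {y} → ∃ (λ x → x ∈ xs × y ≡ f x) → Q y
  image (x , x∈ , refl) = PQ (All.lookup p x∈)
  cover : ∀ {x} → P x × x ∈ xs → Any (λ y → f x ≡ y) ys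
  cover (_ , x∈) = ∈ₚ.∈-deduplicate⁺ _≟_ (∈ₚ.∈-map⁺ f x∈)

atmost-vec : ∀ {X : Set} {P : X → Set} {N} → DecidableEquality X → Atmost P N → ∀ k →
  Atmost (λ (v : Vec X k) → VAll.All P v) (N ^ k)
atmost-vec _≟_ h zero    = atmost-1 λ { [] [] _ _ → refl }
atmost-vec _≟_ h (suc k) = atmost-fibre _≟_ head (λ { {_ ∷ _} (p ∷ _) → p }) h λ y →
  atmost-injection tail (λ { {_ ∷ _} (_ ∷ ps , _) → ps })
    (λ { {_ ∷ _} {_ ∷ _} (_ , refl) (_ , refl) refl → refl }) (atmost-vec _≟_ h k)

vecsOf-suc : ∀ {A : Set} k (xs : List A) → vecsOf (suc k) xs ≡ List.cartesianProductWith _∷_ xs (vecsOf k xs)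
vecsOf-suc {A} k xs = go xs
  where
  go : ∀ ys → List.concatMap (λ x → List.map (x ∷_) (vecsOf k xs)) ys ≡ List.cartesianProductWith _∷_ ys (vecsOf k xs)
  go []       = refl
  go (y ∷ ys) = cong (List.map (y ∷_) (vecsOf k xs) List.++_) (go ys)

∈-vecsOf⁺ : ∀ {A : Set} {k} {xs : List A} (v : Vec A k) → VAll.All (_∈ xs) v → v ∈ vecsOf k xs
∈-vecsOf⁺ []      []       = here refl
∈-vecsOf⁺ {xs = xs} (x ∷ v) (p ∷ ps) = subst (_ ∈_) (sym (vecsOf-suc _ xs))
  (∈ₚ.∈-cartesianProductWith⁺ _∷_ p (∈-vecsOf⁺ v ps))

∈-vecsOf⁻ : ∀ {A : Set} {k} {xs : List A} (v : Vec A k) → v ∈ vecsOf k xs → VAll.All (_∈ xs) v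
∈-vecsOf⁻ []      _ = []
∈-vecsOf⁻ {k = suc k} {xs} (x ∷ v) v∈
  with ∈ₚ.∈-cartesianProductWith⁻ _∷_ xs (vecsOf k xs) (subst (_ ∈_) (vecsOf-suc k xs) v∈)
... | _ , _ , p , q , refl = p ∷ ∈-vecsOf⁻ v q

vecsOf-unique : ∀ {A : Set} k {xs : List A} → Unique xs → Unique (vecsOf k xs)
vecsOf-unique zero    u = [] ∷ []
vecsOf-unique (suc k) {xs} u = subst Unique (sym (vecsOf-suc k xs))
  (Uniqueₚ.cartesianProductWith⁺ _∷_ Vecₚ.∷-injective u (vecsOf-unique k u))

length-vecsOf : ∀ {A : Set} k (xs : List A) → length (vecsOf k xs) ≡ length xs ^ k
length-vecsOf zero    xs = refl
length-vecsOf (suc k) xs = trans (cong length (vecsOf-suc k xs))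
  (trans (go xs) (cong (length xs *_) (length-vecsOf k xs)))
  where
  go : ∀ ys → length (List.cartesianProductWith _∷_ ys (vecsOf k xs)) ≡ length ys * length (vecsOf k xs)
  go []       = refl
  go (y ∷ ys) = trans (Listₚ.length-++ (List.map (y ∷_) (vecsOf k xs)))
    (cong₂ _+_ (Listₚ.length-map (y ∷_) (vecsOf k xs)) (go ys))

length-range : ∀ H → length (range H) ≡ suc (2 * H)
length-range H = trans (Listₚ.length-map _ (List.upTo (suc (2 * H)))) (Listₚ.length-upTo (suc (2 * H)))

range-unique : ∀ H → Unique (range H)
range-unique H = Uniqueₚ.map⁺ (λ {x} {y} e → ℤₚ.+-injective (∙-cancelʳ ℤₚ.+-0-abelianGroup (- + H) (+ x) (+ y) e)) (Uniqueₚ.upTo⁺ _)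

∣i∣≤n⇒i+n≥0 : ∀ i n → ∣ i ∣ ≤ n → i ≡ + ∣ i ℤ.+ + n ∣ ℤ.- + n × ∣ i ℤ.+ + n ∣ ≤ 2 * n
∣i∣≤n⇒i+n≥0 (+ i)       n i≤n = (begin
  + i                        ≡⟨ eq (+ i) (+ n) ⟩
  + i ℤ.+ + n ℤ.- + n        ∎) ,
  ℕₚ.+-mono-≤ i≤n (ℕₚ.≤-reflexive (sym (ℕₚ.+-identityʳ n)))
  where
  open ≡-Reasoning
  eq : ∀ a b → a ≡ a ℤ.+ b ℤ.- b
  eq = solve-∀
∣i∣≤n⇒i+n≥0 (ℤ.-[1+ i ]) n i<n = (begin
  ℤ.-[1+ i ]                         ≡⟨ eq ℤ.-[1+ i ] (+ n) ⟩
  ℤ.-[1+ i ] ℤ.+ + n ℤ.- + n         ≡⟨ cong (ℤ._- + n) (ℤₚ.⊖-≥ i<n) ⟩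
  + (n ∸ suc i) ℤ.- + n              ≡⟨ cong (λ t → + ∣ t ∣ ℤ.- + n) (sym (ℤₚ.⊖-≥ i<n)) ⟩
  + ∣ ℤ.-[1+ i ] ℤ.+ + n ∣ ℤ.- + n   ∎) ,
  subst (_≤ 2 * n) (cong ∣_∣ (sym (ℤₚ.⊖-≥ i<n))) (ℕₚ.≤-trans (ℕₚ.m∸n≤m n (suc i)) (ℕₚ.m≤m+n n _))
  where
  open ≡-Reasoning
  eq : ∀ a b → a ≡ a ℤ.+ b ℤ.- b
  eq = solve-∀

∈-range⁺ : ∀ {H i} → ∣ i ∣ ≤ H → i ∈ range H
∈-range⁺ {H} {i} h with ∣i∣≤n⇒i+n≥0 i H h
... | e , le = subst (_∈ range H) (sym e) (∈ₚ.∈-map⁺ _ (∈ₚ.∈-upTo⁺ (s≤s le)))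

∈-range⁻ : ∀ {H i} → i ∈ range H → ∣ i ∣ ≤ H
∈-range⁻ {H} p with ∈ₚ.∈-map⁻ _ p
... | k , k∈ , refl with ∈ₚ.∈-upTo⁻ k∈
... | s≤s k≤2H rewrite ℤₚ.m-n≡m⊖n k H with ℕₚ.≤-total H k
... | inj₁ H≤k rewrite ℤₚ.⊖-≥ H≤k = ℕₚ.≤-trans (ℕₚ.∸-monoˡ-≤ H k≤2H) (ℕₚ.≤-reflexive (trans (ℕₚ.m+n∸m≡n H (H + 0)) (ℕₚ.+-identityʳ H)))
... | inj₂ k≤H rewrite ℤₚ.⊖-≤ k≤H | ℤₚ.∣-i∣≡∣i∣ (+ (H ∸ k)) = ℕₚ.m∸n≤m H k

Bounded : ∀ {n} → ℕ → Vec ℤ n → Set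
Bounded H = VAll.All (λ a → ∣ a ∣ ≤ H)

∈-box⁺ : ∀ {n H} {v : Vec ℤ n} → Bounded H v → v ∈ vecsOf n (range H)
∈-box⁺ {v = v} b = ∈-vecsOf⁺ v (VAll.map ∈-range⁺ b)

∈-box⁻ : ∀ {n H} {v : Vec ℤ n} → v ∈ vecsOf n (range H) → Bounded H v
∈-box⁻ {v = v} p = VAll.map ∈-range⁻ (∈-vecsOf⁻ v p)

length-box : ∀ n H → length (vecsOf n (range H)) ≡ suc (2 * H) ^ n
length-box n H = trans (length-vecsOf n (range H)) (cong (_^ n) (length-range H))

atmost-box : ∀ {n} H → Atmost (Bounded {n} H) (suc (2 * H) ^ n)
atmost-box {n} H = subst (Atmost _) (length-box n H) (atmost-list _ ∈-box⁺)

bounded-≤ : ∀ {n M N} {x : Vec ℤ n} → M ≤ N → Bounded M x → Bounded N x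
bounded-≤ M≤N = VAll.map (λ p → ℕₚ.≤-trans p M≤N)

bounded-⊕ : ∀ {n M N} {x y : Vec ℤ n} → Bounded M x → Bounded N y → Bounded (M + N) (x ⊕ y)
bounded-⊕ {x = []}    {[]}    []       []       = []
bounded-⊕ {x = a ∷ _} {b ∷ _} (p ∷ ps) (q ∷ qs) =
  ℕₚ.≤-trans (ℤₚ.∣i+j∣≤∣i∣+∣j∣ a b) (ℕₚ.+-mono-≤ p q) ∷ bounded-⊕ ps qs

bounded-⊙ : ∀ {n M N} {c} {x : Vec ℤ n} → ∣ c ∣ ≤ M → Bounded N x → Bounded (M * N) (c ⊙ x)
bounded-⊙ {x = []}    p []       = []
bounded-⊙ {c = c} {a ∷ _} p (q ∷ qs) =
  subst (_≤ _) (sym (ℤₚ.∣i*j∣≡∣i∣*∣j∣ c a)) (ℕₚ.*-mono-≤ p q) ∷ bounded-⊙ {c = c} p qs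

bounded-⊖ : ∀ {n M N} {x y : Vec ℤ n} → Bounded M x → Bounded N y → Bounded (M + N) (x ⊖ y)
bounded-⊖ p q = bounded-⊕ p (bounded-≤ (ℕₚ.≤-reflexive (ℕₚ.*-identityˡ _)) (bounded-⊙ {c = - 1ℤ} ℕₚ.≤-refl q))

bounded-𝟘 : ∀ {n M} → Bounded M (𝟘 {n})
bounded-𝟘 {zero}  = []
bounded-𝟘 {suc n} = z≤n ∷ bounded-𝟘

small-multiple-ℤ : ∀ {T} q a → T < q → ∣ + q ℤ.* a ∣ ≤ T → a ≡ 0ℤ
small-multiple-ℤ {T} q a T<q p = go a (subst (_≤ T) (ℤₚ.∣i*j∣≡∣i∣*∣j∣ (+ q) a) p)
  where
  absurd : ∀ k → ¬ (q * suc k ≤ T)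
  absurd k h = ℕₚ.<⇒≱ T<q (ℕₚ.≤-trans (ℕₚ.m≤m*n q (suc k)) h)
  go : ∀ a → q * ∣ a ∣ ≤ T → a ≡ 0ℤ
  go (+ zero)    h = refl
  go (+ suc k)   h = ⊥-elim (absurd k h)
  go ℤ.-[1+ k ]  h = ⊥-elim (absurd k h)

small-multiple : ∀ {n T} q (x : Vec ℤ n) → T < q → Bounded T (+ q ⊙ x) → x ≡ 𝟘
small-multiple q []      T<q []       = refl
small-multiple q (a ∷ x) T<q (p ∷ ps) = cong₂ _∷_ (small-multiple-ℤ q a T<q p) (small-multiple q x T<q ps)

-- Lattices and reduced bases

-- The lattice is the kernel of `β`, hence primitive. Instead of a basis it carries `τ`, which
-- restricts to an isomorphism of the kernel with ℤᵗ; changing coordinates, or passing to the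
-- quotient by part of a basis, is then mere composition of maps.
record Lattice (n t : ℕ) : Set where
  field
    {codim}  : ℕ
    β        : Vec ℤ n → Vec ℤ codim
    β-linear : Linear β
    τ        : Vec ℤ n → Vec ℤ t
    τ-linear : Linear τ
    τ-surj   : ∀ w → ∃[ x ] β x ≡ 𝟘 × τ x ≡ w
    τ-inj    : ∀ x → β x ≡ 𝟘 → τ x ≡ 𝟘 → x ≡ 𝟘

  Mem : Vec ℤ n → Set
  Mem x = β x ≡ 𝟘

  mem-⊕ : ∀ {x y} → Mem x → Mem y → Mem (x ⊕ y)
  mem-⊕ p q = trans (⊕-homo β-linear _ _) (trans (cong₂ _⊕_ p q) (⊕-identityʳ 𝟘))

  mem-⊙ : ∀ c {x} → Mem x → Mem (c ⊙ x)
  mem-⊙ c p = trans (⊙-homo β-linear c _) (trans (cong (c ⊙_) p) (⊙-zeroʳ c))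

  mem-⊖ : ∀ {x y} → Mem x → Mem y → Mem (x ⊖ y)
  mem-⊖ p q = mem-⊕ p (mem-⊙ (- 1ℤ) q)

open Lattice public using (Mem)

_≟ᵛ_ : ∀ {n} → DecidableEquality (Vec ℤ n)
_≟ᵛ_ = Vecₚ.≡-dec ℤ._≟_

scaleBy : ∀ {k} → Vec ℕ k → Vec ℤ k → Vec ℤ k
scaleBy = zipWith (λ q a → + q ℤ.* a)

scaleBy-linear : ∀ {k} (qs : Vec ℕ k) → Linear (scaleBy qs)
scaleBy-linear qs = record { ⊕-homo = add qs ; ⊙-homo = scl qs }
  where
  add : ∀ {k} (qs : Vec ℕ k) x y → scaleBy qs (x ⊕ y) ≡ scaleBy qs x ⊕ scaleBy qs y
  add []       []      []      = refl
  add (q ∷ qs) (a ∷ x) (b ∷ y) = cong₂ _∷_ (ℤₚ.*-distribˡ-+ (+ q) a b) (add qs x y)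
  scl : ∀ {k} (qs : Vec ℕ k) c x → scaleBy qs (c ⊙ x) ≡ c ⊙ scaleBy qs x
  scl []       c []      = refl
  scl (q ∷ qs) c (a ∷ x) = cong₂ _∷_ (eq (+ q) c a) (scl qs c x)
    where
    eq : ∀ q c a → q ℤ.* (c ℤ.* a) ≡ c ℤ.* (q ℤ.* a)
    eq = solve-∀

residues : ∀ {k} → Vec ℕ k → List (Vec ℤ k)
residues []       = [] ∷ []
residues (q ∷ qs) = List.cartesianProductWith _∷_ (List.map +_ (List.upTo q)) (residues qs)

length-product : ∀ {A B C : Set} (f : A → B → C) xs ys →
  length (List.cartesianProductWith f xs ys) ≡ length xs * length ys
length-product f []       ys = refl
length-product f (x ∷ xs) ys = trans (Listₚ.length-++ (List.map (f x) ys))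
  (cong₂ _+_ (Listₚ.length-map (f x) ys) (length-product f xs ys))

∏ : ∀ {k} → Vec ℕ k → ℕ
∏ = Vec.foldr _ _*_ 1

length-residues : ∀ {k} (qs : Vec ℕ k) → length (residues qs) ≡ ∏ qs
length-residues []       = refl
length-residues (q ∷ qs) = trans (length-product _∷_ (List.map +_ (List.upTo q)) (residues qs))
  (cong₂ _*_ (trans (Listₚ.length-map +_ (List.upTo q)) (Listₚ.length-upTo q)) (length-residues qs))

residues-cover : ∀ {k} (qs : Vec ℕ k) → VAll.All (λ q → 0 < q) qs → ∀ z →
  Any (λ ρ → ∃[ w ] z ≡ ρ ⊕ scaleBy qs w) (residues qs)
residues-cover qs pos z with go qs pos z
  where
  go : ∀ {k} (qs : Vec ℕ k) → VAll.All (λ q → 0 < q) qs → ∀ z →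
    ∃[ ρ ] ρ ∈ residues qs × ∃[ w ] z ≡ ρ ⊕ scaleBy qs w
  go []           []          []      = [] , here refl , [] , refl
  go (suc q ∷ qs) (_ ∷ pos) (a ∷ z) with go qs pos z
  ... | ρ , ρ∈ , w , e = + (a ℤ/.%ℕ suc q) ∷ ρ ,
    ∈ₚ.∈-cartesianProductWith⁺ _∷_ (∈ₚ.∈-map⁺ +_ (∈ₚ.∈-upTo⁺ (ℤ/.n%ℕd<d a (suc q)))) ρ∈ ,
    a ℤ/./ℕ suc q ∷ w , cong₂ _∷_ (trans (ℤ/.a≡a%ℕn+[a/ℕn]*n a (suc q))
      (cong (λ t → + (a ℤ/.%ℕ suc q) ℤ.+ t) (ℤₚ.*-comm (a ℤ/./ℕ suc q) (+ suc q)))) e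
... | ρ , ρ∈ , w , e = Any.map (λ { refl → w , e }) ρ∈

⊕-cancel-⊖ : ∀ {n} (r x y : Vec ℤ n) → (r ⊕ x) ⊖ (r ⊕ y) ≡ x ⊖ y
⊕-cancel-⊖ []      []      []      = refl
⊕-cancel-⊖ (c ∷ r) (a ∷ x) (b ∷ y) = cong₂ _∷_ (eq a b c) (⊕-cancel-⊖ r x y)
  where
  eq : ∀ a b c → (c ℤ.+ a) ℤ.+ (- 1ℤ) ℤ.* (c ℤ.+ b) ≡ a ℤ.+ (- 1ℤ) ℤ.* b
  eq = solve-∀

-- The map x ↦ (coordinates of x modulo qs) is injective on P as soon as a difference of two elements
-- of P all of whose coordinates are divisible by qs has to vanish.
atmost-residues : ∀ {n k} {P : Vec ℤ n → Set} (qs : Vec ℕ k) → VAll.All (λ q → 0 < q) qs →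
  (C : Vec ℤ n → Vec ℤ k → Set) → (∀ {x} → P x → ∃ (C x)) →
  (∀ {x y z z′ w} → P x → P y → C x z → C y z′ → z ⊖ z′ ≡ scaleBy qs w → x ≡ y) →
  Atmost P (∏ qs)
atmost-residues {P = P} qs pos C coords inj =
  atmost-≤ (ℕₚ.≤-reflexive (trans (ℕₚ.*-identityʳ _) (length-residues qs)))
    (atmost-cover (λ x ρ → ∃[ z ] ∃[ w ] C x z × z ≡ ρ ⊕ scaleBy qs w) (residues qs) cover fibre)
  where
  cover : ∀ {x} → P x → Any (λ ρ → ∃[ z ] ∃[ w ] C x z × z ≡ ρ ⊕ scaleBy qs w) (residues qs)
  cover p with coords p
  ... | z , c = Any.map (λ { (w , e) → z , w , c , e }) (residues-cover qs pos z)
  fibre : ∀ ρ → Atmost (λ x → P x × ∃[ z ] ∃[ w ] C x z × z ≡ ρ ⊕ scaleBy qs w) 1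
  fibre ρ = atmost-1 λ { x y (p , z , w , c , refl) (p′ , z′ , w′ , c′ , refl) →
    inj p p′ c c′ (trans (⊕-cancel-⊖ ρ (scaleBy qs w) (scaleBy qs w′)) (sym (⊖-homo (scaleBy-linear qs) w w′))) }

-- The largest integer below 2^e, so that `Bounded (θ e)` expresses a strict inequality. Strictness
-- survives division by a power of two, and at level 0 it leaves the zero vector only.
θ : ℕ → ℕ
θ e = 2 ^ e ∸ 1

suc-θ : ∀ e → suc (θ e) ≡ 2 ^ e
suc-θ e = ℕₚ.suc-pred (2 ^ e) {{ℕₚ.m^n≢0 2 e}}

-- The newest basis vector comes first.
Good : ∀ {n k} → ℕ → Vec (Vec ℤ n) k → Vec ℕ k → Set
Good h []       []       = ⊤
Good h (b ∷ bs) (e ∷ es) =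
  (∀ z zs → Bounded (θ e) (z ⊙ b ⊕ comb zs bs) → z ≡ 0ℤ) × e ≤ h × VAll.All (_≤ e) es × Good h bs es

indices : ∀ {k} → ℕ → Vec ℕ k → Vec ℕ k
indices h = Vec.map (λ e → 2 ^ (h ∸ e))

bounded-divide : ∀ {n h e} (v : Vec ℤ n) → e ≤ h → Bounded (θ h) (+ (2 ^ (h ∸ e)) ⊙ v) → Bounded (θ e) v
bounded-divide []      e≤h []       = []
bounded-divide {h = h} {e} (a ∷ v) e≤h (p ∷ ps) = entry-bound ∷ bounded-divide v e≤h ps
  where
  open ℕₚ.≤-Reasoning
  entry-bound : ∣ a ∣ ≤ θ e
  entry-bound = s≤s⁻¹ (subst (∣ a ∣ <_) (sym (suc-θ e)) (ℕₚ.*-cancelˡ-< (2 ^ (h ∸ e)) ∣ a ∣ (2 ^ e) (begin-strict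
    2 ^ (h ∸ e) * ∣ a ∣            ≡⟨ ℤₚ.∣i*j∣≡∣i∣*∣j∣ (+ (2 ^ (h ∸ e))) a ⟨
    ∣ + (2 ^ (h ∸ e)) ℤ.* a ∣      ≤⟨ p ⟩
    θ h                            <⟨ ℕₚ.≤-refl ⟩
    suc (θ h)                      ≡⟨ suc-θ h ⟩
    2 ^ h                          ≡⟨ cong (2 ^_) (ℕₚ.m∸n+n≡m e≤h) ⟨
    2 ^ (h ∸ e + e)                ≡⟨ ℕₚ.^-distribˡ-+-* 2 (h ∸ e) e ⟩
    2 ^ (h ∸ e) * 2 ^ e            ∎)))

-- Here the powers of two matter. Older levels are at most the newest level `e`, so their moduli are
-- multiples of 2^(h - e), and that power can be taken out of all coordinates at once.
indices-divisible : ∀ {k h e} (es : Vec ℕ k) → e ≤ h → VAll.All (_≤ e) es → ∀ w →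
  ∃[ u ] scaleBy (indices h es) w ≡ + (2 ^ (h ∸ e)) ⊙ u
indices-divisible []       e≤h []       []      = [] , refl
indices-divisible {h = h} {e} (f ∷ es) e≤h (p ∷ ps) (a ∷ w) with indices-divisible es e≤h ps w
... | u , eq = + (2 ^ (e ∸ f)) ℤ.* a ∷ u , cong₂ _∷_ (begin
  + (2 ^ (h ∸ f)) ℤ.* a                          ≡⟨ cong (λ t → + (2 ^ t) ℤ.* a) (trans (cong (_∸ f) (sym (ℕₚ.m∸n+n≡m e≤h))) (ℕₚ.+-∸-assoc (h ∸ e) p)) ⟩
  + (2 ^ (h ∸ e + (e ∸ f))) ℤ.* a                ≡⟨ cong (λ t → + t ℤ.* a) (ℕₚ.^-distribˡ-+-* 2 (h ∸ e) (e ∸ f)) ⟩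
  + (2 ^ (h ∸ e) * 2 ^ (e ∸ f)) ℤ.* a            ≡⟨ cong (ℤ._* a) (ℤₚ.pos-* (2 ^ (h ∸ e)) (2 ^ (e ∸ f))) ⟩
  + (2 ^ (h ∸ e)) ℤ.* + (2 ^ (e ∸ f)) ℤ.* a      ≡⟨ ℤₚ.*-assoc (+ (2 ^ (h ∸ e))) (+ (2 ^ (e ∸ f))) a ⟩
  + (2 ^ (h ∸ e)) ℤ.* (+ (2 ^ (e ∸ f)) ℤ.* a)    ∎) eq
  where open ≡-Reasoning

-- Divided by the newest and smallest modulus 2^(h - e), the combination stays integral and has
-- entries below 2^e, so its newest coordinate vanishes. What is left is the same statement for the
-- older vectors.
good-separates : ∀ {n k h} (bs : Vec (Vec ℤ n) k) es → Good h bs es → ∀ w →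
  Bounded (θ h) (comb (scaleBy (indices h es) w) bs) → comb (scaleBy (indices h es) w) bs ≡ 𝟘
good-separates []       []       _                   []      _ = refl
good-separates {h = h} (b ∷ bs) (e ∷ es) (sep , e≤h , es≤e , g) (a ∷ w) bd
  with indices-divisible es e≤h es≤e w
... | u , u-eq = trans drop-head (good-separates bs es g w (subst (Bounded (θ h)) drop-head bd))
  where
  q = + (2 ^ (h ∸ e))
  factor : (q ℤ.* a) ⊙ b ⊕ comb (scaleBy (indices h es) w) bs ≡ q ⊙ (a ⊙ b ⊕ comb u bs)
  factor = trans (cong₂ _⊕_ (sym (⊙-assoc q a b))
      (trans (cong (λ t → comb t bs) u-eq) (⊙-homo (comb-linear bs) q u)))
    (sym (⊙-distribˡ q (a ⊙ b) (comb u bs)))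
  a≡0 : a ≡ 0ℤ
  a≡0 = sep a u (bounded-divide (a ⊙ b ⊕ comb u bs) e≤h (subst (Bounded (θ h)) factor bd))
  drop-head : (q ℤ.* a) ⊙ b ⊕ comb (scaleBy (indices h es) w) bs ≡ comb (scaleBy (indices h es) w) bs
  drop-head = trans (cong (λ t → (q ℤ.* t) ⊙ b ⊕ comb (scaleBy (indices h es) w) bs) a≡0)
    (trans (cong (λ t → t ⊙ b ⊕ comb (scaleBy (indices h es) w) bs) (ℤₚ.*-zeroʳ q))
    (trans (cong (_⊕ comb (scaleBy (indices h es) w) bs) (⊙-zeroˡ b)) (⊕-identityˡ _)))

indices-positive : ∀ {k} h (es : Vec ℕ k) → VAll.All (λ q → 0 < q) (indices h es)
indices-positive h []       = []
indices-positive h (e ∷ es) = ℕₚ.m^n>0 2 (h ∸ e) ∷ indices-positive h es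

-- Points of a coset of the span have coordinates only relative to a base point `x₀` in it. Reducing
-- these modulo the indices is injective by `good-separates`.
atmost-coset : ∀ {n k h} {P : Vec ℤ n → Set} (bs : Vec (Vec ℤ n) k) es → Good h bs es →
  (∀ {x y} → P x → P y → Bounded (θ h) (x ⊖ y) × ∃[ z ] x ⊖ y ≡ comb z bs) →
  Atmost P (∏ (indices h es))
atmost-coset {h = h} {P} bs es g diff = atmost-inhabited λ x₀ p₀ →
  atmost-residues (indices h es) (indices-positive h es) (λ x z → x ⊖ x₀ ≡ comb z bs)
    (λ p → proj₂ (diff p p₀))
    λ {x} {y} {z} {z′} {w} p p′ c c′ e →
      let eq : x ⊖ y ≡ comb (scaleBy (indices h es) w) bs
          eq = trans (sym (⊖-⊖ x y x₀)) (trans (cong₂ _⊖_ c c′)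
                 (trans (sym (⊖-homo (comb-linear bs) z z′)) (cong (λ t → comb t bs) e)))
      in x⊖y≡𝟘⇒x≡y x y (trans eq (good-separates bs es g w (subst (Bounded (θ h)) eq (proj₁ (diff p p′)))))

-- `lattice` contains the rows, so `rank` is at least theirs; `κ` is injective on the solutions, so
-- `nullity` is at least their dimension. The sum being `n`, both are exact. `κ-saturated` combines
-- two facts: modulus 0 gives injectivity, and a positive modulus lets solutions be counted by
-- residues.
record RankDecomposition {n} (rows : List (Vec ℤ n)) : Set where
  field
    rank nullity : ℕ
    rank+nullity : rank + nullity ≡ n
    lattice      : Lattice n rank
    rows∈lattice : All (Mem lattice) rows
    κ            : Vec ℤ n → Vec ℤ nullity
    κ-linear     : Linear κ
    κ-saturated  : ∀ q w y → All (λ a → dot a y ≡ 0ℤ) rows → κ y ≡ q ⊙ w → ∃[ y′ ] y ≡ q ⊙ y′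

id-linear : ∀ {n} → Linear {n} (λ x → x)
id-linear = record { ⊕-homo = λ _ _ → refl ; ⊙-homo = λ _ _ → refl }

const-linear : ∀ {m} → Linear {m} {0} (λ _ → [])
const-linear = record { ⊕-homo = λ _ _ → refl ; ⊙-homo = λ _ _ → refl }

∷-linear : ∀ {m n} {f : Vec ℤ m → Vec ℤ (suc n)} → Linear f →
  ∀ {k} {h : Vec ℤ n → Vec ℤ k} → Linear h → Linear (λ x → head (f x) ∷ h (tail (f x)))
∷-linear {f = f} F {h = h} Hl = record
  { ⊕-homo = λ x y → cong₂ _∷_ (trans (cong head (⊕-homo F x y)) (head-⊕ (f x) (f y)))
      (⊕-homo (∘-linear Hl (∘-linear tail-linear F)) x y)
  ; ⊙-homo = λ c x → cong₂ _∷_ (trans (cong head (⊙-homo F c x)) (head-⊙ c (f x)))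
      (⊙-homo (∘-linear Hl (∘-linear tail-linear F)) c x) }

head∷tail : ∀ {n} (x : Vec ℤ (suc n)) → head x ∷ tail x ≡ x
head∷tail (_ ∷ _) = refl

dot-cons : ∀ {n} (x y : Vec ℤ (suc n)) → dot x y ≡ head x ℤ.* head y ℤ.+ dot (tail x) (tail y)
dot-cons (_ ∷ _) (_ ∷ _) = refl

module _ {n} (e : El (suc n)) where
  private
    split : Vec ℤ (suc n) → Vec ℤ n
    split x = tail (to e x)

    tail-linear′ : Linear split
    tail-linear′ = ∘-linear tail-linear (to-linear e)

  extend-lattice : ∀ {t} → Lattice n t → Lattice (suc n) (suc t)
  extend-lattice L = record
    { β        = λ x → β (split x)
    ; β-linear = ∘-linear β-linear tail-linear′
    ; τ        = λ x → head (to e x) ∷ τ (split x)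
    ; τ-linear = ∷-linear (to-linear e) τ-linear
    ; τ-surj   = λ { (a ∷ w) → let x , p , q = τ-surj w ; eq = to-inv e (a ∷ x) in
        to (inv e) (a ∷ x) , trans (cong (λ t → β (tail t)) eq) p ,
        cong₂ _∷_ (cong head eq) (trans (cong (λ t → τ (tail t)) eq) q) }
    ; τ-inj    = λ x p q → to-injective e x (trans (sym (head∷tail (to e x)))
        (cong₂ _∷_ (cong head q) (τ-inj (split x) p (cong tail q)))) }
    where open Lattice L

  hyperplane : Lattice (suc n) n
  hyperplane = record
    { β        = λ x → head (to e x) ∷ []
    ; β-linear = ∷-linear (to-linear e) const-linear
    ; τ        = split
    ; τ-linear = tail-linear′
    ; τ-surj   = λ w → let eq = to-inv e (0ℤ ∷ w) in
        to (inv e) (0ℤ ∷ w) , cong (λ t → head t ∷ []) eq , cong tail eq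
    ; τ-inj    = λ x p q → to-injective e x (trans (sym (head∷tail (to e x))) (cong₂ _∷_ (cong head p) q)) }

zero-lattice : ∀ {n} → Lattice n 0
zero-lattice = record
  { β = λ x → x ; β-linear = id-linear ; τ = λ _ → [] ; τ-linear = const-linear
  ; τ-surj = λ { [] → 𝟘 , refl , refl } ; τ-inj = λ _ p _ → p }

add-zero-row : ∀ {n a} {rows : List (Vec ℤ n)} → a ≡ 𝟘 → RankDecomposition rows → RankDecomposition (a ∷ rows)
add-zero-row refl D = record
  { rank = rank ; nullity = nullity ; rank+nullity = rank+nullity ; lattice = lattice
  ; rows∈lattice = 𝟘-homo (Lattice.β-linear lattice) ∷ rows∈lattice
  ; κ = κ ; κ-linear = κ-linear ; κ-saturated = λ { q w y (_ ∷ ps) → κ-saturated q w y ps } }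
  where open RankDecomposition D

-- In the coordinates of `e` the new row is a nonzero multiple of the first unit vector.
-- Orthogonality to it means that the first dual coordinate vanishes, so the solutions are those of
-- the projected rows, while the lattice gains one free coordinate.
add-row : ∀ {n g} {a : Vec ℤ (suc n)} {rows : List (Vec ℤ (suc n))} (e : El (suc n)) → to e a ≡ g ∷ 𝟘 → g ≢ 0ℤ →
  RankDecomposition (List.map (λ b → tail (to e b)) rows) → RankDecomposition (a ∷ rows)
add-row {g = g} {a} {rows} e eg g≢0 D = record
  { rank = suc rank ; nullity = nullity ; rank+nullity = cong suc rank+nullity
  ; lattice = extend-lattice e lattice
  ; rows∈lattice = trans (cong (λ t → Lattice.β lattice (tail t)) eg) (𝟘-homo (Lattice.β-linear lattice))
      ∷ Allₚ.map⁻ rows∈lattice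
  ; κ = λ y → κ (tail (to (dual e) y))
  ; κ-linear = ∘-linear κ-linear (∘-linear tail-linear (to-linear (dual e)))
  ; κ-saturated = saturated }
  where
  open RankDecomposition D
  saturated : ∀ q w y → All (λ b → dot b y ≡ 0ℤ) (a ∷ rows) → κ (tail (to (dual e) y)) ≡ q ⊙ w → ∃[ y′ ] y ≡ q ⊙ y′
  saturated q w y (p ∷ ps) eq = to (inv (dual e)) (0ℤ ∷ proj₁ rest) , (begin
      y                                               ≡⟨ inv-to (dual e) y ⟨
      to (inv (dual e)) y*                            ≡⟨ cong (to (inv (dual e))) (head∷tail y*) ⟨
      to (inv (dual e)) (head y* ∷ tail y*)           ≡⟨ cong (to (inv (dual e))) (cong₂ _∷_ (trans y₀≡0 (sym (ℤₚ.*-zeroʳ q))) (proj₂ rest)) ⟩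
      to (inv (dual e)) (q ⊙ (0ℤ ∷ proj₁ rest))       ≡⟨ ⊙-homo (to-linear (inv (dual e))) q (0ℤ ∷ proj₁ rest) ⟩
      q ⊙ to (inv (dual e)) (0ℤ ∷ proj₁ rest)         ∎)
    where
    open ≡-Reasoning
    y* = to (dual e) y
    pairing : ∀ b → dot b y ≡ head (to e b) ℤ.* head y* ℤ.+ dot (tail (to e b)) (tail y*)
    pairing b = trans (sym (dot-dual e b y)) (dot-cons (to e b) y*)
    gy₀≡0 : g ℤ.* head y* ≡ 0ℤ
    gy₀≡0 = trans (sym (trans (cong (λ t → head t ℤ.* head y* ℤ.+ dot (tail t) (tail y*)) eg)
      (trans (cong (λ t → g ℤ.* head y* ℤ.+ t) (dot-𝟘ˡ (tail y*))) (ℤₚ.+-identityʳ (g ℤ.* head y*)))))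
      (trans (sym (pairing a)) p)
    y₀≡0 : head y* ≡ 0ℤ
    y₀≡0 with ℤₚ.i*j≡0⇒i≡0∨j≡0 g gy₀≡0
    ... | inj₁ g≡0 = ⊥-elim (g≢0 g≡0)
    ... | inj₂ y≡0 = y≡0
    tail-orthogonal : ∀ {b} → dot b y ≡ 0ℤ → dot (tail (to e b)) (tail y*) ≡ 0ℤ
    tail-orthogonal {b} p = trans (sym (trans (cong (λ t → head (to e b) ℤ.* t ℤ.+ dot (tail (to e b)) (tail y*)) y₀≡0)
      (trans (cong (ℤ._+ dot (tail (to e b)) (tail y*)) (ℤₚ.*-zeroʳ (head (to e b)))) (ℤₚ.+-identityˡ _))))
      (trans (sym (pairing b)) p)
    rest = κ-saturated q w (tail y*) (Allₚ.map⁺ (All.map (λ {b} → tail-orthogonal {b}) ps)) eq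

rank-decomposition : ∀ {n} (rows : List (Vec ℤ n)) → RankDecomposition rows
rank-decomposition rows = go (length rows) rows refl
  where
  go : ∀ {n} k (rows : List (Vec ℤ n)) → length rows ≡ k → RankDecomposition rows
  go {n} k [] _ = record
    { rank = 0 ; nullity = n ; rank+nullity = refl ; lattice = zero-lattice ; rows∈lattice = []
    ; κ = λ x → x ; κ-linear = id-linear ; κ-saturated = λ q w y _ e → w , e }
  go {zero} (suc k) ([] ∷ rows) len = add-zero-row refl (go k rows (ℕₚ.suc-injective len))
  go {suc n} (suc k) (a ∷ rows) len with reduce-vector a
  ... | e , g , eg with g ℤ.≟ 0ℤ
  ... | yes refl = add-zero-row (to-injective e a eg) (go k rows (ℕₚ.suc-injective len))
  ... | no g≢0   = add-row e eg g≢0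
    (go k (List.map (λ b → tail (to e b)) rows) (trans (Listₚ.length-map _ rows) (ℕₚ.suc-injective len)))

module _ {n} {rows : List (Vec ℤ n)} (D : RankDecomposition rows) where
  open RankDecomposition D

  nullity≡0⇒injective : nullity ≡ 0 → ∀ y → All (λ a → dot a y ≡ 0ℤ) rows → y ≡ 𝟘
  nullity≡0⇒injective s≡0 y ps with κ-saturated 0ℤ (κ y) y ps (trans (empty nullity s≡0 (κ y)) (sym (⊙-zeroˡ (κ y))))
    where
    empty : ∀ s → s ≡ 0 → (x : Vec ℤ s) → x ≡ 𝟘
    empty zero refl [] = refl
  ... | y′ , eq = trans eq (⊙-zeroˡ y′)

  rank≡0⇒rows≡𝟘 : rank ≡ 0 → All (_≡ 𝟘) rows
  rank≡0⇒rows≡𝟘 r≡0 = All.map (λ {x} p → Lattice.τ-inj lattice x p (empty rank r≡0 _)) rows∈lattice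
    where
    empty : ∀ s → s ≡ 0 → (x : Vec ℤ s) → x ≡ 𝟘
    empty zero refl [] = refl

  -- Two solutions in the box congruent modulo 2T+1 in the coordinates κ differ by a multiple of 2T+1.
  atmost-solutions : ∀ T (c : Vec ℤ n → ℤ) →
    Atmost (λ y → Bounded T y × All (λ a → dot a y ≡ c a) rows) (suc (2 * T) ^ nullity)
  atmost-solutions T c = subst (Atmost _) (∏-replicate nullity (suc (2 * T)))
    (atmost-residues (replicate nullity (suc (2 * T))) (positive nullity) (λ y z → κ y ≡ z) (λ _ → _ , refl)
      λ { {x} {y} {_} {_} {w} (bx , px) (by , py) refl refl eq →
        let diff : All (λ a → dot a (x ⊖ y) ≡ 0ℤ) rows
            diff = All.zipWith (λ {a} (p , q) → orthogonal a x y (trans p (sym q))) (px , py)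
            y′ , eq′ = κ-saturated (+ suc (2 * T)) w (x ⊖ y) diff
              (trans (⊖-homo κ-linear x y) (trans eq (scale-replicate (suc (2 * T)) w)))
            y′≡0 = small-multiple (suc (2 * T)) y′ ℕₚ.≤-refl
              (subst (Bounded (2 * T)) eq′ (bounded-≤ (ℕₚ.≤-reflexive (cong (λ t → T + t) (sym (ℕₚ.+-identityʳ T)))) (bounded-⊖ bx by)))
        in x⊖y≡𝟘⇒x≡y x y (trans eq′ (trans (cong (+ suc (2 * T) ⊙_) y′≡0) (⊙-zeroʳ (+ suc (2 * T))))) })
    where
    positive : ∀ k → VAll.All (λ q → 0 < q) (replicate k (suc (2 * T)))
    positive zero    = []
    positive (suc k) = s≤s z≤n ∷ positive k
    ∏-replicate : ∀ k q → ∏ (replicate k q) ≡ q ^ k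
    ∏-replicate zero    q = refl
    ∏-replicate (suc k) q = cong (q *_) (∏-replicate k q)
    scale-replicate : ∀ {k} q (w : Vec ℤ k) → scaleBy (replicate k q) w ≡ + q ⊙ w
    scale-replicate q []      = refl
    scale-replicate q (a ∷ w) = cong (+ q ℤ.* a ∷_) (scale-replicate q w)
    orthogonal : ∀ a x y → dot a x ≡ dot a y → dot a (x ⊖ y) ≡ 0ℤ
    orthogonal a x y p = trans (dot-⊕ʳ a x ((- 1ℤ) ⊙ y)) (trans (cong₂ ℤ._+_ p (dot-⊙ʳ (- 1ℤ) a y)) (eq (dot a y)))
      where
      eq : ∀ t → t ℤ.+ (- 1ℤ) ℤ.* t ≡ 0ℤ
      eq = solve-∀

-- Construction of reduced bases, level by level

Sized : ∀ {n k} → Vec (Vec ℤ n) k → Vec ℕ k → Set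
Sized []       []       = ⊤
Sized {k = suc k} (b ∷ bs) (e ∷ es) = Bounded (2 ^ (e + suc k)) b × Sized bs es

-- The construction stops at level `h`, possibly with fewer than `t` vectors. Their span contains
-- the vectors of `L` in the box, which suffices for bounded rank. The determinant count needs a
-- basis of all of `L` and has to show that `size` is `t`.
record ReducedBasis {n t} (L : Lattice n t) (h : ℕ) : Set where
  field
    {size}   : ℕ
    size≤    : size ≤ t
    basis    : Vec (Vec ℤ n) size
    levels   : Vec ℕ size
    good     : Good h basis levels
    sized    : Sized basis levels
    basis∈   : VAll.All (Mem L) basis
    short    : ∀ x → Mem L x → Bounded (θ h) x → ∃[ z ] x ≡ comb z basis
    full     : size ≡ t → ∀ x → Mem L x → ∃[ z ] x ≡ comb z basis

divide-vector : ∀ {k} g → g ≢ 0ℤ → (z : Vec ℤ k) → ∃[ q ] ∃[ ρ ] z ≡ ρ ⊕ g ⊙ q × Bounded ∣ g ∣ ρ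
divide-vector g g≢0 []      = [] , [] , refl , []
divide-vector g g≢0 (a ∷ z) with divide-vector g g≢0 z
... | q , ρ , e , b = a ℤ/./ g ∷ q , + (a ℤ/.% g) ∷ ρ ,
    cong₂ _∷_ (trans (ℤ/.a≡a%n+[a/n]*n a g) (cong (λ t → + (a ℤ/.% g) ℤ.+ t) (ℤₚ.*-comm (a ℤ/./ g) g))) e ,
    ℕₚ.<⇒≤ (ℤ/.n%d<d a g) ∷ b
  where instance _ = ℤ.≢-nonZero g≢0

bounded-cancel : ∀ {n M S} g → g ≢ 0ℤ → (x : Vec ℤ n) → Bounded (M + ∣ g ∣ * S) (g ⊙ x) → Bounded (M + S) x
bounded-cancel g g≢0 []      []       = []
bounded-cancel {M = M} {S} g g≢0 (a ∷ x) (p ∷ ps) = ℕₚ.*-cancelˡ-≤ ∣ g ∣ (begin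
    ∣ g ∣ * ∣ a ∣              ≡⟨ ℤₚ.∣i*j∣≡∣i∣*∣j∣ g a ⟨
    ∣ g ℤ.* a ∣                ≤⟨ p ⟩
    M + ∣ g ∣ * S              ≤⟨ ℕₚ.+-monoˡ-≤ (∣ g ∣ * S) (ℕₚ.m≤n*m M ∣ g ∣) ⟩
    ∣ g ∣ * M + ∣ g ∣ * S      ≡⟨ ℕₚ.*-distribˡ-+ ∣ g ∣ M S ⟨
    ∣ g ∣ * (M + S)            ∎) ∷ bounded-cancel g g≢0 x ps
  where
  open ℕₚ.≤-Reasoning
  instance _ = ℤ.≢-nonZero g≢0

-- `S` stands for the sum of the sup norms of `bs`, expressed through its effect on combinations
-- with coefficients at most `R`.
Weight : ∀ {n k} → ℕ → Vec (Vec ℤ n) k → Set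
Weight S bs = ∀ R ρ → Bounded R ρ → Bounded (R * S) (comb ρ bs)

weight-∷ : ∀ {n k S M} {b : Vec ℤ n} {bs : Vec (Vec ℤ n) k} → Bounded M b → Weight S bs → Weight (M + S) (b ∷ bs)
weight-∷ {S = S} {M} pb pw R (a ∷ ρ) (p ∷ ps) =
  bounded-≤ (ℕₚ.≤-reflexive (sym (ℕₚ.*-distribˡ-+ R M S))) (bounded-⊕ (bounded-⊙ {c = a} p pb) (pw R ρ ps))

bounded-0 : ∀ {n} {x : Vec ℤ n} → Bounded 0 x → x ≡ 𝟘
bounded-0 {x = []}    []       = refl
bounded-0 {x = a ∷ x} (p ∷ ps) = cong₂ _∷_ (ℤₚ.∣i∣≡0⇒i≡0 (ℕₚ.n≤0⇒n≡0 p)) (bounded-0 ps)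

module _ {n t₀} (L : Lattice n t₀) (h : ℕ) where
  private module L = Lattice L

  mem-comb : ∀ {k} {bs : Vec (Vec ℤ n) k} → VAll.All (Mem L) bs → ∀ z → Mem L (comb z bs)
  mem-comb ps z = linear-comb L.β-linear z _ ps

  -- e is the level reached: every vector of L with entries below 2^e lies in the span of the basis so far,
  -- and τ records the coordinates that are not yet covered by it.
  record State (e k t : ℕ) : Set where
    field
      k+t≡t₀   : k + t ≡ t₀
      bs       : Vec (Vec ℤ n) k
      es       : Vec ℕ k
      good     : Good h bs es
      sized    : Sized bs es
      es≤e     : VAll.All (_≤ e) es
      bs∈L     : VAll.All (Mem L) bs
      S        : ℕ
      weight   : Weight S bs
      -- The left side bounds the next basis vector: reduction by the earlier ones costs `S`, and
      -- the short vector it comes from has entries below 2^(e + 1). Adding that vector at most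
      -- doubles the left side, hence the growth with `k` here and in `Sized`.
      S-bound  : S + 2 ^ suc e ≤ 2 ^ (e + suc k)
      τ        : Vec ℤ n → Vec ℤ t
      τ-linear : Linear τ
      τ-surj   : ∀ w → ∃[ x ] Mem L x × τ x ≡ w
      τ-bs     : VAll.All (λ b → τ b ≡ 𝟘) bs
      τ-ker    : ∀ x → Mem L x → τ x ≡ 𝟘 → ∃[ z ] x ≡ comb z bs
      τ-short  : ∀ x → Mem L x → Bounded (θ e) x → τ x ≡ 𝟘

  initial : State 0 0 t₀
  initial = record
    { k+t≡t₀ = refl ; bs = [] ; es = [] ; good = tt ; sized = tt ; es≤e = [] ; bs∈L = []
    ; S = 0 ; weight = λ { R [] [] → bounded-𝟘 } ; S-bound = ℕₚ.≤-refl
    ; τ = L.τ ; τ-linear = L.τ-linear ; τ-surj = L.τ-surj ; τ-bs = []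
    ; τ-ker = λ x p q → [] , L.τ-inj x p q
    ; τ-short = λ x _ b → trans (cong L.τ (bounded-0 b)) (𝟘-homo L.τ-linear) }

  raise : ∀ {e k t} (s : State e k t) →
    (∀ x → Mem L x → Bounded (θ (suc e)) x → State.τ s x ≡ 𝟘) → State (suc e) k t
  raise {e} {k} s short = record
    { k+t≡t₀ = k+t≡t₀ ; bs = bs ; es = es ; good = good ; sized = sized ; es≤e = VAll.map ℕₚ.m≤n⇒m≤1+n es≤e ; bs∈L = bs∈L
    ; S = S ; weight = weight ; S-bound = bound
    ; τ = τ ; τ-linear = τ-linear ; τ-surj = τ-surj ; τ-bs = τ-bs ; τ-ker = τ-ker ; τ-short = short }
    where
    open State s
    open ℕₚ.≤-Reasoning
    bound : S + 2 ^ suc (suc e) ≤ 2 ^ (suc e + suc k)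
    bound = begin
      S + 2 * 2 ^ suc e            ≤⟨ ℕₚ.+-monoˡ-≤ (2 * 2 ^ suc e) (ℕₚ.m≤n*m S 2) ⟩
      2 * S + 2 * 2 ^ suc e        ≡⟨ ℕₚ.*-distribˡ-+ 2 S (2 ^ suc e) ⟨
      2 * (S + 2 ^ suc e)          ≤⟨ ℕₚ.*-monoʳ-≤ 2 S-bound ⟩
      2 * 2 ^ (e + suc k)          ∎

  -- With g the content of τ x, some b ≡ x / g modulo the span of bs works; reducing the coordinates
  -- modulo g keeps it short.
  enlarge : ∀ {e k t} (s : State e k (suc t)) → e ≤ h → ∀ x → Mem L x → Bounded (θ (suc e)) x →
    State.τ s x ≢ 𝟘 → State e (suc k) t
  enlarge {e} {k} {t} s e≤h x x∈ bx τx≢0 = record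
    { k+t≡t₀ = trans (sym (ℕₚ.+-suc k t)) k+t≡t₀
    ; bs = b ∷ bs ; es = e ∷ es ; good = separated , e≤h , es≤e , good
    ; sized = bounded-≤ M≤ b-bound , sized
    ; es≤e = ℕₚ.≤-refl ∷ es≤e ; bs∈L = b∈ ∷ bs∈L
    ; S = M + S ; weight = weight-∷ b-bound weight ; S-bound = S-bound′
    ; τ = λ y → tail (to ε (τ y)) ; τ-linear = ∘-linear tail-linear ψτ-linear
    ; τ-surj = λ w → let y , p , q = τ-surj (to (inv ε) (0ℤ ∷ w)) in
        y , p , cong tail (trans (cong (to ε) q) (to-inv ε (0ℤ ∷ w)))
    ; τ-bs = cong tail ψτb ∷ VAll.map (λ p → cong tail (trans (cong (to ε) p) (𝟘-homo (to-linear ε)))) τ-bs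
    ; τ-ker = kernel
    ; τ-short = λ y p q → cong tail (trans (cong (to ε) (τ-short y p q)) (𝟘-homo (to-linear ε))) }
    where
    open State s
    reduced = reduce-vector (τ x)
    ε = proj₁ reduced
    g = proj₁ (proj₂ reduced)
    ψτx : to ε (τ x) ≡ g ∷ 𝟘
    ψτx = proj₂ (proj₂ reduced)
    ψτ-linear : Linear (λ y → to ε (τ y))
    ψτ-linear = ∘-linear (to-linear ε) τ-linear
    g≢0 : g ≢ 0ℤ
    g≢0 g≡0 = τx≢0 (to-injective ε (τ x) (trans ψτx (cong (_∷ 𝟘) g≡0)))
    unit : Vec ℤ (suc t)
    unit = 1ℤ ∷ 𝟘
    c-data = τ-surj (to (inv ε) unit)
    c = proj₁ c-data
    c∈ : Mem L c
    c∈ = proj₁ (proj₂ c-data)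
    ψτc : to ε (τ c) ≡ unit
    ψτc = trans (cong (to ε) (proj₂ (proj₂ c-data))) (to-inv ε unit)
    multiple : ∀ a y → to ε (τ y) ≡ a ∷ 𝟘 → ∀ d → to ε (τ d) ≡ unit → τ (y ⊖ a ⊙ d) ≡ 𝟘
    multiple a y p d q = to-injective ε _ (begin
      to ε (τ (y ⊖ a ⊙ d))                     ≡⟨ ⊖-homo ψτ-linear y (a ⊙ d) ⟩
      to ε (τ y) ⊖ to ε (τ (a ⊙ d))            ≡⟨ cong₂ _⊖_ p (trans (⊙-homo ψτ-linear a d) (trans (cong (a ⊙_) q) (cong₂ _∷_ (ℤₚ.*-identityʳ a) (⊙-zeroʳ a)))) ⟩
      (a ∷ 𝟘) ⊖ (a ∷ 𝟘)                        ≡⟨ x⊖x≡𝟘 (a ∷ 𝟘) ⟩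
      𝟘                                        ∎)
      where open ≡-Reasoning
    -- `c` lifts the first unit vector, so `x` and `g ⊙ c` agree modulo the span of `bs`. Moving the
    -- quotients of `z` by `g` into `c` gives a `b` for which `g ⊙ b` is `x` minus a combination
    -- with coefficients at most `∣ g ∣`; cancelling `g` leaves a bound independent of it.
    z-data = τ-ker (x ⊖ g ⊙ c) (L.mem-⊖ x∈ (L.mem-⊙ g c∈)) (multiple g x ψτx c ψτc)
    z = proj₁ z-data
    q-data = divide-vector g g≢0 z
    q = proj₁ q-data
    ρ = proj₁ (proj₂ q-data)
    ρ-bound : Bounded ∣ g ∣ ρ
    ρ-bound = proj₂ (proj₂ (proj₂ q-data))
    b = c ⊕ comb q bs
    b∈ : Mem L b
    b∈ = L.mem-⊕ c∈ (mem-comb bs∈L q)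
    ψτb : to ε (τ b) ≡ unit
    ψτb = trans (cong (to ε) (trans (⊕-homo τ-linear c (comb q bs))
      (trans (cong (τ c ⊕_) (linear-comb τ-linear q bs τ-bs)) (⊕-identityʳ (τ c))))) ψτc
    gb≡ : g ⊙ b ≡ x ⊖ comb ρ bs
    gb≡ = begin
      g ⊙ (c ⊕ comb q bs)                                   ≡⟨ ⊙-distribˡ g c (comb q bs) ⟩
      g ⊙ c ⊕ g ⊙ comb q bs                                 ≡⟨ cong (g ⊙ c ⊕_) (⊙-homo (comb-linear bs) g q) ⟨
      g ⊙ c ⊕ comb (g ⊙ q) bs                               ≡⟨ cong (g ⊙ c ⊕_) (x⊕y⊖x≡y (comb ρ bs) (comb (g ⊙ q) bs)) ⟨
      g ⊙ c ⊕ ((comb ρ bs ⊕ comb (g ⊙ q) bs) ⊖ comb ρ bs)   ≡⟨ cong (λ v → g ⊙ c ⊕ (v ⊖ comb ρ bs)) (sym (⊕-homo (comb-linear bs) ρ (g ⊙ q))) ⟩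
      g ⊙ c ⊕ (comb (ρ ⊕ g ⊙ q) bs ⊖ comb ρ bs)             ≡⟨ cong (λ v → g ⊙ c ⊕ (comb v bs ⊖ comb ρ bs)) (proj₁ (proj₂ (proj₂ q-data))) ⟨
      g ⊙ c ⊕ (comb z bs ⊖ comb ρ bs)                       ≡⟨ ⊕-assoc (g ⊙ c) (comb z bs) _ ⟨
      (g ⊙ c ⊕ comb z bs) ⊖ comb ρ bs                       ≡⟨ cong (_⊖ comb ρ bs) (trans (⊕-comm (g ⊙ c) (comb z bs)) (trans (cong (_⊕ g ⊙ c) (sym (proj₂ z-data))) (x⊖y⊕y≡x x (g ⊙ c)))) ⟩
      x ⊖ comb ρ bs                                         ∎
      where open ≡-Reasoning
    M = θ (suc e) + S
    b-bound : Bounded M b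
    b-bound = bounded-cancel g g≢0 b (subst (Bounded (θ (suc e) + ∣ g ∣ * S)) (sym gb≡)
      (bounded-⊖ bx (weight ∣ g ∣ ρ ρ-bound)))
    M≤ : M ≤ 2 ^ (e + suc k)
    M≤ = begin
      θ (suc e) + S         ≤⟨ ℕₚ.+-monoˡ-≤ S (ℕₚ.m∸n≤m (2 ^ suc e) 1) ⟩
      2 ^ suc e + S         ≡⟨ ℕₚ.+-comm (2 ^ suc e) S ⟩
      S + 2 ^ suc e         ≤⟨ S-bound ⟩
      2 ^ (e + suc k)       ∎
      where open ℕₚ.≤-Reasoning
    S-bound′ : (M + S) + 2 ^ suc e ≤ 2 ^ (e + suc (suc k))
    S-bound′ = begin
      (M + S) + 2 ^ suc e                     ≡⟨ ℕₚ.+-assoc M S (2 ^ suc e) ⟩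
      M + (S + 2 ^ suc e)                     ≤⟨ ℕₚ.+-mono-≤ M≤ S-bound ⟩
      2 ^ (e + suc k) + 2 ^ (e + suc k)       ≡⟨ cong (λ v → 2 ^ (e + suc k) + v) (ℕₚ.+-identityʳ (2 ^ (e + suc k))) ⟨
      2 ^ suc (e + suc k)                     ≡⟨ cong (2 ^_) (ℕₚ.+-suc e (suc k)) ⟨
      2 ^ (e + suc (suc k))                   ∎
      where open ℕₚ.≤-Reasoning
    -- The first coordinate of `to ε (τ _)` reads off the coefficient of `b`, and vectors of `L`
    -- that are short at level `e` are killed by `τ`.
    separated : ∀ a zs → Bounded (θ e) (a ⊙ b ⊕ comb zs bs) → a ≡ 0ℤ
    separated a zs bd = trans (sym (ℤₚ.*-identityʳ a)) (cong head (begin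
      a ⊙ unit                                 ≡⟨ cong (a ⊙_) ψτb ⟨
      a ⊙ to ε (τ b)                           ≡⟨ ⊙-homo ψτ-linear a b ⟨
      to ε (τ (a ⊙ b))                         ≡⟨ cong (to ε) (⊕-identityʳ (τ (a ⊙ b))) ⟨
      to ε (τ (a ⊙ b) ⊕ 𝟘)                     ≡⟨ cong (λ v → to ε (τ (a ⊙ b) ⊕ v)) (linear-comb τ-linear zs bs τ-bs) ⟨
      to ε (τ (a ⊙ b) ⊕ τ (comb zs bs))        ≡⟨ cong (to ε) (⊕-homo τ-linear (a ⊙ b) (comb zs bs)) ⟨
      to ε (τ (a ⊙ b ⊕ comb zs bs))            ≡⟨ cong (to ε) (τ-short _ (L.mem-⊕ (L.mem-⊙ a b∈) (mem-comb bs∈L zs)) bd) ⟩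
      to ε 𝟘                                   ≡⟨ 𝟘-homo (to-linear ε) ⟩
      𝟘                                        ∎))
      where open ≡-Reasoning
    kernel : ∀ y → Mem L y → tail (to ε (τ y)) ≡ 𝟘 → ∃[ z ] y ≡ comb z (b ∷ bs)
    kernel y y∈ p =
      let a = head (to ε (τ y))
          zs , eq = τ-ker (y ⊖ a ⊙ b) (L.mem-⊖ y∈ (L.mem-⊙ a b∈))
            (multiple a y (trans (sym (head∷tail (to ε (τ y)))) (cong (a ∷_) p)) b ψτb)
      in a ∷ zs , trans (sym (x⊖y⊕y≡x y (a ⊙ b))) (trans (cong (_⊕ a ⊙ b) eq) (⊕-comm (comb zs bs) (a ⊙ b)))

  finish : ∀ {k t} → State h k t → ReducedBasis L h
  finish {k} {t} s = record
    { size≤ = subst (k ≤_) k+t≡t₀ (ℕₚ.m≤m+n k t) ; basis = bs ; levels = es ; good = good ; sized = sized ; basis∈ = bs∈L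
    ; short = λ x x∈ bx → τ-ker x x∈ (τ-short x x∈ bx)
    ; full = λ k≡t₀ x x∈ → τ-ker x x∈ (empty t (ℕₚ.+-cancelˡ-≡ k t 0 (trans k+t≡t₀ (trans (sym k≡t₀) (sym (ℕₚ.+-identityʳ k))))) (τ x)) }
    where
    open State s
    empty : ∀ s → s ≡ 0 → (x : Vec ℤ s) → x ≡ 𝟘
    empty zero refl [] = refl

  search : ∀ {e k t} (s : State e k t) →
    (∃[ x ] Mem L x × Bounded (θ (suc e)) x × State.τ s x ≢ 𝟘) ⊎
    (∀ x → Mem L x → Bounded (θ (suc e)) x → State.τ s x ≡ 𝟘)
  search {e} s with Any.any? (λ x → (L.β x ≟ᵛ 𝟘) ×-dec ¬? (State.τ s x ≟ᵛ 𝟘)) (vecsOf n (range (θ (suc e))))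
  ... | yes found = let x , x∈box , x∈L , τx≢0 = find found in inj₁ (x , x∈L , ∈-box⁻ x∈box , τx≢0)
  ... | no none = inj₂ λ x x∈L bx → decidable-stable (State.τ s x ≟ᵛ 𝟘) λ τx≢0 →
    none (Any.map (λ { refl → x∈L , τx≢0 }) (∈-box⁺ bx))

  -- Each step either raises the level, which lowers `f`, or adds a basis vector at the same level,
  -- which lowers `t`; several basis vectors may share a level.
  run : ∀ f {e k} t → e + f ≡ h → State e k t → ReducedBasis L h
  run zero {e} {k} t eq s = finish (subst (λ i → State i k t) (trans (sym (ℕₚ.+-identityʳ e)) eq) s)
  run (suc f) {e} zero eq s = run f zero (trans (sym (ℕₚ.+-suc e f)) eq) (raise s λ _ _ _ → empty _)
    where
    empty : (x : Vec ℤ 0) → x ≡ 𝟘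
    empty [] = refl
  run (suc f) {e} (suc t) eq s with search s
  ... | inj₁ (x , x∈ , bx , τx≢0) = run (suc f) t eq (enlarge s (subst (e ≤_) eq (ℕₚ.m≤m+n e (suc f))) x x∈ bx τx≢0)
  ... | inj₂ short = run f (suc t) (trans (sym (ℕₚ.+-suc e f)) eq) (raise s short)

  reduced-basis : ReducedBasis L h
  reduced-basis = run h t₀ refl initial

-- Counting matrices through reduced bases of their rows

sizedBases : ∀ n {k} → Vec ℕ k → List (Vec (Vec ℤ n) k)
sizedBases n []                   = [] ∷ []
sizedBases n {suc k} (e ∷ es) =
  List.cartesianProductWith _∷_ (vecsOf n (range (2 ^ (e + suc k)))) (sizedBases n es)

∈-sizedBases : ∀ {n k} (bs : Vec (Vec ℤ n) k) es → Sized bs es → bs ∈ sizedBases n es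
∈-sizedBases []       []       _       = here refl
∈-sizedBases (b ∷ bs) (e ∷ es) (p , s) =
  ∈ₚ.∈-cartesianProductWith⁺ _∷_ (∈-box⁺ p) (∈-sizedBases bs es s)

good⇒levels≤ : ∀ {n k h} (bs : Vec (Vec ℤ n) k) es → Good h bs es → VAll.All (_≤ h) es
good⇒levels≤ []       []       _                 = []
good⇒levels≤ (b ∷ bs) (e ∷ es) (_ , e≤h , _ , g) = e≤h ∷ good⇒levels≤ bs es g

^-distribʳ-* : ∀ m n k → (m * n) ^ k ≡ m ^ k * n ^ k
^-distribʳ-* m n zero    = refl
^-distribʳ-* m n (suc k) = trans (cong (m * n *_) (^-distribʳ-* m n k)) (ℕₚ.[m*n]*[o*p]≡[m*o]*[n*p] m n (m ^ k) (n ^ k))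

-- With 2^h about `H` this is O(Hⁿ), the price of one unit of rank. The summand `n + 2` pays for the
-- factor 2^k in `Sized`, where k ≤ n, and for the factor 4 that bounds the side 2N + 1 of a box by
-- 4N.
Q : ℕ → ℕ → ℕ
Q h n = (2 ^ (h + (n + 2))) ^ n

-- Minkowski: the bound 2^(e+k) for each basis vector and the index 2^(h-e) compensate.
bases×points≤ : ∀ {n k} h (es : Vec ℕ k) → VAll.All (_≤ h) es → k ≤ n →
  length (sizedBases n es) * ∏ (indices h es) ^ n ≤ Q h n ^ k
bases×points≤ {n} h []       []       k≤n = ℕₚ.≤-reflexive (trans (ℕₚ.*-identityˡ (1 ^ n)) (ℕₚ.^-zeroˡ n))
bases×points≤ {n} {suc k} h (e ∷ es) (e≤h ∷ es≤h) k<n = begin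
  length (List.cartesianProductWith _∷_ box (sizedBases n es)) * (ι * ∏ (indices h es)) ^ n
    ≡⟨ cong₂ _*_ (length-product _∷_ box (sizedBases n es)) (^-distribʳ-* ι (∏ (indices h es)) n) ⟩
  (length box * length (sizedBases n es)) * (ι ^ n * ∏ (indices h es) ^ n)
    ≡⟨ ℕₚ.[m*n]*[o*p]≡[m*o]*[n*p] (length box) (length (sizedBases n es)) (ι ^ n) (∏ (indices h es) ^ n) ⟩
  (length box * ι ^ n) * (length (sizedBases n es) * ∏ (indices h es) ^ n)
    ≤⟨ ℕₚ.*-mono-≤ first (bases×points≤ h es es≤h (ℕₚ.<⇒≤ k<n)) ⟩
  Q h n * Q h n ^ k ∎
  where
  open ℕₚ.≤-Reasoning
  box = vecsOf n (range (2 ^ (e + suc k)))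
  ι = 2 ^ (h ∸ e)
  two : suc (2 * 2 ^ (e + suc k)) ≤ 2 ^ (e + suc k + 2)
  two = begin
    suc (2 * p)      ≤⟨ ℕₚ.+-monoˡ-≤ (2 * p) (ℕₚ.m^n>0 2 (e + suc k)) ⟩
    p + 2 * p        ≤⟨ ℕₚ.m≤m+n (p + 2 * p) p ⟩
    p + 2 * p + p    ≡⟨ eq p ⟩
    p * 2 ^ 2        ≡⟨ ℕₚ.^-distribˡ-+-* 2 (e + suc k) 2 ⟨
    2 ^ (e + suc k + 2) ∎
    where
    p = 2 ^ (e + suc k)
    eq : ∀ p → p + 2 * p + p ≡ p * 4
    eq = solve-∀ℕ
  exponent : e + suc k + 2 + (h ∸ e) ≤ h + (n + 2)
  exponent = begin
    e + suc k + 2 + (h ∸ e)     ≡⟨ eq e (suc k) (h ∸ e) ⟩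
    (h ∸ e + e) + (suc k + 2)   ≡⟨ cong (_+ (suc k + 2)) (ℕₚ.m∸n+n≡m e≤h) ⟩
    h + (suc k + 2)             ≤⟨ ℕₚ.+-monoʳ-≤ h (ℕₚ.+-monoˡ-≤ 2 k<n) ⟩
    h + (n + 2)                 ∎
    where
    eq : ∀ e k d → e + k + 2 + d ≡ (d + e) + (k + 2)
    eq = solve-∀ℕ
  first : length box * ι ^ n ≤ Q h n
  first = begin
    length box * ι ^ n                                  ≡⟨ cong (_* ι ^ n) (length-box n (2 ^ (e + suc k))) ⟩
    suc (2 * 2 ^ (e + suc k)) ^ n * ι ^ n               ≡⟨ ^-distribʳ-* (suc (2 * 2 ^ (e + suc k))) ι n ⟨
    (suc (2 * 2 ^ (e + suc k)) * ι) ^ n                 ≤⟨ ℕₚ.^-monoˡ-≤ n (ℕₚ.*-monoˡ-≤ ι two) ⟩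
    (2 ^ (e + suc k + 2) * ι) ^ n                       ≡⟨ cong (_^ n) (ℕₚ.^-distribˡ-+-* 2 (e + suc k + 2) (h ∸ e)) ⟨
    (2 ^ (e + suc k + 2 + (h ∸ e))) ^ n                 ≤⟨ ℕₚ.^-monoˡ-≤ n (ℕₚ.^-monoʳ-≤ 2 exponent) ⟩
    Q h n                                               ∎

Q>0 : ∀ h n → 0 < Q h n
Q>0 h n = ℕₚ.m^n>0 (2 ^ (h + (n + 2))) {{ℕₚ.m^n≢0 2 (h + (n + 2))}} n

-- The scheme shared by both matrix counts. Elements are sorted by size, levels and reduced basis,
-- and `R` records how an element depends on its basis. `F` counts the choices beyond n points of
-- the span: 1 for bounded rank, the number of divisors for divisors of `d`. Bases and points
-- compensate for each choice of levels, so levels contribute only their number, at most (h + 1)^r.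
module _ {X : Set} {P : X → Set} {n : ℕ} (h r F : ℕ) (r≤n : r ≤ n)
  (R : X → ∀ k → Vec (Vec ℤ n) k → Set)
  (bases : ∀ {x} → P x → ∃[ k ] k ≤ r × ∃[ bs ] ∃[ es ] Good h bs es × Sized bs es × R x k bs)
  (fibres : ∀ {k} (bs : Vec (Vec ℤ n) k) es → Good h bs es → Atmost (λ x → P x × R x k bs) (F * ∏ (indices h es) ^ n))
  where

  private
    OfLevels : ∀ k → X → Vec ℕ k → Set
    OfLevels k x es = k ≤ r × ∃[ bs ] Good h bs es × Sized bs es × R x k bs

    OfSize : X → ℕ → Set
    OfSize x k = ∃ (OfLevels k x)

    fixed-levels : ∀ k es → Atmost (λ x → P x × OfLevels k x es) (F * Q h n ^ k)
    fixed-levels k es = atmost-inhabited λ { x (_ , k≤r , bs₀ , g₀ , _) →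
      atmost-≤ (bound (ℕₚ.≤-trans k≤r r≤n) (good⇒levels≤ bs₀ es g₀))
        (atmost-cover (λ x bs → Good h bs es × R x k bs) (sizedBases n es)
          (λ { (_ , _ , bs , g , s , ρ) → Any.map (λ { refl → g , ρ }) (∈-sizedBases bs es s) })
          λ bs → atmost-inhabited λ { _ (_ , g , _) →
            atmost-⊆ (λ { ((p , _) , _ , ρ) → p , ρ }) (fibres bs es g) }) }
      where
      open ℕₚ.≤-Reasoning
      bound : k ≤ n → VAll.All (_≤ h) es → length (sizedBases n es) * (F * ∏ (indices h es) ^ n) ≤ F * Q h n ^ k
      bound k≤n es≤h = begin
        length (sizedBases n es) * (F * ∏ (indices h es) ^ n)  ≡⟨ eq (length (sizedBases n es)) F (∏ (indices h es) ^ n) ⟩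
        F * (length (sizedBases n es) * ∏ (indices h es) ^ n)  ≤⟨ ℕₚ.*-monoʳ-≤ F (bases×points≤ h es es≤h k≤n) ⟩
        F * Q h n ^ k                                          ∎
        where
        eq : ∀ a b c → a * (b * c) ≡ b * (a * c)
        eq = solve-∀ℕ

    fixed-size : ∀ k → Atmost (λ x → P x × OfSize x k) (suc h ^ r * (F * Q h n ^ r))
    fixed-size k = atmost-inhabited λ { _ (_ , _ , k≤r , _) →
      atmost-≤ (ℕₚ.*-mono-≤ (ℕₚ.≤-trans (ℕₚ.≤-reflexive length-levels) (ℕₚ.^-monoʳ-≤ (suc h) k≤r))
          (ℕₚ.*-monoʳ-≤ F (ℕₚ.^-monoʳ-≤ (Q h n) {{>-nonZero (Q>0 h n)}} k≤r)))
        (atmost-cover (OfLevels k) (vecsOf k (List.upTo (suc h)))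
          (λ { (_ , es , k≤r , bs , g , ρ) → Any.map (λ { refl → k≤r , bs , g , ρ })
            (∈-vecsOf⁺ es (VAll.map (λ e≤h → ∈ₚ.∈-upTo⁺ (s≤s e≤h)) (good⇒levels≤ bs es g))) })
          λ es → atmost-⊆ (λ { ((p , _) , ρ) → p , ρ }) (fixed-levels k es)) }
      where
      length-levels : length (vecsOf k (List.upTo (suc h))) ≡ suc h ^ k
      length-levels = trans (length-vecsOf k (List.upTo (suc h))) (cong (_^ k) (Listₚ.length-upTo (suc h)))

  atmost-reduced : Atmost P (suc r * (suc h ^ r * (F * Q h n ^ r)))
  atmost-reduced = atmost-≤ (ℕₚ.≤-reflexive (cong (_* (suc h ^ r * (F * Q h n ^ r))) (Listₚ.length-upTo (suc r))))
    (atmost-cover OfSize (List.upTo (suc r))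
      (λ p → let k , k≤r , bs , es , g , s , ρ = bases p in
        Any.map (λ { refl → es , k≤r , bs , g , s , ρ }) (∈ₚ.∈-upTo⁺ (s≤s k≤r)))
      fixed-size)

vall-zipWith : ∀ {A : Set} {P R S : A → Set} {k} {v : Vec A k} → (∀ {x} → P x × R x → S x) →
  VAll.All P v × VAll.All R v → VAll.All S v
vall-zipWith f ps = VAll.map f (VAll.zip ps)

⊖-small : ∀ {n h H} → 2 * H ≤ θ h → {x y : Vec ℤ n} → Bounded H x → Bounded H y → Bounded (θ h) (x ⊖ y)
⊖-small {H = H} 2H≤ bx by = bounded-≤ (ℕₚ.≤-trans (ℕₚ.≤-reflexive (cong (λ t → H + t) (sym (ℕₚ.+-identityʳ H)))) 2H≤) (bounded-⊖ bx by)

InSpan : ∀ {n k} → Vec (Vec ℤ n) k → Vec ℤ n → Set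
InSpan bs x = ∃[ z ] x ≡ comb z bs

inSpan-⊖ : ∀ {n k} {bs : Vec (Vec ℤ n) k} {x y} → InSpan bs x → InSpan bs y → InSpan bs (x ⊖ y)
inSpan-⊖ {bs = bs} (z , refl) (z′ , refl) = z ⊖ z′ , sym (⊖-homo (comb-linear bs) z z′)

atmost-span : ∀ {n k h H} → 2 * H ≤ θ h → (bs : Vec (Vec ℤ n) k) → ∀ es → Good h bs es →
  Atmost (λ x → Bounded H x × InSpan bs x) (∏ (indices h es))
atmost-span {h = h} 2H≤ bs es g = atmost-coset bs es g λ { (bx , px) (by , py) → ⊖-small {h = h} 2H≤ bx by , inSpan-⊖ px py }

atmost-rank≤ : ∀ n r h H → r ≤ n → 2 * H ≤ θ h →
  Atmost (λ (A : Matrix n) → VAll.All (Bounded H) A × ∃[ L ] VAll.All (Mem {n} {r} L) A)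
    (suc r * (suc h ^ r * (1 * Q h n ^ r)))
atmost-rank≤ n r h H r≤n 2H≤ = atmost-reduced h r 1 r≤n (λ A k bs → VAll.All (InSpan bs) A)
  (λ { {A} (bA , L , A∈) → let open ReducedBasis (reduced-basis L h) in
    _ , size≤ , basis , levels , good , sized ,
    vall-zipWith (λ { {x} (bx , x∈) → short x x∈ (bounded-≤ (ℕₚ.≤-trans (ℕₚ.m≤n*m H 2) 2H≤) bx) }) (bA , A∈) })
  λ bs es g → atmost-≤ (ℕₚ.≤-reflexive (sym (ℕₚ.*-identityˡ _)))
    (atmost-⊆ (λ { ((bA , _) , ρ) → vall-zipWith (λ p → p) (bA , ρ) }) (atmost-vec _≟ᵛ_ (atmost-span 2H≤ bs es g) n))

-- Matrices that divide a nonzero integer d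

act : ∀ {m n} → Vec (Vec ℤ n) m → Vec ℤ n → Vec ℤ m
act A v = Vec.map (λ a → dot a v) A

-- `g` is d times the inverse of `A`, and integral. This follows from det A = d but, unlike that
-- equation, passes with the same `d` to every factor of a matrix of determinant d.
Invertible : ∀ {n} → ℤ → Matrix n → Set
Invertible d A = ∃[ g ] Linear g × (∀ v → act A (g v) ≡ d ⊙ v) × (∀ v → g (act A v) ≡ d ⊙ v)

act-zero : ∀ {m n} (A : Vec (Vec ℤ n) m) v → VAll.All (λ a → dot a v ≡ 0ℤ) A → act A v ≡ 𝟘
act-zero []      v []       = refl
act-zero (a ∷ A) v (p ∷ ps) = cong₂ _∷_ p (act-zero A v ps)

act-zero⁻ : ∀ {m n} (A : Vec (Vec ℤ n) m) v → act A v ≡ 𝟘 → VAll.All (λ a → dot a v ≡ 0ℤ) A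
act-zero⁻ []      v e = []
act-zero⁻ (a ∷ A) v e = cong head e ∷ act-zero⁻ A v (cong tail e)

all-toList : ∀ {A : Set} {P : A → Set} {k} {v : Vec A k} → All P (Vec.toList v) → VAll.All P v
all-toList {v = []}    []       = []
all-toList {v = x ∷ v} (p ∷ ps) = p ∷ all-toList ps

length-toList : ∀ {A : Set} {k} (v : Vec A k) → length (Vec.toList v) ≡ k
length-toList []      = refl
length-toList (x ∷ v) = cong suc (length-toList v)

-- The rows below the first lie in a hyperplane lattice with a reduced basis bs, and modulo this lattice
-- the first row is a divisor of d.
module _ {n′ : ℕ} (h H : ℕ) (2H≤ : 2 * H ≤ θ h) (d : ℤ) (d≢0 : d ≢ 0ℤ)
  (ds : List ℤ) (divisors : ∀ t u → d ≡ t ℤ.* u → t ∈ ds) where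

  private
    n : ℕ
    n = suc n′

    P : Matrix n → Set
    P A = VAll.All (Bounded H) A × Invertible d A

    R : Matrix n → ∀ k → Vec (Vec ℤ n) k → Set
    R A k bs = ∃[ e ] ∃[ y ] (∀ l → head (to e l) ≡ 0ℤ → InSpan bs l)
      × dot (head A) y ≡ d × VAll.All (λ b → dot b y ≡ 0ℤ) bs × VAll.All (InSpan bs) (tail A)

    bases : ∀ {A} → P A → ∃[ k ] k ≤ n′ × ∃[ bs ] ∃[ es ] Good h bs es × Sized bs es × R A k bs
    bases {x ∷ A} (bx ∷ bA , g , g-linear , Ag , gA) =
      size , size≤ , basis , levels , good , sized , e , y , full′ , xy≡d , basis⊥y , rows
      where
      -- The first column of d times the inverse: it pairs to `d` with the first row and to 0 with
      -- the others, so it is a normal vector of the hyperplane that contains them.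
      y = g (1ℤ ∷ 𝟘)
      Ay : act (x ∷ A) y ≡ d ⊙ (1ℤ ∷ 𝟘)
      Ay = Ag (1ℤ ∷ 𝟘)
      xy≡d : dot x y ≡ d
      xy≡d = trans (cong head Ay) (ℤₚ.*-identityʳ d)
      A⊥y : VAll.All (λ a → dot a y ≡ 0ℤ) A
      A⊥y = act-zero⁻ A y (trans (cong tail Ay) (⊙-zeroʳ d))
      ε-data = reduce-vector y
      ε = proj₁ ε-data
      e = dual ε
      c = proj₁ (proj₂ ε-data)
      pairing : ∀ l → dot l y ≡ c ℤ.* head (to e l)
      pairing l = trans (dot-comm l y) (trans (sym (dot-dual ε y l)) (trans (cong (λ t → dot t (to e l)) (proj₂ (proj₂ ε-data)))
        (trans (dot-cons (c ∷ 𝟘) (to e l)) (trans (cong (λ t → c ℤ.* head (to e l) ℤ.+ t) (dot-𝟘ˡ (tail (to e l)))) (ℤₚ.+-identityʳ _)))))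
      c≢0 : c ≢ 0ℤ
      c≢0 c≡0 = d≢0 (trans (sym xy≡d) (trans (pairing x) (cong (ℤ._* head (to e x)) c≡0)))
      L = hyperplane e
      ⊥⇒∈ : ∀ {l} → dot l y ≡ 0ℤ → Mem L l
      ⊥⇒∈ {l} p with ℤₚ.i*j≡0⇒i≡0∨j≡0 c (trans (sym (pairing l)) p)
      ... | inj₁ c≡0 = ⊥-elim (c≢0 c≡0)
      ... | inj₂ q   = cong (_∷ []) q
      open ReducedBasis (reduced-basis L h)
      basis⊥y : VAll.All (λ b → dot b y ≡ 0ℤ) basis
      basis⊥y = VAll.map (λ {b} b∈ → trans (pairing b) (trans (cong (c ℤ.*_) (cong head b∈)) (ℤₚ.*-zeroʳ c))) basis∈
      rows : VAll.All (InSpan basis) A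
      rows = vall-zipWith (λ { {l} (bl , p) → short l (⊥⇒∈ {l} p) (bounded-≤ (ℕₚ.≤-trans (ℕₚ.m≤n*m H 2) 2H≤) bl) }) (bA , A⊥y)
      -- Were the basis smaller, some nonzero `u` would be orthogonal to it and to the first row,
      -- hence killed by the whole matrix, against invertibility.
      size≡n′ : size ≡ n′
      size≡n′ = ℕₚ.≤-antisym size≤ (ℕₚ.≮⇒≥ λ size<n′ →
        let u , u≢0 , ou = orthogonal-vector (x ∷ Vec.toList basis) (s≤s (subst (_< n′) (sym (length-toList basis)) size<n′))
            Au≡0 : act (x ∷ A) u ≡ 𝟘
            Au≡0 = act-zero (x ∷ A) u (All.head ou ∷ VAll.map (λ { (z , refl) → dot-comb z basis u (all-toList (All.tail ou)) }) rows)
        in u≢0 (⊙≡𝟘⇒≡𝟘 d≢0 u (trans (sym (gA u)) (trans (cong g Au≡0) (𝟘-homo g-linear)))))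
      full′ : ∀ l → head (to e l) ≡ 0ℤ → InSpan basis l
      full′ l p = full size≡n′ l (cong (_∷ []) p)

    fibres : ∀ {k} (bs : Vec (Vec ℤ n) k) es → Good h bs es →
      Atmost (λ A → P A × R A k bs) (length ds * ∏ (indices h es) ^ n)
    -- The coordinates `e` of one matrix `A₀` serve for the whole fibre, although each matrix brings
    -- its own normal vector `y`: `full` speaks of `bs` and `e` alone.
    fibres bs es g = atmost-inhabited λ { A₀ (_ , e , _ , full , _) →
      let c₀ = to (inv e) (1ℤ ∷ 𝟘)
          π : Vec ℤ n → ℤ
          π x = head (to e x)
          π-⊖ : ∀ x a y → π (x ⊖ a ⊙ y) ≡ π x ℤ.+ (- 1ℤ) ℤ.* (a ℤ.* π y)
          π-⊖ x a y = trans (cong head (⊖-homo (to-linear e) x (a ⊙ y)))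
            (trans (head-⊕ (to e x) _) (cong (λ t → π x ℤ.+ t) (trans (head-⊙ (- 1ℤ) (to e (a ⊙ y)))
              (cong ((- 1ℤ) ℤ.*_) (trans (cong head (⊙-homo (to-linear e) a y)) (head-⊙ a (to e y)))))))
          πc₀ : π c₀ ≡ 1ℤ
          πc₀ = cong head (to-inv e (1ℤ ∷ 𝟘))
          -- Modulo the span of `bs`, which is orthogonal to `y`, the row `x` is `π x ⊙ c₀`; pairing
          -- with `y` therefore factors `d`.
          divides : ∀ {x y} → dot x y ≡ d → VAll.All (λ b → dot b y ≡ 0ℤ) bs → d ≡ π x ℤ.* dot c₀ y
          divides {x} {y} xy≡d bs⊥y =
            let z , eq = full (x ⊖ π x ⊙ c₀) (trans (π-⊖ x (π x) c₀) (trans (cong (λ t → π x ℤ.+ (- 1ℤ) ℤ.* (π x ℤ.* t)) πc₀) (cancel (π x))))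
            in begin
              d                                                    ≡⟨ xy≡d ⟨
              dot x y                                              ≡⟨ cong (λ t → dot t y) (x⊖y⊕y≡x x (π x ⊙ c₀)) ⟨
              dot ((x ⊖ π x ⊙ c₀) ⊕ π x ⊙ c₀) y                    ≡⟨ dot-⊕ˡ (x ⊖ π x ⊙ c₀) (π x ⊙ c₀) y ⟩
              dot (x ⊖ π x ⊙ c₀) y ℤ.+ dot (π x ⊙ c₀) y            ≡⟨ cong₂ ℤ._+_ (trans (cong (λ t → dot t y) eq) (dot-comb z bs y bs⊥y)) (dot-⊙ˡ (π x) c₀ y) ⟩
              0ℤ ℤ.+ π x ℤ.* dot c₀ y                              ≡⟨ ℤₚ.+-identityˡ _ ⟩
              π x ℤ.* dot c₀ y                                     ∎
          -- First rows with the same `π x` lie in one coset of the span of `bs`, so for each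
          -- divisor they are no more numerous than any other row.
          first-row : Atmost (λ x → Bounded H x × π x ∈ ds) (length ds * ∏ (indices h es))
          first-row = atmost-cover (λ x t → π x ≡ t) ds proj₂ λ t → atmost-coset bs es g
            λ { {x} {y} ((bx , _) , px) ((by , _) , py) → ⊖-small {h = h} 2H≤ bx by ,
              full (x ⊖ y) (trans (cong head (⊖-homo (to-linear e) x y)) (trans (head-⊕ (to e x) _)
                (trans (cong (λ t → π x ℤ.+ t) (head-⊙ (- 1ℤ) (to e y))) (trans (cong₂ (λ a b → a ℤ.+ (- 1ℤ) ℤ.* b) px py) (cancel′ t))))) }
      in atmost-≤ (ℕₚ.≤-reflexive (ℕₚ.*-assoc (length ds) (∏ (indices h es)) (∏ (indices h es) ^ n′)))
           (atmost-fibre _≟ᵛ_ head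
             (λ { {x ∷ A} ((bx ∷ _ , _) , _ , y , _ , xy , by , _) → bx , divisors _ _ (divides xy by) })
             first-row
             λ x → atmost-injection tail (λ { {_ ∷ A} (((_ ∷ bA , _) , _ , _ , _ , _ , _ , rows) , _) → vall-zipWith (λ p → p) (bA , rows) })
               (λ { {_ ∷ _} {_ ∷ _} (_ , refl) (_ , refl) refl → refl })
               (atmost-vec _≟ᵛ_ (atmost-span 2H≤ bs es g) n′)) }
      where
      open ≡-Reasoning
      cancel : ∀ a → a ℤ.+ (- 1ℤ) ℤ.* (a ℤ.* 1ℤ) ≡ 0ℤ
      cancel = solve-∀
      cancel′ : ∀ a → a ℤ.+ (- 1ℤ) ℤ.* a ≡ 0ℤ
      cancel′ = solve-∀

  atmost-invertible : Atmost (λ (A : Matrix n) → VAll.All (Bounded H) A × Invertible d A)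
    (suc n′ * (suc h ^ n′ * (length ds * Q h n ^ n′)))
  atmost-invertible = atmost-reduced h n′ (length ds) (ℕₚ.n≤1+n n′) R bases fibres

-- Matrices

act-linear : ∀ {m n} (A : Vec (Vec ℤ n) m) → Linear (act A)
act-linear A = record { ⊕-homo = add A ; ⊙-homo = scl A }
  where
  add : ∀ {m n} (A : Vec (Vec ℤ n) m) x y → act A (x ⊕ y) ≡ act A x ⊕ act A y
  add []      x y = refl
  add (a ∷ A) x y = cong₂ _∷_ (dot-⊕ʳ a x y) (add A x y)
  scl : ∀ {m n} (A : Vec (Vec ℤ n) m) c x → act A (c ⊙ x) ≡ c ⊙ act A x
  scl []      c x = refl
  scl (a ∷ A) c x = cong₂ _∷_ (dot-⊙ʳ c a x) (scl A c x)

lookup-ext : ∀ {A : Set} {n} (x y : Vec A n) → (∀ i → lookup x i ≡ lookup y i) → x ≡ y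
lookup-ext x y h = trans (sym (Vecₚ.tabulate∘lookup x)) (trans (Vecₚ.tabulate-cong h) (Vecₚ.tabulate∘lookup y))

lookup-comb : ∀ {m n} (a : Vec ℤ m) (B : Vec (Vec ℤ n) m) j →
  lookup (comb a B) j ≡ sumFin m (λ k → lookup a k ℤ.* lookup (lookup B k) j)
lookup-comb []      []      j = Vecₚ.lookup-replicate j 0ℤ
lookup-comb (z ∷ a) (b ∷ B) j = trans (Vecₚ.lookup-zipWith ℤ._+_ j (z ⊙ b) (comb a B))
  (cong₂ ℤ._+_ (Vecₚ.lookup-map j (z ℤ.*_) b) (lookup-comb a B j))

lookup-⊗ : ∀ {n} (A B : Matrix n) i → lookup (A ⊗ B) i ≡ comb (lookup A i) B
lookup-⊗ A B i = trans (Vecₚ.lookup∘tabulate _ i) (lookup-ext _ _ λ j →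
  trans (Vecₚ.lookup∘tabulate _ j) (sym (lookup-comb (lookup A i) B j)))

dot-comb≡dot-act : ∀ {m n} (a : Vec ℤ m) (B : Vec (Vec ℤ n) m) v → dot (comb a B) v ≡ dot a (act B v)
dot-comb≡dot-act []      []      v = dot-𝟘ˡ v
dot-comb≡dot-act (z ∷ a) (b ∷ B) v =
  trans (dot-⊕ˡ (z ⊙ b) (comb a B) v) (cong₂ ℤ._+_ (dot-⊙ˡ z b v) (dot-comb≡dot-act a B v))

lookup-act : ∀ {m n} (A : Vec (Vec ℤ n) m) v i → lookup (act A v) i ≡ dot (lookup A i) v
lookup-act A v i = Vecₚ.lookup-map i (λ a → dot a v) A

act-⊗ : ∀ {n} (A B : Matrix n) v → act (A ⊗ B) v ≡ act A (act B v)
act-⊗ A B v = lookup-ext _ _ λ i → trans (lookup-act (A ⊗ B) v i) (trans (cong (λ t → dot t v) (lookup-⊗ A B i))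
  (trans (dot-comb≡dot-act (lookup A i) B v) (sym (lookup-act A (act B v) i))))

dot-lookup≡0 : ∀ {n} (x v : Vec ℤ n) → (∀ j → lookup x j ≡ 0ℤ) → dot x v ≡ 0ℤ
dot-lookup≡0 []      []      h = refl
dot-lookup≡0 (a ∷ x) (b ∷ v) h = trans (cong₂ (λ s t → s ℤ.* b ℤ.+ t) (h zero) (dot-lookup≡0 x v (λ j → h (suc j)))) refl

dot-unit : ∀ {n} (x v : Vec ℤ n) i → lookup x i ≡ 1ℤ → (∀ j → j ≢ i → lookup x j ≡ 0ℤ) → dot x v ≡ lookup v i
dot-unit (a ∷ x) (b ∷ v) zero    p h =
  trans (cong₂ (λ s t → s ℤ.* b ℤ.+ t) p (dot-lookup≡0 x v (λ j → h (suc j) λ ()))) (trans (ℤₚ.+-identityʳ _) (ℤₚ.*-identityˡ b))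
dot-unit (a ∷ x) (b ∷ v) (suc i) p h =
  trans (cong₂ (λ s t → s ℤ.* b ℤ.+ t) (h zero λ ()) (dot-unit x v i p (λ j j≢i → h (suc j) λ e → j≢i (Finₚ.suc-injective e)))) (ℤₚ.+-identityˡ _)

unit : ∀ {n} → Fin n → Vec ℤ n
unit {n} i = lookup (identity n) i

entry-identity : ∀ {n} (i j : Fin n) → (j ≡ i → entry (identity n) i j ≡ 1ℤ) × (j ≢ i → entry (identity n) i j ≡ 0ℤ)
entry-identity {n} i j with i Fin.≟ j | (entry (identity n) i j ≡ _) ∋
  trans (cong (λ t → lookup t j) (Vecₚ.lookup∘tabulate _ i)) (Vecₚ.lookup∘tabulate _ j)
... | yes i≡j | eq = (λ _ → eq) , λ j≢i → ⊥-elim (j≢i (sym i≡j))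
... | no i≢j  | eq = (λ j≡i → ⊥-elim (i≢j (sym j≡i))) , λ _ → eq

dot-unitˡ : ∀ {n} (i : Fin n) v → dot (unit i) v ≡ lookup v i
dot-unitˡ {n} i v = dot-unit (unit i) v i (proj₁ (entry-identity i i) refl) λ j → proj₂ (entry-identity i j)

act-identity : ∀ {n} (v : Vec ℤ n) → act (identity n) v ≡ v
act-identity v = lookup-ext _ _ λ i → trans (lookup-act (identity _) v i) (dot-unitˡ i v)

act-zeroMat : ∀ {n} (v : Vec ℤ n) → act (zeroMat n) v ≡ 𝟘
act-zeroMat {n} v = lookup-ext _ _ λ i → trans (lookup-act (zeroMat n) v i)
  (trans (dot-lookup≡0 (lookup (zeroMat n) i) v (λ j → trans (cong (λ t → lookup t j) (Vecₚ.lookup∘tabulate _ i)) (Vecₚ.lookup∘tabulate _ j)))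
    (sym (Vecₚ.lookup-replicate i 0ℤ)))

act-unit : ∀ {m n} (A : Vec (Vec ℤ n) m) j → act A (unit j) ≡ Vec.map (λ a → lookup a j) A
act-unit A j = Vecₚ.map-cong (λ a → trans (dot-comm a (unit j)) (dot-unitˡ j a)) A

act-ext : ∀ {m n} (A B : Vec (Vec ℤ n) m) → (∀ j → act A (unit j) ≡ act B (unit j)) → A ≡ B
act-ext A B h = lookup-ext A B λ i → lookup-ext _ _ λ j →
  trans (sym (Vecₚ.lookup-map i (λ a → lookup a j) A)) (trans (cong (λ t → lookup t i)
    (trans (sym (act-unit A j)) (trans (h j) (act-unit B j)))) (Vecₚ.lookup-map i (λ a → lookup a j) B))

actAll : ∀ {n m} → Vec (Matrix n) m → Vec ℤ n → Vec ℤ n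
actAll []       v = v
actAll (A ∷ As) v = act A (actAll As v)

act-prodMats : ∀ {n m} (As : Vec (Matrix n) m) v → act (prodMats As) v ≡ actAll As v
act-prodMats []       v = act-identity v
act-prodMats (A ∷ As) v = trans (act-⊗ A (prodMats As) v) (cong (act A) (act-prodMats As v))

actAll-linear : ∀ {n m} (As : Vec (Matrix n) m) → Linear (actAll As)
actAll-linear []       = id-linear
actAll-linear (A ∷ As) = ∘-linear (act-linear A) (actAll-linear As)

transposeᵛ : ∀ {m n} → Vec (Vec ℤ n) m → Vec (Vec ℤ m) n
transposeᵛ []      = replicate _ []
transposeᵛ (a ∷ M) = zipWith _∷_ a (transposeᵛ M)

act-transpose : ∀ {m n} (M : Vec (Vec ℤ n) m) w → act (transposeᵛ M) w ≡ comb w M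
act-transpose []      []      = empty _
  where
  empty : ∀ n → act (replicate n []) [] ≡ 𝟘
  empty zero    = refl
  empty (suc n) = cong (0ℤ ∷_) (empty n)
act-transpose (a ∷ M) (z ∷ w) = trans (go a (transposeᵛ M)) (cong (z ⊙ a ⊕_) (act-transpose M w))
  where
  go : ∀ {n} (a : Vec ℤ n) T → act (zipWith _∷_ a T) (z ∷ w) ≡ z ⊙ a ⊕ act T w
  go []      []      = refl
  go (b ∷ a) (t ∷ T) = cong₂ _∷_ (cong (ℤ._+ dot t w) (ℤₚ.*-comm b z)) (go a T)

linear≡comb : ∀ {m n} {f : Vec ℤ m → Vec ℤ n} → Linear f → ∃[ C ] ∀ x → f x ≡ comb x C
linear≡comb {zero}  F = [] , λ { [] → 𝟘-homo F }
linear≡comb {suc m} {f = f} F =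
  let C , eq = linear≡comb {f = λ x → f (0ℤ ∷ x)} record
        { ⊕-homo = λ x y → ⊕-homo F (0ℤ ∷ x) (0ℤ ∷ y)
        ; ⊙-homo = λ c x → trans (cong (λ t → f (t ∷ c ⊙ x)) (sym (ℤₚ.*-zeroʳ c))) (⊙-homo F c (0ℤ ∷ x)) }
  in f (1ℤ ∷ 𝟘) ∷ C , λ { (a ∷ x) → trans (cong f (cong₂ _∷_ (eq₁ a) (sym (trans (cong (_⊕ x) (⊙-zeroʳ a)) (⊕-identityˡ x)))))
       (trans (⊕-homo F (a ⊙ (1ℤ ∷ 𝟘)) (0ℤ ∷ x)) (cong₂ _⊕_ (⊙-homo F a (1ℤ ∷ 𝟘)) (eq x))) }
  where
  eq₁ : ∀ a → a ≡ a ℤ.* 1ℤ ℤ.+ 0ℤ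
  eq₁ = solve-∀

-- g is injective, so its n columns together with v are linearly dependent with a nonzero coefficient at v.
right⇒left-inverse : ∀ {n} {d} {f g : Vec ℤ n → Vec ℤ n} → d ≢ 0ℤ → Linear f → Linear g →
  (∀ v → f (g v) ≡ d ⊙ v) → ∀ v → g (f v) ≡ d ⊙ v
right⇒left-inverse {n} {d} {f} {g} d≢0 F G fg v
  with linear≡comb G
... | C , g≡ with orthogonal-vector (Vec.toList (transposeᵛ (v ∷ C))) (subst (_< suc n) (sym (length-toList (transposeᵛ (v ∷ C)))) ℕₚ.≤-refl)
... | c ∷ p , w≢0 , orth = ⊙-cancel c≢0 (g (f v)) (d ⊙ v) (begin
  c ⊙ g (f v)                ≡⟨ ⊙-homo (∘-linear G F) c v ⟨
  g (f (c ⊙ v))              ≡⟨ cong (λ t → g (f t)) cv≡ ⟩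
  g (f (- 1ℤ ⊙ g p))         ≡⟨ cong (λ t → g (f t)) (⊙-homo G (- 1ℤ) p) ⟨
  g (f (g (- 1ℤ ⊙ p)))       ≡⟨ cong g (fg (- 1ℤ ⊙ p)) ⟩
  g (d ⊙ - 1ℤ ⊙ p)           ≡⟨ ⊙-homo G d (- 1ℤ ⊙ p) ⟩
  d ⊙ g (- 1ℤ ⊙ p)           ≡⟨ cong (d ⊙_) (⊙-homo G (- 1ℤ) p) ⟩
  d ⊙ - 1ℤ ⊙ g p             ≡⟨ cong (d ⊙_) cv≡ ⟨
  d ⊙ c ⊙ v                  ≡⟨ ⊙-swap d c v ⟩
  c ⊙ d ⊙ v                  ∎)
  where
  open ≡-Reasoning
  relation : c ⊙ v ⊕ g p ≡ 𝟘
  relation = trans (cong (c ⊙ v ⊕_) (g≡ p)) (trans (sym (act-transpose (v ∷ C) (c ∷ p)))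
    (act-zero (transposeᵛ (v ∷ C)) (c ∷ p) (all-toList orth)))
  cv≡ : c ⊙ v ≡ - 1ℤ ⊙ g p
  cv≡ = trans (sym (x⊕y⊖x≡y (g p) (c ⊙ v))) (trans (cong (_⊖ g p) (trans (⊕-comm (g p) (c ⊙ v)) relation)) (⊕-identityˡ _))
  c≢0 : c ≢ 0ℤ
  c≢0 refl = w≢0 (cong (0ℤ ∷_) (⊙≡𝟘⇒≡𝟘 d≢0 p (trans (sym (fg p)) (trans (cong f gp≡0) (𝟘-homo F)))))
    where
    gp≡0 : g p ≡ 𝟘
    gp≡0 = trans (sym (⊕-identityˡ (g p))) (trans (cong (_⊕ g p) (sym (⊙-zeroˡ v))) relation)

-- Counting factorisations

BoundedMatrix : ∀ {n} → ℕ → Matrix n → Set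
BoundedMatrix H = VAll.All (Bounded H)

_≟ᵐ_ : ∀ {m n} → DecidableEquality (Vec (Vec ℤ n) m)
_≟ᵐ_ = Vecₚ.≡-dec _≟ᵛ_

-- `E` is a right inverse of `C` up to the factor `d`. If `A` is the first factor, then the product
-- of the others after `E` is such an inverse of `A`, on both sides by `right⇒left-inverse`. So `A`
-- cancels, and the remaining product satisfies the hypothesis with `E` after `A` and the same `d`.
-- The last factor is determined, which makes the exponent `m` for m + 1 factors.
atmost-factorisations : ∀ {n d H M} → d ≢ 0ℤ →
  Atmost (λ (A : Matrix n) → BoundedMatrix H A × Invertible d A) M →
  ∀ m (C E : Vec ℤ n → Vec ℤ n) → Linear E → (∀ v → C (E v) ≡ d ⊙ v) →
  Atmost (λ (As : Vec (Matrix n) (suc m)) → VAll.All (BoundedMatrix H) As × (∀ v → actAll As v ≡ C v)) (M ^ m)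
atmost-factorisations d≢0 hM zero C E E-lin CE = atmost-1
  λ { (A ∷ []) (B ∷ []) (_ , p) (_ , q) → cong (_∷ []) (act-ext A B λ j → trans (p (unit j)) (sym (q (unit j)))) }
atmost-factorisations {n} {d} {H} {M} d≢0 hM (suc m) C E E-lin CE = atmost-fibre _≟ᵐ_ head
  (λ { {A ∷ As} (bA ∷ _ , p) → bA , invertible A As p }) hM
  λ A → atmost-inhabited λ { (_ ∷ As₀) ((_ , p₀) , refl) →
    let g = λ v → actAll As₀ (E v)
        gA = left-inverse A As₀ p₀
    in atmost-injection tail
      (λ { {_ ∷ As} ((_ ∷ bAs , p) , refl) → bAs , λ v → ⊙-cancel d≢0 (actAll As v) (actAll As₀ v)
        (trans (sym (gA (actAll As v))) (trans (cong g (trans (p v) (sym (p₀ v)))) (gA (actAll As₀ v)))) })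
      (λ { {_ ∷ _} {_ ∷ _} (_ , refl) (_ , refl) refl → refl })
      (atmost-factorisations d≢0 hM m (actAll As₀) (λ v → E (act A v)) (∘-linear E-lin (act-linear A)) gA) }
  where
  right-inverse : ∀ (A : Matrix n) (As : Vec (Matrix n) (suc m)) → (∀ v → act A (actAll As v) ≡ C v) →
    ∀ v → act A (actAll As (E v)) ≡ d ⊙ v
  right-inverse A As p v = trans (p (E v)) (CE v)
  left-inverse : ∀ (A : Matrix n) (As : Vec (Matrix n) (suc m)) → (∀ v → act A (actAll As v) ≡ C v) →
    ∀ v → actAll As (E (act A v)) ≡ d ⊙ v
  left-inverse A As p =
    right⇒left-inverse d≢0 (act-linear A) (∘-linear (actAll-linear As) E-lin) (right-inverse A As p)
  invertible : ∀ (A : Matrix n) (As : Vec (Matrix n) (suc m)) → (∀ v → act A (actAll As v) ≡ C v) → Invertible d A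
  invertible A As p = (λ v → actAll As (E v)) , ∘-linear (actAll-linear As) E-lin , right-inverse A As p , left-inverse A As p

toList-all : ∀ {A : Set} {P : A → Set} {k} {v : Vec A k} → VAll.All P v → All P (Vec.toList v)
toList-all []       = []
toList-all (p ∷ ps) = p ∷ toList-all ps

decompose : ∀ {n} (A : Matrix n) → RankDecomposition (Vec.toList A)
decompose A = rank-decomposition (Vec.toList A)

rank nullity : ∀ {n} → Matrix n → ℕ
rank A = RankDecomposition.rank (decompose A)
nullity A = RankDecomposition.nullity (decompose A)

rank+nullity≡n : ∀ {n} (A : Matrix n) → rank A + nullity A ≡ n
rank+nullity≡n A = RankDecomposition.rank+nullity (decompose A)

K : ℕ → ℕ → ℕ → ℕ
K h n r = suc r * (suc h ^ r * (1 * Q h n ^ r))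

atmost-rank : ∀ n r h H → r ≤ n → 2 * H ≤ θ h → Atmost (λ (A : Matrix n) → BoundedMatrix H A × rank A ≡ r) (K h n r)
atmost-rank n r h H r≤n 2H≤ = atmost-⊆
  (λ { {A} (bA , refl) → bA , RankDecomposition.lattice (decompose A) , all-toList (RankDecomposition.rows∈lattice (decompose A)) })
  (atmost-rank≤ n r h H r≤n 2H≤)

act≡⇒rows : ∀ {m n} (A : Vec (Vec ℤ n) m) x y → act A x ≡ act A y → VAll.All (λ a → dot a x ≡ dot a y) A
act≡⇒rows []      x y e = []
act≡⇒rows (a ∷ A) x y e = cong head e ∷ act≡⇒rows A x y (cong tail e)

atmost-preimages : ∀ {n} (A : Matrix n) T u → Atmost (λ y → Bounded T y × act A y ≡ u) (suc (2 * T) ^ nullity A)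
atmost-preimages A T u = atmost-inhabited λ { y₀ (_ , refl) →
  atmost-⊆ (λ { {y} (b , e) → b , toList-all (act≡⇒rows A y y₀ e) }) (atmost-solutions (decompose A) T (λ a → dot a y₀)) }

atmost-lookup : ∀ {X : Set} {k N} {P : Fin k → X → Set} → DecidableEquality X → (∀ j → Atmost (P j) N) →
  Atmost (λ (v : Vec X k) → ∀ j → P j (lookup v j)) (N ^ k)
atmost-lookup {k = zero}  _≟_ h = atmost-1 λ { [] [] _ _ → refl }
atmost-lookup {k = suc k} _≟_ h = atmost-fibre _≟_ head (λ { {_ ∷ _} p → p zero }) (h zero) λ y →
  atmost-injection tail (λ { {_ ∷ _} (p , _) j → p (suc j) })
    (λ { {_ ∷ _} {_ ∷ _} (_ , refl) (_ , refl) refl → refl }) (atmost-lookup _≟_ (λ j → h (suc j)))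

bounded-column : ∀ {m n H} {B : Vec (Vec ℤ n) m} → VAll.All (Bounded H) B → ∀ j → Bounded H (act B (unit j))
bounded-column {H = H} {B} bB j = subst (Bounded H) (sym (act-unit B j)) (go bB)
  where
  go : ∀ {m} {B : Vec (Vec ℤ _) m} → VAll.All (Bounded H) B → Bounded H (Vec.map (λ a → lookup a j) B)
  go []       = []
  go (b ∷ bs) = VAllₚ.lookup⁺ b j ∷ go bs

-- The equation for A B separates into one for each column of `B`; hence the passage to the
-- transpose.
atmost-right-factors : ∀ {n} (A : Matrix n) H (C : Vec ℤ n → Vec ℤ n) →
  Atmost (λ (B : Matrix n) → BoundedMatrix H B × (∀ v → act A (act B v) ≡ C v)) ((suc (2 * H) ^ nullity A) ^ n)
atmost-right-factors {n} A H C = atmost-injection (λ B → tabulate λ j → act B (unit j))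
  (λ { {B} (bB , p) j → subst (λ t → Bounded H t × act A t ≡ C (unit j))
    (sym (Vecₚ.lookup∘tabulate (λ j → act B (unit j)) j)) (bounded-column bB j , p (unit j)) })
  (λ {B} {B′} _ _ e → act-ext B B′ λ j → trans (sym (Vecₚ.lookup∘tabulate (λ j → act B (unit j)) j))
    (trans (cong (λ t → lookup t j) e) (Vecₚ.lookup∘tabulate (λ j → act B′ (unit j)) j)))
  (atmost-lookup _≟ᵛ_ λ j → atmost-preimages A H (C (unit j)))

∃-bound : ∀ {n} (x : Vec ℤ n) → ∃[ M ] Bounded M x
∃-bound []      = 0 , []
∃-bound (a ∷ x) = let M , p = ∃-bound x in (∣ a ∣ + M) , (ℕₚ.m≤m+n (∣ a ∣) M ∷ bounded-≤ (ℕₚ.m≤n+m M (∣ a ∣)) p)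

∃-weight : ∀ {n k} (bs : Vec (Vec ℤ n) k) → ∃[ S ] Weight S bs
∃-weight []       = 0 , λ { R [] [] → bounded-𝟘 }
∃-weight (b ∷ bs) = let S , p = ∃-weight bs ; M , q = ∃-bound b in M + S , weight-∷ {b = b} {bs} q p

linear-bound : ∀ {m n} {f : Vec ℤ m → Vec ℤ n} → Linear f → ∃[ c ] ∀ T x → Bounded T x → Bounded (T * c) (f x)
linear-bound F = let C , eq = linear≡comb F ; S , w = ∃-weight C in
  S , λ T x b → subst (Bounded (T * S)) (sym (eq x)) (w T x b)

total-nullity : ∀ {n m} → Vec (Matrix n) m → ℕ
total-nullity []       = 0
total-nullity (A ∷ As) = nullity A + total-nullity As

-- The value of the inner product lies in a box larger by the constant `c′`, and there has few
-- preimages under the outer factor. The constant depends on the matrices but not on `T`, so that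
-- `sylvester` can choose the box after it.
atmost-preimages-product : ∀ {n m} (As : Vec (Matrix n) m) → ∃[ c ] ∀ T u →
  Atmost (λ y → Bounded T y × actAll As y ≡ u) (c * suc (2 * T) ^ total-nullity As)
atmost-preimages-product []       = 1 , λ T u → atmost-1 λ { _ _ (_ , p) (_ , q) → trans p (sym q) }
atmost-preimages-product (A ∷ As) =
  let c , ih = atmost-preimages-product As
      c′ , bd = linear-bound (actAll-linear As)
      s = nullity A ; Σs = total-nullity As
  in suc c′ ^ s * c , λ T u → atmost-≤ (bound c c′ s Σs T)
       (atmost-fibre _≟ᵛ_ (actAll As) (λ { {y} (b , p) → bd T y b , p }) (atmost-preimages A (T * c′) u)
         λ w → atmost-⊆ (λ { ((b , _) , e) → b , e }) (ih T w))
  where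
  open ℕₚ.≤-Reasoning
  bound : ∀ c c′ s Σs T → suc (2 * (T * c′)) ^ s * (c * suc (2 * T) ^ Σs) ≤ suc c′ ^ s * c * suc (2 * T) ^ (s + Σs)
  bound c c′ s Σs T = begin
    suc (2 * (T * c′)) ^ s * (c * Y ^ Σs)        ≤⟨ ℕₚ.*-monoˡ-≤ (c * Y ^ Σs) (ℕₚ.^-monoˡ-≤ s step) ⟩
    (suc c′ * Y) ^ s * (c * Y ^ Σs)              ≡⟨ cong (_* (c * Y ^ Σs)) (^-distribʳ-* (suc c′) Y s) ⟩
    suc c′ ^ s * Y ^ s * (c * Y ^ Σs)            ≡⟨ ℕₚ.[m*n]*[o*p]≡[m*o]*[n*p] (suc c′ ^ s) (Y ^ s) c (Y ^ Σs) ⟩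
    suc c′ ^ s * c * (Y ^ s * Y ^ Σs)            ≡⟨ cong (suc c′ ^ s * c *_) (ℕₚ.^-distribˡ-+-* Y s Σs) ⟨
    suc c′ ^ s * c * Y ^ (s + Σs)                ∎
    where
    Y = suc (2 * T)
    step : suc (2 * (T * c′)) ≤ suc c′ * Y
    step = ℕₚ.≤-trans (ℕₚ.m≤m+n _ (c′ + 2 * T)) (ℕₚ.≤-reflexive (eq T c′))
      where
      eq : ∀ T c → suc (2 * (T * c)) + (c + 2 * T) ≡ suc c * suc (2 * T)
      eq = solve-∀ℕ

-- Sylvester's rank inequality, by comparing the number of vectors in a large box with the number of
-- solutions of A₁(⋯(Aₘ y)) = 0 in it.
sylvester : ∀ {n m} (As : Vec (Matrix n) m) → (∀ v → actAll As v ≡ 𝟘) → n ≤ total-nullity As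
sylvester {n} As zero-product = ℕₚ.≮⇒≥ λ Σ<n →
  let c , h = atmost-preimages-product As
      -- The box size is the constant `c` itself: if Σs < n, then Y^(Σs + 1) ≤ Y^n ≤ c Y^Σs would
      -- give 2c + 1 ≤ c.
      Y = suc (2 * c) ; Σs = total-nullity As
      count = h c 𝟘 (vecsOf n (range c)) (vecsOf-unique n (range-unique c))
        (All.tabulate λ y∈ → ∈-box⁻ y∈ , zero-product _)
      Y≤c : Y ≤ c
      Y≤c = ℕₚ.*-cancelʳ-≤ Y c (Y ^ Σs) {{ℕₚ.m^n≢0 Y Σs}} (ℕₚ.≤-trans (ℕₚ.^-monoʳ-≤ Y Σ<n)
        (ℕₚ.≤-trans (ℕₚ.≤-reflexive (sym (length-box n c))) count))
  in ℕₚ.<⇒≱ (s≤s (ℕₚ.m≤n*m c 2)) Y≤c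

-- For h about log₂ H, Z exceeds 2H+1 and is O(H), and W is a power of log H.
module Counts (n h H : ℕ) (2H≤ : 2 * H ≤ θ h) where
  Z W Y : ℕ
  Z = 2 ^ (h + (n + 2))
  W = suc n * suc h ^ n
  Y = suc (2 * H)

  Y≤Z : Y ≤ Z
  Y≤Z = ℕₚ.≤-trans (s≤s 2H≤) (ℕₚ.≤-trans (ℕₚ.≤-reflexive (suc-θ h)) (ℕₚ.^-monoʳ-≤ 2 (ℕₚ.m≤m+n h (n + 2))))

  Yⁿ≤Q : ∀ s → (Y ^ s) ^ n ≤ Q h n ^ s
  Yⁿ≤Q s = begin
    (Y ^ s) ^ n      ≡⟨ ℕₚ.^-*-assoc Y s n ⟩
    Y ^ (s * n)      ≤⟨ ℕₚ.^-monoˡ-≤ (s * n) Y≤Z ⟩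
    Z ^ (s * n)      ≡⟨ cong (Z ^_) (ℕₚ.*-comm s n) ⟩
    Z ^ (n * s)      ≡⟨ ℕₚ.^-*-assoc Z n s ⟨
    Q h n ^ s        ∎
    where open ℕₚ.≤-Reasoning

  K≤ : ∀ {r} → r ≤ n → K h n r ≤ W * Q h n ^ r
  K≤ {r} r≤n = begin
    suc r * (suc h ^ r * (1 * Q h n ^ r))     ≡⟨ eq (suc r) (suc h ^ r) (Q h n ^ r) ⟩
    suc r * suc h ^ r * Q h n ^ r             ≤⟨ ℕₚ.*-monoˡ-≤ (Q h n ^ r) (ℕₚ.*-mono-≤ (s≤s r≤n) (ℕₚ.^-monoʳ-≤ (suc h) r≤n)) ⟩
    W * Q h n ^ r                             ∎
    where
    open ℕₚ.≤-Reasoning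
    eq : ∀ a b c → a * (b * (1 * c)) ≡ a * b * c
    eq = solve-∀ℕ

  atmost-rank′ : ∀ {r} → r ≤ n → Atmost (λ (A : Matrix n) → BoundedMatrix H A × rank A ≡ r) (W * Q h n ^ r)
  atmost-rank′ {r} r≤n = atmost-≤ (K≤ r≤n) (atmost-rank n r h H r≤n 2H≤)

  rank≤n : (A : Matrix n) → rank A ≤ n
  rank≤n A = subst (rank A ≤_) (rank+nullity≡n A) (ℕₚ.m≤m+n (rank A) (nullity A))

  atmost-matrices : Atmost (BoundedMatrix {n} H) (Q h n ^ n)
  atmost-matrices = atmost-≤ (Yⁿ≤Q n) (atmost-vec _≟ᵛ_ (atmost-box H) n)

  atmost-two-factors : ∀ (C : Vec ℤ n → Vec ℤ n) →
    Atmost (λ (As : Vec (Matrix n) 2) → VAll.All (BoundedMatrix H) As × (∀ v → actAll As v ≡ C v)) (suc n * (W * Q h n ^ n))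
  atmost-two-factors C = atmost-≤ (ℕₚ.≤-reflexive (cong (_* (W * Q h n ^ n)) (Listₚ.length-upTo (suc n))))
    (atmost-cover (λ As r → rank (head As) ≡ r) (List.upTo (suc n)) (λ { {A ∷ _} _ → ∈ₚ.∈-upTo⁺ (s≤s (rank≤n A)) }) λ r →
      atmost-inhabited λ { (A₀ ∷ _) (_ , refl) →
        atmost-≤ (bound (rank A₀) (nullity A₀) (rank+nullity≡n A₀))
          (atmost-fibre _≟ᵐ_ head (λ { {_ ∷ _} ((bA ∷ _ , _) , e) → bA , e }) (atmost-rank′ (rank≤n A₀)) λ A →
            atmost-inhabited λ { (_ ∷ _) ((_ , e) , refl) → atmost-≤ (ℕₚ.≤-reflexive (cong (λ s → (Y ^ s) ^ n)
                (ℕₚ.+-cancelˡ-≡ (rank A₀) (nullity A) (nullity A₀) (trans (cong (_+ nullity A) (sym e)) (trans (rank+nullity≡n A) (sym (rank+nullity≡n A₀)))))))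
              (atmost-injection (λ As → head (tail As)) (λ { {_ ∷ _ ∷ []} (((_ ∷ bB ∷ [] , p) , _) , refl) → bB , p })
                (λ { {_ ∷ _ ∷ []} {_ ∷ _ ∷ []} (_ , refl) (_ , refl) refl → refl })
                (atmost-right-factors A H C)) }) })
    where
    open ℕₚ.≤-Reasoning
    bound : ∀ r s → r + s ≡ n → W * Q h n ^ r * (Y ^ s) ^ n ≤ W * Q h n ^ n
    bound r s e = begin
      W * Q h n ^ r * (Y ^ s) ^ n      ≤⟨ ℕₚ.*-monoʳ-≤ (W * Q h n ^ r) (Yⁿ≤Q s) ⟩
      W * Q h n ^ r * Q h n ^ s        ≡⟨ ℕₚ.*-assoc W (Q h n ^ r) (Q h n ^ s) ⟩
      W * (Q h n ^ r * Q h n ^ s)      ≡⟨ cong (W *_) (ℕₚ.^-distribˡ-+-* (Q h n) r s) ⟨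
      W * Q h n ^ (r + s)              ≡⟨ cong (λ t → W * Q h n ^ t) e ⟩
      W * Q h n ^ n                    ∎

  ∑ : ∀ {m} → Vec ℕ m → ℕ
  ∑ []      = 0
  ∑ (r ∷ ρ) = r + ∑ ρ

  atmost-ranks : ∀ {m} (ρ : Vec ℕ m) → VAll.All (_≤ n) ρ →
    Atmost (λ (As : Vec (Matrix n) m) → VAll.All (BoundedMatrix H) As × Vec.map rank As ≡ ρ) (W ^ m * Q h n ^ ∑ ρ)
  atmost-ranks []      []       = atmost-1 λ { [] [] _ _ → refl }
  atmost-ranks {suc m} (r ∷ ρ) (p ∷ ps) = atmost-≤ (ℕₚ.≤-reflexive (begin
      W * Q h n ^ r * (W ^ m * Q h n ^ ∑ ρ)         ≡⟨ ℕₚ.[m*n]*[o*p]≡[m*o]*[n*p] W (Q h n ^ r) (W ^ m) (Q h n ^ ∑ ρ) ⟩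
      W * W ^ m * (Q h n ^ r * Q h n ^ ∑ ρ)         ≡⟨ cong (W * W ^ m *_) (ℕₚ.^-distribˡ-+-* (Q h n) r (∑ ρ)) ⟨
      W * W ^ m * Q h n ^ (r + ∑ ρ)                 ∎))
    (atmost-fibre _≟ᵐ_ head (λ { {_ ∷ _} (bA ∷ _ , e) → bA , cong head e }) (atmost-rank′ p) λ A →
      atmost-injection tail (λ { {_ ∷ _} ((_ ∷ bAs , e) , _) → bAs , cong tail e })
        (λ { {_ ∷ _} {_ ∷ _} (_ , refl) (_ , refl) refl → refl }) (atmost-ranks ρ ps))
    where open ≡-Reasoning

  ranks+nullities : ∀ {m} (As : Vec (Matrix n) m) → ∑ (Vec.map rank As) + total-nullity As ≡ m * n
  ranks+nullities []       = refl
  ranks+nullities (A ∷ As) = trans (eq (rank A) _ (nullity A) _) (cong₂ _+_ (rank+nullity≡n A) (ranks+nullities As))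
    where
    eq : ∀ a b c d → a + b + (c + d) ≡ a + c + (b + d)
    eq = solve-∀ℕ

  atmost-zero-products : ∀ m →
    Atmost (λ (As : Vec (Matrix n) (suc m)) → VAll.All (BoundedMatrix H) As × (∀ v → actAll As v ≡ 𝟘))
      (suc n ^ suc m * (W ^ suc m * Q h n ^ (m * n)))
  atmost-zero-products m = atmost-≤ (ℕₚ.≤-reflexive (cong (_* (W ^ suc m * Q h n ^ (m * n)))
      (trans (length-vecsOf (suc m) (List.upTo (suc n))) (cong (_^ suc m) (Listₚ.length-upTo (suc n))))))
    (atmost-cover (λ As ρ → Vec.map rank As ≡ ρ) (vecsOf (suc m) (List.upTo (suc n)))
      (λ {As} _ → ∈-vecsOf⁺ (Vec.map rank As) (ranks≤ As (λ {A} p → ∈ₚ.∈-upTo⁺ (s≤s p)))) λ ρ →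
      atmost-inhabited λ { As₀ ((_ , p) , refl) →
        atmost-≤ (ℕₚ.*-monoʳ-≤ (W ^ suc m) (ℕₚ.^-monoʳ-≤ (Q h n) {{>-nonZero (Q>0 h n)}} (total-rank As₀ p)))
          (atmost-⊆ (λ { ((b , _) , e) → b , e }) (atmost-ranks (Vec.map rank As₀) (ranks≤ As₀ (λ p → p)))) })
    where
    ranks≤ : ∀ {k} (As : Vec (Matrix n) k) {P : ℕ → Set} → (∀ {r} → r ≤ n → P r) → VAll.All P (Vec.map rank As)
    ranks≤ []       f = []
    ranks≤ (A ∷ As) f = f (rank≤n A) ∷ ranks≤ As f
    total-rank : (As : Vec (Matrix n) (suc m)) → (∀ v → actAll As v ≡ 𝟘) → ∑ (Vec.map rank As) ≤ m * n
    total-rank As p = ℕₚ.+-cancelˡ-≤ n _ _ (begin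
      n + ∑ (Vec.map rank As)                    ≡⟨ ℕₚ.+-comm n _ ⟩
      ∑ (Vec.map rank As) + n                    ≤⟨ ℕₚ.+-monoʳ-≤ (∑ (Vec.map rank As)) (sylvester As p) ⟩
      ∑ (Vec.map rank As) + total-nullity As     ≡⟨ ranks+nullities As ⟩
      suc m * n                                  ∎)
      where open ℕₚ.≤-Reasoning

-- The dimension is at least 2, since a nonzero 1 × 1 matrix is never singular, and `n″` is n - 2.
-- Up to logarithms, m + 1 factors are bounded by q^(n m + n - 2); as `q` is about Hⁿ, this is about
-- Hⁿ times smaller than the claim.
module NonzeroProducts (n″ h H : ℕ) (2H≤ : 2 * H ≤ θ h) where
  private
    n : ℕ
    n = suc (suc n″)

  open Counts n h H 2H≤

  private
    q = Q h n
    instance _ = >-nonZero (Q>0 h n)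

    NonzeroMap : (Vec ℤ n → Vec ℤ n) → Set
    NonzeroMap C = ¬ (∀ v → C v ≡ 𝟘)

  nonzero⇒nullity<n : ∀ (L : Matrix n) {f C : Vec ℤ n → Vec ℤ n} → NonzeroMap C → (∀ v → act L (f v) ≡ C v) → nullity L ≤ suc n″
  nonzero⇒nullity<n L {f} C≢0 p with rank L in r≡ | rank+nullity≡n L
  ... | suc r | e = s≤s⁻¹ (subst (suc (nullity L) ≤_) e (s≤s (ℕₚ.m≤n+m (nullity L) r)))
  ... | zero  | e = ⊥-elim (C≢0 λ v → trans (sym (p v)) (act-zero L (f v)
    (VAll.map (λ { refl → dot-𝟘ˡ (f v) }) (all-toList (rank≡0⇒rows≡𝟘 (decompose L) r≡)))))

  -- `L` is the product of the factors fixed so far, and all remaining factors but the last are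
  -- free. By then `L` has positive rank, because `C` is nonzero and a solution exists, so each
  -- column of the last factor keeps at most n - 1 degrees of freedom.
  atmost-after : ∀ m (L : Matrix n) (C : Vec ℤ n → Vec ℤ n) → NonzeroMap C →
    Atmost (λ (As : Vec (Matrix n) (suc m)) → VAll.All (BoundedMatrix H) As × (∀ v → act L (actAll As v) ≡ C v))
      ((q ^ n) ^ m * q ^ suc n″)
  atmost-after zero L C C≢0 = atmost-inhabited λ { As₀ (_ , p₀) →
    atmost-≤ (ℕₚ.≤-trans (Yⁿ≤Q (nullity L)) (ℕₚ.≤-trans (ℕₚ.^-monoʳ-≤ q (nonzero⇒nullity<n L C≢0 p₀)) (ℕₚ.≤-reflexive (sym (ℕₚ.*-identityˡ _)))))
      (atmost-injection head (λ { {_ ∷ []} (bA ∷ [] , p) → bA , p }) (λ { {_ ∷ []} {_ ∷ []} _ _ refl → refl })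
        (atmost-right-factors L H C)) }
  atmost-after (suc m) L C C≢0 = atmost-≤ (ℕₚ.≤-reflexive (sym (ℕₚ.*-assoc (q ^ n) ((q ^ n) ^ m) (q ^ suc n″))))
    (atmost-fibre _≟ᵐ_ head (λ { {_ ∷ _} (bA ∷ _ , _) → bA }) atmost-matrices λ A →
      atmost-injection tail (λ { {_ ∷ As} ((_ ∷ bAs , p) , refl) → bAs , λ v → trans (act-⊗ L A (actAll As v)) (p v) })
        (λ { {_ ∷ _} {_ ∷ _} (_ , refl) (_ , refl) refl → refl })
        (atmost-after m (L ⊗ A) C C≢0))

  atmost-singular : Atmost (λ (A : Matrix n) → BoundedMatrix H A × nullity A ≢ 0) (n * (W * q ^ suc n″))
  atmost-singular = atmost-≤ (ℕₚ.≤-reflexive (cong (_* (W * q ^ suc n″)) (Listₚ.length-upTo n)))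
    (atmost-cover (λ A r → rank A ≡ r) (List.upTo n) (λ { {A} (_ , s≢0) → ∈ₚ.∈-upTo⁺ (rank<n A s≢0) }) λ r →
      atmost-inhabited λ { A₀ ((_ , s≢0) , refl) →
        atmost-≤ (ℕₚ.*-monoʳ-≤ W (ℕₚ.^-monoʳ-≤ q (s≤s⁻¹ (rank<n A₀ s≢0))))
          (atmost-⊆ (λ { ((bA , _) , e) → bA , e }) (atmost-rank′ (rank≤n A₀))) })
    where
    rank<n : ∀ A → nullity A ≢ 0 → rank A < n
    rank<n A s≢0 with nullity A | rank+nullity≡n A
    ... | zero  | _ = ⊥-elim (s≢0 refl)
    ... | suc s | e = subst (suc (rank A) ≤_) e (subst (suc (rank A) ≤_) (sym (ℕₚ.+-suc (rank A) s)) (s≤s (ℕₚ.m≤m+n (rank A) s)))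

  -- A regular first factor costs q^n and leaves the same problem with one factor fewer. A singular
  -- one costs q^(n - 1) up to logarithms, and the last factor then loses a power of `q` too. Both
  -- branches have the same exponent. Logarithms enter in the singular branch only, so `n * W` is
  -- added at each step, not multiplied.
  atmost-nonzero-products : ∀ m (C : Vec ℤ n → Vec ℤ n) → NonzeroMap C →
    Atmost (λ (As : Vec (Matrix n) (suc m)) → VAll.All (BoundedMatrix H) As × (∀ v → actAll As v ≡ C v))
      (suc (m * (n * W)) * q ^ (n * m + n″))
  atmost-nonzero-products zero C C≢0 = atmost-≤ (ℕₚ.≤-trans (ℕₚ.m^n>0 q (n * 0 + n″)) (ℕₚ.≤-reflexive (sym (ℕₚ.*-identityˡ _))))
    (atmost-1 λ { (A ∷ []) (B ∷ []) (_ , p) (_ , p′) → cong (_∷ []) (act-ext A B λ j → trans (p (unit j)) (sym (p′ (unit j)))) })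
  atmost-nonzero-products (suc m) C C≢0 = atmost-≤ (ℕₚ.≤-reflexive total)
    (atmost-⊆ (λ { {A ∷ _} p → split A p }) (atmost-⊎ regular singular))
    where
    P : Vec (Matrix n) (suc (suc m)) → Set
    P As = VAll.All (BoundedMatrix H) As × (∀ v → actAll As v ≡ C v)
    split : ∀ A {As} → P (A ∷ As) → (P (A ∷ As) × nullity A ≡ 0) ⊎ (P (A ∷ As) × nullity A ≢ 0)
    split A p with nullity A ℕₚ.≟ 0
    ... | yes e = inj₁ (p , e)
    ... | no e  = inj₂ (p , e)
    regular : Atmost (λ As → P As × nullity (head As) ≡ 0) (q ^ n * (suc (m * (n * W)) * q ^ (n * m + n″)))
    regular = atmost-fibre _≟ᵐ_ head (λ { {_ ∷ _} ((bA ∷ _ , _) , _) → bA }) atmost-matrices λ A →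
      atmost-inhabited λ { (_ ∷ As₀) (((_ , p₀) , s≡0) , refl) →
        atmost-injection tail
          (λ { {_ ∷ As} (((_ ∷ bAs , p) , _) , refl) → bAs , λ v → x⊖y≡𝟘⇒x≡y (actAll As v) (actAll As₀ v)
            (nullity≡0⇒injective (decompose A) s≡0 _ (toList-all (act-zero⁻ A _
              (trans (⊖-homo (act-linear A) (actAll As v) (actAll As₀ v))
                (trans (cong (_⊖ act A (actAll As₀ v)) (trans (p v) (sym (p₀ v)))) (x⊖x≡𝟘 _)))))) })
          (λ { {_ ∷ _} {_ ∷ _} (_ , refl) (_ , refl) refl → refl })
          (atmost-nonzero-products m (actAll As₀)
            λ z → C≢0 λ v → trans (sym (p₀ v)) (trans (cong (act A) (z v)) (𝟘-homo (act-linear A)))) }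
    singular : Atmost (λ As → P As × nullity (head As) ≢ 0) (n * (W * q ^ suc n″) * ((q ^ n) ^ m * q ^ suc n″))
    singular = atmost-fibre _≟ᵐ_ head (λ { {_ ∷ _} ((bA ∷ _ , _) , e) → bA , e }) atmost-singular λ A →
      atmost-injection tail (λ { {_ ∷ _} (((_ ∷ bAs , p) , _) , refl) → bAs , p })
        (λ { {_ ∷ _} {_ ∷ _} (_ , refl) (_ , refl) refl → refl })
        (atmost-after m A C C≢0)
    open ≡-Reasoning
    V = m * (n * W)
    total : q ^ n * (suc V * q ^ (n * m + n″)) + n * (W * q ^ suc n″) * ((q ^ n) ^ m * q ^ suc n″)
      ≡ suc (suc m * (n * W)) * q ^ (n * suc m + n″)
    total = begin
      q ^ n * (suc V * q ^ (n * m + n″)) + n * (W * q ^ suc n″) * ((q ^ n) ^ m * q ^ suc n″)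
        ≡⟨ cong₂ _+_ (eq₁ (q ^ n) (suc V) (q ^ (n * m + n″))) (eq₂ n W (q ^ suc n″) ((q ^ n) ^ m)) ⟩
      suc V * (q ^ n * q ^ (n * m + n″)) + n * W * (q ^ suc n″ * (q ^ n) ^ m * q ^ suc n″)
        ≡⟨ cong₂ (λ s t → suc V * s + n * W * t) (exp₁) (exp₂) ⟩
      suc V * q ^ (n * suc m + n″) + n * W * q ^ (n * suc m + n″)
        ≡⟨ ℕₚ.*-distribʳ-+ (q ^ (n * suc m + n″)) (suc V) (n * W) ⟨
      (suc V + n * W) * q ^ (n * suc m + n″)
        ≡⟨ cong (_* q ^ (n * suc m + n″)) (cong suc (ℕₚ.+-comm V (n * W))) ⟩
      suc (suc m * (n * W)) * q ^ (n * suc m + n″) ∎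
      where
      eq₁ : ∀ a b c → a * (b * c) ≡ b * (a * c)
      eq₁ = solve-∀ℕ
      eq₂ : ∀ n w a b → n * (w * a) * (b * a) ≡ n * w * (a * b * a)
      eq₂ = solve-∀ℕ
      exp₁ : q ^ n * q ^ (n * m + n″) ≡ q ^ (n * suc m + n″)
      exp₁ = trans (sym (ℕₚ.^-distribˡ-+-* q n (n * m + n″))) (cong (q ^_) (e n n″ m))
        where
        e : ∀ n k m → n + (n * m + k) ≡ n * suc m + k
        e = solve-∀ℕ
      exp₂ : q ^ suc n″ * (q ^ n) ^ m * q ^ suc n″ ≡ q ^ (n * suc m + n″)
      exp₂ = trans (cong (λ t → q ^ suc n″ * t * q ^ suc n″) (ℕₚ.^-*-assoc q n m))
        (trans (cong (_* q ^ suc n″) (sym (ℕₚ.^-distribˡ-+-* q (suc n″) (n * m))))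
        (trans (sym (ℕₚ.^-distribˡ-+-* q (suc n″ + n * m) (suc n″))) (cong (q ^_) (e n″ m))))
        where
        e : ∀ k m → suc k + (2 + k) * m + suc k ≡ (2 + k) * suc m + k
        e = solve-∀ℕ

-- Determinants

alt : ∀ {k} → Fin k → ℤ
alt zero    = 1ℤ
alt (suc j) = - alt j

alt-unique : (s : ∀ k → Fin k → ℤ) → (∀ k → s (suc k) zero ≡ 1ℤ) → (∀ k j → s (suc k) (suc j) ≡ - s k j) →
  ∀ k j → s k j ≡ alt j
alt-unique s s₀ s₊ (suc k) zero    = s₀ k
alt-unique s s₀ s₊ (suc k) (suc j) = trans (s₊ k j) (cong -_ (alt-unique s s₀ s₊ k j))

sum-cong : ∀ n {f g : Fin n → ℤ} → (∀ i → f i ≡ g i) → sumFin n f ≡ sumFin n g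
sum-cong zero    h = refl
sum-cong (suc n) h = cong₂ ℤ._+_ (h zero) (sum-cong n λ i → h (suc i))

sum-+ : ∀ n (f g : Fin n → ℤ) → sumFin n (λ i → f i ℤ.+ g i) ≡ sumFin n f ℤ.+ sumFin n g
sum-+ zero    f g = refl
sum-+ (suc n) f g = trans (cong (λ t → f zero ℤ.+ g zero ℤ.+ t) (sum-+ n (λ i → f (suc i)) (λ i → g (suc i))))
  (eq (f zero) (g zero) (sumFin n (λ i → f (suc i))) (sumFin n (λ i → g (suc i))))
  where
  eq : ∀ a b c d → a ℤ.+ b ℤ.+ (c ℤ.+ d) ≡ a ℤ.+ c ℤ.+ (b ℤ.+ d)
  eq = solve-∀

sum-* : ∀ n c (f : Fin n → ℤ) → sumFin n (λ i → c ℤ.* f i) ≡ c ℤ.* sumFin n f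
sum-* zero    c f = sym (ℤₚ.*-zeroʳ c)
sum-* (suc n) c f = trans (cong (λ t → c ℤ.* f zero ℤ.+ t) (sum-* n c (λ i → f (suc i)))) (sym (ℤₚ.*-distribˡ-+ c (f zero) _))

sum-0 : ∀ n (f : Fin n → ℤ) → (∀ i → f i ≡ 0ℤ) → sumFin n f ≡ 0ℤ
sum-0 zero    f h = refl
sum-0 (suc n) f h = cong₂ ℤ._+_ (h zero) (sum-0 n (λ i → f (suc i)) λ i → h (suc i))

-- The sign function of detF is local to its definition, so it cannot be named here; unification recovers
-- it. `tail-terms` reads off the summands of detF, and in `tail-terms-alt` abstracting the dimension and
-- the function ∣_∣ leaves the local sign as a solvable meta-variable, which becomes `detF-sign`.
tail-terms : ∀ n A → Σ[ f ∈ (Fin n → ℤ) ]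
  detF (suc n) A ≡ 1ℤ ℤ.* (A zero zero ℤ.* detF n (λ i k → A (suc i) (suc k))) ℤ.+ sumFin n f
tail-terms n A = _ , refl

-- Both sides are integer products unfolded into sign and absolute value, with ∣_∣ generalised to
-- `f`: the shape of the goal in `tail-terms-alt` after its abstractions.
sign-product-cong : (s : ∀ k → Fin k → ℤ) → (∀ k → s (suc k) zero ≡ 1ℤ) → (∀ k j → s (suc k) (suc j) ≡ - s k j) →
  ∀ k j (f : ℤ → ℕ) y {t} → t ≡ alt j →
  (ℤ.sign (s k j) Sign.* ℤ.sign y) ℤ.◃ f (s k j) * f y ≡ (ℤ.sign t Sign.* ℤ.sign y) ℤ.◃ f t * f y
sign-product-cong s s₀ s₊ k j f y p rewrite p | alt-unique s s₀ s₊ k j = refl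

mutual
  detF-sign : ∀ w → (Fin (suc w) → Fin (suc w) → ℤ) → ∀ k → Fin k → ℤ
  detF-sign = _

  tail-terms-alt : ∀ n A k → proj₁ (tail-terms n A) k ≡
    - alt k ℤ.* (A zero (suc k) ℤ.* detF n (λ i l → A (suc i) (punchIn (suc k) l)))
  tail-terms-alt (suc n) A zero    = refl
  tail-terms-alt (suc n) A (suc k)
    with A zero (suc (suc k)) | detF (suc n) (λ i l → A (suc i) (punchIn (suc (suc k)) l))
  ... | a | d with suc n | ∣_∣
  ... | w | f = sign-product-cong (detF-sign w A) (λ _ → refl) (λ _ _ → refl) _ k f _ (ℤₚ.neg-involutive (alt k))

laplace-term : ∀ {n} → (Fin (suc n) → ℤ) → (Fin n → Fin (suc n) → ℤ) → Fin (suc n) → ℤ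
laplace-term {n} a R j = alt j ℤ.* (a j ℤ.* detF n (λ i k → R i (punchIn j k)))

-- The row of the expansion is kept apart from the other rows, so that rows can be exchanged or
-- repeated without reindexing a matrix.
laplace : ∀ {n} → (Fin (suc n) → ℤ) → (Fin n → Fin (suc n) → ℤ) → ℤ
laplace {n} a R = sumFin (suc n) (laplace-term a R)

det-laplace : ∀ n A → detF (suc n) A ≡ laplace (A zero) (λ i → A (suc i))
det-laplace n A = trans (proj₂ (tail-terms n A))
  (cong (λ t → 1ℤ ℤ.* (A zero zero ℤ.* detF n (λ i k → A (suc i) (suc k))) ℤ.+ t) (sum-cong n (tail-terms-alt n A)))

det-cong : ∀ n {A B : Fin n → Fin n → ℤ} → (∀ i j → A i j ≡ B i j) → detF n A ≡ detF n B
det-cong zero    h = refl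
det-cong (suc n) {A} {B} h = trans (det-laplace n A) (trans (sum-cong (suc n) λ j →
  cong₂ (λ s t → alt j ℤ.* (s ℤ.* t)) (h zero j) (det-cong n λ i k → h (suc i) (punchIn j k))) (sym (det-laplace n B)))

infixr 5 _▹_

_▹_ : ∀ {m n} → (Fin m → ℤ) → (Fin n → Fin m → ℤ) → Fin (suc n) → Fin m → ℤ
(a ▹ R) zero    = a
(a ▹ R) (suc i) = R i

-- (j′ , k′) names the same ordered pair of distinct columns as (j , k), in the opposite order.
Swapped : ∀ {m} → Fin (suc m) → Fin m → Fin (suc m) → Fin m → Set
Swapped j k j′ k′ = punchIn j k ≡ j′ × punchIn j′ k′ ≡ j

-- For columns a < b the two orders are (a , b - 1) and (b , a), since the second index counts the
-- columns left after deleting the first; the parities differ.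
swapped-alt : ∀ {m} (j : Fin (suc m)) k j′ k′ → Swapped j k j′ k′ → alt j ℤ.* alt k ℤ.+ alt j′ ℤ.* alt k′ ≡ 0ℤ
swapped-alt zero    k       _ zero     (refl , _) = eq (alt k)
  where
  eq : ∀ a → 1ℤ ℤ.* a ℤ.+ (- a) ℤ.* 1ℤ ≡ 0ℤ
  eq = solve-∀
swapped-alt (suc j) zero    _ k′       (refl , refl) = eq (alt k′)
  where
  eq : ∀ a → (- a) ℤ.* 1ℤ ℤ.+ 1ℤ ℤ.* a ≡ 0ℤ
  eq = solve-∀
swapped-alt (suc j) (suc k) _ (suc k′) (refl , q) =
  trans (eq (alt j) (alt k) (alt (punchIn j k)) (alt k′)) (swapped-alt j k _ k′ (refl , Finₚ.suc-injective q))
  where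
  eq : ∀ a b c d → (- a) ℤ.* (- b) ℤ.+ (- c) ℤ.* (- d) ≡ a ℤ.* b ℤ.+ c ℤ.* d
  eq = solve-∀

swapped-punchIn : ∀ {m} (j : Fin (suc (suc m))) k j′ k′ → Swapped j k j′ k′ →
  ∀ l → punchIn j (punchIn k l) ≡ punchIn j′ (punchIn k′ l)
swapped-punchIn zero    k       _ zero     (refl , _)    l       = refl
swapped-punchIn (suc j) zero    _ k′       (refl , refl) l       = refl
swapped-punchIn (suc j) (suc k) _ (suc k′) (refl , q)    zero    = refl
swapped-punchIn (suc j) (suc k) _ (suc k′) (refl , q)    (suc l) =
  cong suc (swapped-punchIn j k _ k′ (refl , Finₚ.suc-injective q) l)

-- Pairs that involve column 0 cancel against each other, (0 , k) of one sum against (k + 1 , 0) of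
-- the other; the remaining pairs are the same sums for one column fewer.
sum-swapped : ∀ m (f g : Fin (suc m) → Fin m → ℤ) →
  (∀ j k j′ k′ → Swapped j k j′ k′ → f j k ℤ.+ g j′ k′ ≡ 0ℤ) →
  sumFin (suc m) (λ j → sumFin m (f j)) ℤ.+ sumFin (suc m) (λ j → sumFin m (g j)) ≡ 0ℤ
sum-swapped zero    f g h = refl
sum-swapped (suc m) f g h = begin
  Σ₀ f ℤ.+ sumFin (suc m) (λ j → f (suc j) zero ℤ.+ Σ₊ f j) ℤ.+ (Σ₀ g ℤ.+ sumFin (suc m) (λ j → g (suc j) zero ℤ.+ Σ₊ g j))
    ≡⟨ cong₂ (λ s t → Σ₀ f ℤ.+ s ℤ.+ (Σ₀ g ℤ.+ t)) (sum-+ (suc m) (λ j → f (suc j) zero) (Σ₊ f)) (sum-+ (suc m) (λ j → g (suc j) zero) (Σ₊ g)) ⟩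
  Σ₀ f ℤ.+ (Σ¹ f ℤ.+ sumFin (suc m) (Σ₊ f)) ℤ.+ (Σ₀ g ℤ.+ (Σ¹ g ℤ.+ sumFin (suc m) (Σ₊ g)))
    ≡⟨ eq (Σ₀ f) (Σ¹ f) (sumFin (suc m) (Σ₊ f)) (Σ₀ g) (Σ¹ g) (sumFin (suc m) (Σ₊ g)) ⟩
  (Σ₀ f ℤ.+ Σ¹ g) ℤ.+ (Σ¹ f ℤ.+ Σ₀ g) ℤ.+ (sumFin (suc m) (Σ₊ f) ℤ.+ sumFin (suc m) (Σ₊ g))
    ≡⟨ cong₂ ℤ._+_ (cong₂ ℤ._+_
        (trans (sym (sum-+ (suc m) (f zero) (λ j → g (suc j) zero))) (sum-0 (suc m) _ λ k → h zero k (suc k) zero (refl , refl)))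
        (trans (sym (sum-+ (suc m) (λ j → f (suc j) zero) (g zero))) (sum-0 (suc m) _ λ k → h (suc k) zero zero k (refl , refl))))
        (sum-swapped m (λ j k → f (suc j) (suc k)) (λ j k → g (suc j) (suc k))
          λ j k j′ k′ (p , q) → h (suc j) (suc k) (suc j′) (suc k′) (cong suc p , cong suc q)) ⟩
  0ℤ ∎
  where
  open ≡-Reasoning
  Σ₀ Σ¹ : (Fin (suc (suc m)) → Fin (suc m) → ℤ) → ℤ
  Σ₀ f = sumFin (suc m) (f zero)
  Σ¹ f = sumFin (suc m) (λ j → f (suc j) zero)
  Σ₊ : (Fin (suc (suc m)) → Fin (suc m) → ℤ) → Fin (suc m) → ℤ
  Σ₊ f j = sumFin m (λ k → f (suc j) (suc k))
  eq : ∀ a b c d e f → a ℤ.+ (b ℤ.+ c) ℤ.+ (d ℤ.+ (e ℤ.+ f)) ≡ (a ℤ.+ e) ℤ.+ (b ℤ.+ d) ℤ.+ (c ℤ.+ f)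
  eq = solve-∀

-- Expand along both rows. Opposite orders of two columns give the same entries and the same minor,
-- with opposite signs.
laplace-swap : ∀ {n} (a b : Fin (suc (suc n)) → ℤ) (S : Fin n → Fin (suc (suc n)) → ℤ) →
  laplace a (b ▹ S) ℤ.+ laplace b (a ▹ S) ≡ 0ℤ
laplace-swap {n} a b S = trans (cong₂ ℤ._+_ (double a b) (double b a))
  (sum-swapped (suc n) (term a b) (term b a) cancel)
  where
  N : Fin (suc (suc n)) → Fin (suc n) → ℤ
  N j k = detF n (λ i l → S i (punchIn j (punchIn k l)))
  term : (a b : Fin (suc (suc n)) → ℤ) → Fin (suc (suc n)) → Fin (suc n) → ℤ
  term a b j k = alt j ℤ.* alt k ℤ.* (a j ℤ.* b (punchIn j k) ℤ.* N j k)
  double : ∀ a b → laplace a (b ▹ S) ≡ sumFin (suc (suc n)) (λ j → sumFin (suc n) (term a b j))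
  double a b = sum-cong (suc (suc n)) λ j →
    trans (cong (λ t → alt j ℤ.* (a j ℤ.* t)) (det-laplace n (λ i k → (b ▹ S) i (punchIn j k))))
    (trans (sym (ℤₚ.*-assoc (alt j) (a j) (laplace (λ k → b (punchIn j k)) (λ i k → S i (punchIn j k))))) (trans (sym (sum-* (suc n) (alt j ℤ.* a j) (laplace-term (λ k → b (punchIn j k)) (λ i k → S i (punchIn j k)))))
      (sum-cong (suc n) λ k → eq (alt j) (a j) (alt k) (b (punchIn j k)) (N j k))))
    where
    eq : ∀ p q r s t → p ℤ.* q ℤ.* (r ℤ.* (s ℤ.* t)) ≡ p ℤ.* r ℤ.* (q ℤ.* s ℤ.* t)
    eq = solve-∀
  cancel : ∀ j k j′ k′ → Swapped j k j′ k′ → term a b j k ℤ.+ term b a j′ k′ ≡ 0ℤ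
  cancel j k j′ k′ s@(refl , q) = trans (cong (λ t → term a b j k ℤ.+ t) (cong (alt j′ ℤ.* alt k′ ℤ.*_)
      (cong₂ (λ u v → b (punchIn j k) ℤ.* a u ℤ.* v) q (det-cong n λ i l → cong (S i) (sym (swapped-punchIn j k _ k′ s l))))))
    (trans (eq (alt j ℤ.* alt k) (alt (punchIn j k) ℤ.* alt k′) (a j) (b (punchIn j k)) (N j k))
      (cong (ℤ._* (a j ℤ.* b (punchIn j k) ℤ.* N j k)) (swapped-alt j k _ k′ s)))
    where
    eq : ∀ s t p q r → s ℤ.* (p ℤ.* q ℤ.* r) ℤ.+ t ℤ.* (q ℤ.* p ℤ.* r) ≡ (s ℤ.+ t) ℤ.* (p ℤ.* q ℤ.* r)
    eq = solve-∀

a+b≡0⇒a≡-b : ∀ a b → a ℤ.+ b ≡ 0ℤ → a ≡ - b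
a+b≡0⇒a≡-b a b e = trans (eq a b) (trans (cong (ℤ._- b) e) (ℤₚ.+-identityˡ (- b)))
  where
  eq : ∀ a b → a ≡ a ℤ.+ b ℤ.- b
  eq = solve-∀

laplace-▹ : ∀ {n} a (R : Fin (suc n) → Fin (suc (suc n)) → ℤ) → laplace a R ≡ laplace a (R zero ▹ λ i → R (suc i))
laplace-▹ {n} a R = sum-cong (suc (suc n)) λ j → cong (λ t → alt j ℤ.* (a j ℤ.* t)) (det-cong (suc n) {λ i k → R i (punchIn j k)}
  {λ i k → (R zero ▹ λ i → R (suc i)) i (punchIn j k)} λ { zero _ → refl ; (suc _) _ → refl })

laplace-transpose : ∀ {n} a (R : Fin (suc n) → Fin (suc (suc n)) → ℤ) →
  laplace a R ≡ - laplace (R zero) (a ▹ λ i → R (suc i))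
laplace-transpose a R = trans (laplace-▹ a R)
  (a+b≡0⇒a≡-b (laplace a (R zero ▹ S)) (laplace (R zero) (a ▹ S)) (laplace-swap a (R zero) S))
  where S = λ i → R (suc i)

-- If the top two rows agree, the determinant is its own negative. Otherwise exchange them: the
-- repetition moves into the minors of the new expansion.
laplace-repeated : ∀ n (R : Fin n → Fin (suc n) → ℤ) i → laplace (R i) R ≡ 0ℤ
laplace-repeated (suc n) R zero = 2x≡0⇒x≡0 (laplace (R zero) R)
  (trans (cong₂ ℤ._+_ (laplace-▹ (R zero) R) (laplace-▹ (R zero) R)) (laplace-swap (R zero) (R zero) (λ i → R (suc i))))
  where
  2x≡0⇒x≡0 : ∀ x → x ℤ.+ x ≡ 0ℤ → x ≡ 0ℤ
  2x≡0⇒x≡0 (+ zero) _ = refl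
laplace-repeated (suc n) R (suc i) = trans (laplace-transpose (R (suc i)) R)
  (cong -_ (sum-0 (suc (suc n)) (laplace-term (R zero) (R (suc i) ▹ S)) λ j → trans (cong (λ t → alt j ℤ.* (R zero j ℤ.* t)) (minor j))
    (trans (cong (alt j ℤ.*_) (ℤₚ.*-zeroʳ (R zero j))) (ℤₚ.*-zeroʳ (alt j)))))
  where
  S = λ i → R (suc i)
  minor : ∀ j → detF (suc n) (λ i′ k → (R (suc i) ▹ S) i′ (punchIn j k)) ≡ 0ℤ
  minor j = trans (det-laplace n (λ i′ k → (R (suc i) ▹ S) i′ (punchIn j k)))
    (laplace-repeated n (λ i k → R (suc i) (punchIn j k)) i)

-- Row `suc k`, once moved to the top, is exchanged with row 0, which gives one sign; within each
-- minor it then descends past `k` rows by induction.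
laplace-rotate : ∀ n A (k : Fin (suc n)) → alt k ℤ.* laplace (A k) (λ i → A (punchIn k i)) ≡ detF (suc n) A
laplace-rotate n       A zero    = trans (ℤₚ.*-identityˡ _) (sym (det-laplace n A))
laplace-rotate (suc n) A (suc k) = begin
  - alt k ℤ.* laplace (A (suc k)) (λ i → A (punchIn (suc k) i))
    ≡⟨ cong (- alt k ℤ.*_) (laplace-transpose (A (suc k)) (λ i → A (punchIn (suc k) i))) ⟩
  - alt k ℤ.* - laplace (A zero) (A (suc k) ▹ S)
    ≡⟨ eq (alt k) (laplace (A zero) (A (suc k) ▹ S)) ⟩
  alt k ℤ.* laplace (A zero) (A (suc k) ▹ S)
    ≡⟨ sum-* (suc (suc n)) (alt k) (laplace-term (A zero) (A (suc k) ▹ S)) ⟨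
  sumFin (suc (suc n)) (λ j → alt k ℤ.* (alt j ℤ.* (A zero j ℤ.* detF (suc n) (λ i l → (A (suc k) ▹ S) i (punchIn j l)))))
    ≡⟨ sum-cong (suc (suc n)) (λ j → trans (eq′ (alt k) (alt j) (A zero j) (detF (suc n) (λ i l → (A (suc k) ▹ S) i (punchIn j l)))) (cong (λ t → alt j ℤ.* (A zero j ℤ.* t)) (minor j))) ⟩
  laplace (A zero) (λ i → A (suc i))
    ≡⟨ det-laplace (suc n) A ⟨
  detF (suc (suc n)) A ∎
  where
  open ≡-Reasoning
  S : Fin n → Fin (suc (suc n)) → ℤ
  S i = A (suc (punchIn k i))
  eq : ∀ a b → (- a) ℤ.* (- b) ≡ a ℤ.* b
  eq = solve-∀
  eq′ : ∀ a b c d → a ℤ.* (b ℤ.* (c ℤ.* d)) ≡ b ℤ.* (c ℤ.* (a ℤ.* d))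
  eq′ = solve-∀
  minor : ∀ j → alt k ℤ.* detF (suc n) (λ i l → (A (suc k) ▹ S) i (punchIn j l)) ≡ detF (suc n) (λ i l → A (suc i) (punchIn j l))
  minor j = trans (cong (alt k ℤ.*_) (det-laplace n (λ i l → (A (suc k) ▹ S) i (punchIn j l))))
    (laplace-rotate n (λ i l → A (suc i) (punchIn j l)) k)

dot≡sum : ∀ {n} (x y : Vec ℤ n) → dot x y ≡ sumFin n (λ j → lookup x j ℤ.* lookup y j)
dot≡sum []      []      = refl
dot≡sum (a ∷ x) (b ∷ y) = cong (λ t → a ℤ.* b ℤ.+ t) (dot≡sum x y)

cofactor : ∀ {n} → Matrix (suc n) → Fin (suc n) → Fin (suc n) → ℤ
cofactor {n} C k j = alt k ℤ.* (alt j ℤ.* detF n (λ i l → entry C (punchIn k i) (punchIn j l)))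

-- Row k holds the cofactors of row k, so this is the transpose of the classical adjugate. It is
-- therefore applied by `comb`, which multiplies from the left.
adjugate : ∀ {n} → Matrix n → Matrix n
adjugate {zero}  C = []
adjugate {suc n} C = tabulate λ k → tabulate (cofactor C k)

dot-adjugate : ∀ {n} (C : Matrix n) k i → dot (lookup (adjugate C) k) (lookup C i) ≡ det C ℤ.* lookup (unit i) k
dot-adjugate {suc n} C k i = trans expand (by-cases (k Fin.≟ i))
  where
  open ≡-Reasoning
  R : Fin n → Fin (suc n) → ℤ
  R l = entry C (punchIn k l)
  expand : dot (lookup (adjugate C) k) (lookup C i) ≡ alt k ℤ.* laplace (entry C i) R
  expand = begin
    dot (lookup (adjugate C) k) (lookup C i)
      ≡⟨ dot≡sum (lookup (adjugate C) k) (lookup C i) ⟩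
    sumFin (suc n) (λ j → entry (adjugate C) k j ℤ.* entry C i j)
      ≡⟨ sum-cong (suc n) (λ j → trans (cong (ℤ._* entry C i j) (trans (cong (λ t → lookup t j) (Vecₚ.lookup∘tabulate (λ k → tabulate (cofactor C k)) k)) (Vecₚ.lookup∘tabulate (cofactor C k) j)))
           (eq (alt k) (alt j) (detF n (λ i l → R i (punchIn j l))) (entry C i j))) ⟩
    sumFin (suc n) (λ j → alt k ℤ.* (alt j ℤ.* (entry C i j ℤ.* detF n (λ i l → R i (punchIn j l)))))
      ≡⟨ sum-* (suc n) (alt k) (laplace-term (entry C i) R) ⟩
    alt k ℤ.* laplace (entry C i) R ∎
    where
    eq : ∀ a b c d → a ℤ.* (b ℤ.* c) ℤ.* d ≡ a ℤ.* (b ℤ.* (d ℤ.* c))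
    eq = solve-∀
  by-cases : Dec (k ≡ i) → alt k ℤ.* laplace (entry C i) R ≡ det C ℤ.* lookup (unit i) k
  by-cases (yes refl) = trans (laplace-rotate n (entry C) k)
    (trans (sym (ℤₚ.*-identityʳ (det C))) (cong (det C ℤ.*_) (sym (proj₁ (entry-identity k k) refl))))
  by-cases (no k≢i) = begin
    alt k ℤ.* laplace (entry C i) R                            ≡⟨ cong (λ t → alt k ℤ.* laplace (entry C t) R) (Finₚ.punchIn-punchOut k≢i) ⟨
    alt k ℤ.* laplace (R (punchOut k≢i)) R                     ≡⟨ cong (alt k ℤ.*_) (laplace-repeated n R (punchOut k≢i)) ⟩
    alt k ℤ.* 0ℤ                                               ≡⟨ ℤₚ.*-zeroʳ (alt k) ⟩
    0ℤ                                                         ≡⟨ ℤₚ.*-zeroʳ (det C) ⟨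
    det C ℤ.* 0ℤ                                               ≡⟨ cong (det C ℤ.*_) (proj₂ (entry-identity i k) k≢i) ⟨
    det C ℤ.* lookup (unit i) k                                ∎

act-adjugate : ∀ {n} (C : Matrix n) v → act C (comb v (adjugate C)) ≡ det C ⊙ v
act-adjugate C v = lookup-ext _ _ λ i → begin
  lookup (act C (comb v (adjugate C))) i     ≡⟨ lookup-act C (comb v (adjugate C)) i ⟩
  dot (lookup C i) (comb v (adjugate C))     ≡⟨ dot-comm (lookup C i) (comb v (adjugate C)) ⟩
  dot (comb v (adjugate C)) (lookup C i)     ≡⟨ dot-comb≡dot-act v (adjugate C) (lookup C i) ⟩
  dot v (act (adjugate C) (lookup C i))      ≡⟨ cong (dot v) (lookup-ext _ (det C ⊙ unit i) λ k →
      trans (lookup-act (adjugate C) (lookup C i) k) (trans (dot-adjugate C k i) (sym (Vecₚ.lookup-map k (det C ℤ.*_) (unit i))))) ⟩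
  dot v (det C ⊙ unit i)                     ≡⟨ dot-⊙ʳ (det C) v (unit i) ⟩
  det C ℤ.* dot v (unit i)                   ≡⟨ cong (det C ℤ.*_) (trans (dot-comm v (unit i)) (dot-unitˡ i v)) ⟩
  det C ℤ.* lookup v i                       ≡⟨ Vecₚ.lookup-map i (det C ℤ.*_) v ⟨
  lookup (det C ⊙ v) i                       ∎
  where open ≡-Reasoning

∣alt∣≡1 : ∀ {k} (j : Fin k) → ∣ alt j ∣ ≡ 1
∣alt∣≡1 zero    = refl
∣alt∣≡1 (suc j) = trans (ℤₚ.∣-i∣≡∣i∣ (alt j)) (∣alt∣≡1 j)

∣sum∣≤ : ∀ n (f : Fin n → ℤ) {X} → (∀ i → ∣ f i ∣ ≤ X) → ∣ sumFin n f ∣ ≤ n * X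
∣sum∣≤ zero    f h = z≤n
∣sum∣≤ (suc n) f h = ℕₚ.≤-trans (ℤₚ.∣i+j∣≤∣i∣+∣j∣ (f zero) _) (ℕₚ.+-mono-≤ (h zero) (∣sum∣≤ n (λ i → f (suc i)) λ i → h (suc i)))

∣det∣≤ : ∀ n (A : Fin n → Fin n → ℤ) {M} → (∀ i j → ∣ A i j ∣ ≤ M) → ∣ detF n A ∣ ≤ n ! * M ^ n
∣det∣≤ zero    A h = ℕₚ.≤-refl
∣det∣≤ (suc n) A {M} h = begin
  ∣ detF (suc n) A ∣                              ≡⟨ cong ∣_∣ (det-laplace n A) ⟩
  ∣ laplace (A zero) (λ i → A (suc i)) ∣          ≤⟨ ∣sum∣≤ (suc n) (laplace-term (A zero) (λ i → A (suc i))) term≤ ⟩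
  suc n * (M * (n ! * M ^ n))                     ≡⟨ eq (suc n) M (n !) (M ^ n) ⟩
  suc n ! * M ^ suc n                             ∎
  where
  open ℕₚ.≤-Reasoning
  eq : ∀ s m f p → s * (m * (f * p)) ≡ s * f * (m * p)
  eq = solve-∀ℕ
  term≤ : ∀ j → ∣ laplace-term (A zero) (λ i → A (suc i)) j ∣ ≤ M * (n ! * M ^ n)
  term≤ j = begin
    ∣ alt j ℤ.* (A zero j ℤ.* d) ∣      ≡⟨ ℤₚ.∣i*j∣≡∣i∣*∣j∣ (alt j) (A zero j ℤ.* d) ⟩
    ∣ alt j ∣ * ∣ A zero j ℤ.* d ∣      ≡⟨ cong₂ _*_ (∣alt∣≡1 j) (ℤₚ.∣i*j∣≡∣i∣*∣j∣ (A zero j) d) ⟩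
    1 * (∣ A zero j ∣ * ∣ d ∣)          ≡⟨ ℕₚ.*-identityˡ (∣ A zero j ∣ * ∣ d ∣) ⟩
    ∣ A zero j ∣ * ∣ d ∣                ≤⟨ ℕₚ.*-mono-≤ (h zero j) (∣det∣≤ n (λ i k → A (suc i) (punchIn j k)) λ i k → h (suc i) (punchIn j k)) ⟩
    M * (n ! * M ^ n)                   ∎
    where d = detF n (λ i k → A (suc i) (punchIn j k))

-- Divisors and subpolynomial functions

rising : ℕ → ℕ → ℕ
rising a zero    = 1
rising a (suc q) = suc a * rising (suc a) q

rising-suc : ∀ a q → rising a (suc q) ≡ rising a q * (suc a + q)
rising-suc a zero    = trans (ℕₚ.*-identityʳ (suc a)) (sym (trans (ℕₚ.*-identityˡ (suc a + 0)) (ℕₚ.+-identityʳ (suc a))))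
rising-suc a (suc q) = trans (cong (suc a *_) (rising-suc (suc a) q))
  (trans (sym (ℕₚ.*-assoc (suc a) (rising (suc a) q) (suc (suc a) + q))) (cong (suc a * rising (suc a) q *_) (cong suc (sym (ℕₚ.+-suc a q)))))

-- rising a q / q! is a binomial coefficient, and this is Pascal's rule.
rising≤ : ∀ a q → rising a q ≤ q ! * 2 ^ (a + q)
rising≤ a       zero    = ℕₚ.≤-trans (ℕₚ.m^n>0 2 (a + 0)) (ℕₚ.≤-reflexive (sym (ℕₚ.*-identityˡ _)))
rising≤ zero    (suc q) = begin
  rising 0 (suc q)                ≡⟨ rising-suc 0 q ⟩
  rising 0 q * suc q              ≤⟨ ℕₚ.*-monoˡ-≤ (suc q) (rising≤ 0 q) ⟩
  q ! * 2 ^ q * suc q             ≡⟨ eq (q !) (2 ^ q) (suc q) ⟩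
  suc q * q ! * 2 ^ q             ≤⟨ ℕₚ.*-monoʳ-≤ (suc q !) (ℕₚ.m≤n*m (2 ^ q) 2) ⟩
  suc q ! * 2 ^ suc q             ∎
  where
  open ℕₚ.≤-Reasoning
  eq : ∀ a b c → a * b * c ≡ c * a * b
  eq = solve-∀ℕ
rising≤ (suc a) (suc q) = begin
  rising (suc a) (suc q)                                     ≡⟨ rising-suc (suc a) q ⟩
  rising (suc a) q * (suc (suc a) + q)                       ≡⟨ eq (rising (suc a) q) a q ⟩
  suc a * rising (suc a) q + suc q * rising (suc a) q        ≤⟨ ℕₚ.+-mono-≤ (rising≤ a (suc q)) (ℕₚ.*-monoʳ-≤ (suc q) (rising≤ (suc a) q)) ⟩
  suc q ! * 2 ^ (a + suc q) + suc q * (q ! * 2 ^ (suc a + q)) ≡⟨ cong₂ (λ s t → suc q ! * 2 ^ s + t) (ℕₚ.+-suc a q) (sym (ℕₚ.*-assoc (suc q) (q !) (2 ^ suc (a + q)))) ⟩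
  suc q ! * 2 ^ suc (a + q) + suc q ! * 2 ^ suc (a + q)      ≡⟨ eq′ (suc q !) (2 ^ suc (a + q)) ⟩
  suc q ! * (2 * 2 ^ suc (a + q))                            ≡⟨ cong (λ t → suc q ! * 2 ^ suc t) (ℕₚ.+-suc a q) ⟨
  suc q ! * 2 ^ (suc a + suc q)                              ∎
  where
  open ℕₚ.≤-Reasoning
  eq : ∀ r a q → r * (suc (suc a) + q) ≡ suc a * r + suc q * r
  eq = solve-∀ℕ
  eq′ : ∀ f x → f * x + f * x ≡ f * (2 * x)
  eq′ = solve-∀ℕ

power≤rising : ∀ a q → suc a ^ q ≤ rising a q
power≤rising a zero    = ℕₚ.≤-refl
power≤rising a (suc q) = ℕₚ.*-monoʳ-≤ (suc a) (ℕₚ.≤-trans (ℕₚ.^-monoˡ-≤ q (ℕₚ.n≤1+n (suc a))) (power≤rising (suc a) q))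

κ₂ : ℕ → ℕ
κ₂ q = q ! * 2 ^ q

-- Needed twice: with `a` the exponent of a prime, for the divisor bound, and with `a` the logarithm
-- of `H`.
power≤exponential : ∀ a q → suc a ^ q ≤ κ₂ q * 2 ^ a
power≤exponential a q = ℕₚ.≤-trans (power≤rising a q) (ℕₚ.≤-trans (rising≤ a q) (ℕₚ.≤-reflexive
  (trans (cong (q ! *_) (trans (ℕₚ.^-distribˡ-+-* 2 a q) (ℕₚ.*-comm (2 ^ a) (2 ^ q)))) (sym (ℕₚ.*-assoc (q !) (2 ^ q) (2 ^ a))))))

prime-divisor-split : ∀ {p t D} → Prime p → t ∣ℕ p * D → t ∣ℕ D ⊎ ∃[ t₁ ] t ≡ p * t₁ × t₁ ∣ℕ D
prime-divisor-split {p} {t} {D} pp (divides u eq) with euclidsLemma u t pp (divides D (trans (sym eq) (ℕₚ.*-comm p D)))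
... | inj₁ (divides v refl) = inj₁ (divides v (ℕₚ.*-cancelˡ-≡ D (v * t) p {{prime⇒nonZero pp}} (trans eq (lem v p t))))
  where
  lem : ∀ v p t → v * p * t ≡ p * (v * t)
  lem = solve-∀ℕ
... | inj₂ (divides v refl) = inj₂ (v , ℕₚ.*-comm v p , divides u (ℕₚ.*-cancelˡ-≡ D (u * v) p {{prime⇒nonZero pp}} (trans eq (lem u v p))))
  where
  lem : ∀ u v p → u * (v * p) ≡ p * (u * v)
  lem = solve-∀ℕ

prime-power-divisor : ∀ {p t e} → Prime p → ∀ a → t ∣ℕ p ^ a * e → ∃[ i ] ∃[ s ] i ≤ a × s ∣ℕ e × t ≡ p ^ i * s
prime-power-divisor {t = t} {e} pp zero    d = 0 , t , z≤n , subst (t ∣ℕ_) (ℕₚ.*-identityˡ e) d , sym (ℕₚ.*-identityˡ t)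
prime-power-divisor {p} {t} {e} pp (suc a) d with prime-divisor-split pp (subst (t ∣ℕ_) (ℕₚ.*-assoc p (p ^ a) e) d)
... | inj₁ d′ = let i , s , i≤a , s∣e , eq = prime-power-divisor pp a d′ in i , s , ℕₚ.m≤n⇒m≤1+n i≤a , s∣e , eq
... | inj₂ (t₁ , refl , d′) = let i , s , i≤a , s∣e , eq = prime-power-divisor pp a d′ in
  suc i , s , s≤s i≤a , s∣e , trans (cong (p *_) eq) (sym (ℕₚ.*-assoc p (p ^ i) s))

Divisors : ℕ → List ℕ → Set
Divisors D ds = ∀ {t} → t ∣ℕ D → t ∈ ds

divisors-prime-power : ∀ {p} → Prime p → ∀ a e ds → Divisors e ds →
  ∃[ ds′ ] Divisors (p ^ a * e) ds′ × length ds′ ≡ suc a * length ds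
divisors-prime-power {p} pp a e ds h = List.cartesianProductWith (λ i s → p ^ i * s) (List.upTo (suc a)) ds ,
  (λ d → let i , s , i≤a , s∣e , eq = prime-power-divisor pp a d in
    subst (_∈ _) (sym eq) (∈ₚ.∈-cartesianProductWith⁺ (λ i s → p ^ i * s) (∈ₚ.∈-upTo⁺ (s≤s i≤a)) (h s∣e))) ,
  trans (length-product (λ i s → p ^ i * s) (List.upTo (suc a)) ds) (cong (_* length ds) (Listₚ.length-upTo (suc a)))

strip : ∀ p D → Prime p → 0 < D → Acc _<_ D → ∃[ a ] ∃[ e ] D ≡ p ^ a * e × ¬ (p ∣ℕ e)
strip p D pp D>0 (acc rs) with p ∣ℕ? D
... | no p∤D = 0 , D , sym (ℕₚ.*-identityˡ D) , p∤D
... | yes (divides zero refl) = ⊥-elim (ℕₚ.<-irrefl refl D>0)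
... | yes (divides E@(suc _) refl) =
  let a , e , eq , p∤e = strip p E pp (s≤s z≤n) (rs (ℕₚ.m<m*n E p (nonTrivial⇒n>1 p {{prime⇒nonTrivial pp}})))
  in suc a , e , trans (ℕₚ.*-comm E p) (trans (cong (p *_) eq) (sym (ℕₚ.*-assoc p (p ^ a) e))) , p∤e

-- Each prime factor, counted with multiplicity, at most doubles the number of divisors, and 2^q is
-- at most that prime.
divisors-of-large-primes : ∀ q ps → All Prime ps → All (2 ^ q ≤_) ps →
  ∃[ ds ] Divisors (product ps) ds × length ds ^ q ≤ product ps
divisors-of-large-primes q [] [] [] = 1 ∷ [] , (λ d → here (ℕₚ.≤-antisym (∣⇒≤ d) (positive d))) , ℕₚ.≤-reflexive (ℕₚ.^-zeroˡ q)
  where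
  positive : ∀ {t} → t ∣ℕ 1 → 1 ≤ t
  positive {zero} (divides u eq) = ⊥-elim (ℕₚ.1+n≢0 (trans eq (ℕₚ.*-zeroʳ u)))
  positive {suc t} _ = s≤s z≤n
divisors-of-large-primes q (p ∷ ps) (pp ∷ pps) (b ∷ bs) =
  let ds , h , len = divisors-of-large-primes q ps pps bs
      ds′ , h′ , len′ = divisors-prime-power pp 1 (product ps) ds h
  in ds′ , (λ {t} d → h′ (subst (λ s → t ∣ℕ s * product ps) (sym (ℕₚ.*-identityʳ p)) d)) , (begin
    length ds′ ^ q                   ≡⟨ cong (_^ q) len′ ⟩
    (2 * length ds) ^ q              ≡⟨ ^-distribʳ-* 2 (length ds) q ⟩
    2 ^ q * length ds ^ q            ≤⟨ ℕₚ.*-mono-≤ b len ⟩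
    p * product ps                   ∎)
  where open ℕₚ.≤-Reasoning

κ₂>0 : ∀ q → 0 < κ₂ q
κ₂>0 q = subst (_≤ κ₂ q) (ℕₚ.^-zeroˡ q)
  (ℕₚ.≤-trans (power≤exponential 0 q) (ℕₚ.≤-reflexive (ℕₚ.*-identityʳ (κ₂ q))))

-- Each of the at most 2^q primes below 2^q costs a factor κ₂ q.
divisors-rough : ∀ q k B D → B + k ≡ 2 ^ q → 0 < D → (∀ {p} → Prime p → p ∣ℕ D → B ≤ p) →
  ∃[ ds ] Divisors D ds × length ds ^ q ≤ κ₂ q ^ k * D
divisors-rough q zero B D eq D>0 rough =
  let ds , h , len = divisors-of-large-primes q factors factorsPrime (All.tabulate λ {p} p∈ →
        subst (_≤ p) (trans (sym (ℕₚ.+-identityʳ B)) eq) (rough (All.lookup factorsPrime p∈) (subst (p ∣ℕ_) (sym isFactorisation) (∈⇒∣product p∈))))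
  in ds , (λ {t} d → h (subst (t ∣ℕ_) isFactorisation d)) ,
     ℕₚ.≤-trans len (ℕₚ.≤-reflexive (trans (sym isFactorisation) (sym (ℕₚ.*-identityˡ D))))
  where
  open PrimeFactorisation (factorise D {{>-nonZero D>0}})
  ∈⇒∣product : ∀ {p ps} → p ∈ ps → p ∣ℕ product ps
  ∈⇒∣product {p} {_ ∷ ps} (here refl) = m∣m*n (product ps)
  ∈⇒∣product {p} {r ∷ ps} (there p∈)  = ∣-trans (∈⇒∣product p∈) (n∣m*n r)
divisors-rough q (suc k) B D eq D>0 rough with prime? B
... | no ¬prime =
  let ds , h , len = divisors-rough q k (suc B) D (trans (sym (ℕₚ.+-suc B k)) eq) D>0
        λ {p} pp p∣D → ℕₚ.≤∧≢⇒< (rough pp p∣D) λ { refl → ¬prime pp }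
  in ds , h , ℕₚ.≤-trans len (ℕₚ.*-monoˡ-≤ D (ℕₚ.m≤n*m (κ₂ q ^ k) (κ₂ q) {{>-nonZero (κ₂>0 q)}}))
... | yes pB with strip B D pB D>0 (<-wellFounded D)
... | a , zero , refl , _ = ⊥-elim (ℕₚ.<-irrefl (sym (ℕₚ.*-zeroʳ (B ^ a))) D>0)
... | a , e@(suc _) , refl , B∤e =
  let ds , h , len = divisors-rough q k (suc B) e (trans (sym (ℕₚ.+-suc B k)) eq) (s≤s z≤n)
        λ {p} pp p∣e → ℕₚ.≤∧≢⇒< (rough pp (∣-trans p∣e (n∣m*n (B ^ a)))) λ { refl → B∤e p∣e }
      ds′ , h′ , len′ = divisors-prime-power pB a e ds h
  in ds′ , h′ , (begin
    length ds′ ^ q                              ≡⟨ cong (_^ q) len′ ⟩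
    (suc a * length ds) ^ q                     ≡⟨ ^-distribʳ-* (suc a) (length ds) q ⟩
    suc a ^ q * length ds ^ q                   ≤⟨ ℕₚ.*-mono-≤ (power≤exponential a q) len ⟩
    κ₂ q * 2 ^ a * (κ₂ q ^ k * e)               ≤⟨ ℕₚ.*-monoˡ-≤ (κ₂ q ^ k * e) (ℕₚ.*-monoʳ-≤ (κ₂ q) (ℕₚ.^-monoˡ-≤ a (nonTrivial⇒n>1 B {{prime⇒nonTrivial pB}}))) ⟩
    κ₂ q * B ^ a * (κ₂ q ^ k * e)               ≡⟨ ℕₚ.[m*n]*[o*p]≡[m*o]*[n*p] (κ₂ q) (B ^ a) (κ₂ q ^ k) e ⟩
    κ₂ q ^ suc k * (B ^ a * e)                  ∎)
  where open ℕₚ.≤-Reasoning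

divisors : ℕ → List ℕ
divisors D = List.filter (_∣ℕ? D) (List.upTo (suc D))

∈-divisors : ∀ {D t} → 0 < D → t ∣ℕ D → t ∈ divisors D
∈-divisors {D} D>0 d = ∈ₚ.∈-filter⁺ (_∣ℕ? D) (∈ₚ.∈-upTo⁺ (s≤s (∣⇒≤ {{>-nonZero D>0}} d))) d

-- The classical bound O(D^ε) for the number of divisors, with ε = 1/q.
divisor-bound : ∀ q → ∃[ c ] ∀ D → 0 < D → length (divisors D) ^ q ≤ c * D
divisor-bound q = κ₂ q ^ (2 ^ q) , λ D D>0 →
  let ds , h , len = divisors-rough q (2 ^ q) 0 D refl D>0 (λ _ _ → z≤n)
  in ℕₚ.≤-trans (ℕₚ.^-monoˡ-≤ q (atmost-list {P = _∣ℕ D} ds h (divisors D)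
       (Uniqueₚ.filter⁺ (_∣ℕ? D) (Uniqueₚ.upTo⁺ (suc D))) (Allₚ.all-filter (_∣ℕ? D) (List.upTo (suc D))))) len

-- This is f(H) = H^o(1), with ε = 1/q. No implied constant appears, since constants are themselves
-- subpolynomial.
Subpolynomial : (ℕ → ℕ) → Set
Subpolynomial f = ∀ q → ∃[ H₀ ] ∀ H → H ≥ H₀ → f H ^ q ≤ H

sub-const : ∀ c → Subpolynomial (λ _ → c)
sub-const c q = c ^ q , λ H H≥ → H≥

sub-* : ∀ {f g} → Subpolynomial f → Subpolynomial g → Subpolynomial (λ H → f H * g H)
sub-* {f} {g} F G q =
  let H₁ , h₁ = F (q + q) ; H₂ , h₂ = G (q + q) in
  H₁ ⊔ H₂ , λ H H≥ → subst (_≤ H) (sym (^-distribʳ-* (f H) (g H) q))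
    (bound (f H) (g H) (h₁ H (ℕₚ.≤-trans (ℕₚ.m≤m⊔n H₁ H₂) H≥)) (h₂ H (ℕₚ.≤-trans (ℕₚ.m≤n⊔m H₁ H₂) H≥)))
  where
  bound : ∀ {H} a b → a ^ (q + q) ≤ H → b ^ (q + q) ≤ H → a ^ q * b ^ q ≤ H
  bound {H} a b p r with ℕₚ.≤-total a b
  ... | inj₁ a≤b = ℕₚ.≤-trans (ℕₚ.*-monoˡ-≤ (b ^ q) (ℕₚ.^-monoˡ-≤ q a≤b)) (subst (_≤ H) (ℕₚ.^-distribˡ-+-* b q q) r)
  ... | inj₂ b≤a = ℕₚ.≤-trans (ℕₚ.*-monoʳ-≤ (a ^ q) (ℕₚ.^-monoˡ-≤ q b≤a)) (subst (_≤ H) (ℕₚ.^-distribˡ-+-* a q q) p)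

sub-^ : ∀ {f} → Subpolynomial f → ∀ k → Subpolynomial (λ H → f H ^ k)
sub-^ {f} F k q = let H₀ , h = F (k * q) in H₀ , λ H H≥ → subst (_≤ H) (sym (ℕₚ.^-*-assoc (f H) k q)) (h H H≥)

^-reflects-≤ : ∀ k {x y} → x ^ suc k ≤ y ^ suc k → x ≤ y
^-reflects-≤ k {x} {y} h = ℕₚ.≮⇒≥ λ y<x → ℕₚ.<⇒≱ (ℕₚ.^-monoˡ-< (suc k) y<x) h

-- A maximum over all arguments up to `X`, because the determinant of `C` is known only through an
-- upper bound.
maxDivisors : ℕ → ℕ
maxDivisors zero    = 0
maxDivisors (suc X) = maxDivisors X ⊔ length (divisors (suc X))

divisors≤max : ∀ {D X} → 0 < D → D ≤ X → length (divisors D) ≤ maxDivisors X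
divisors≤max {suc D} {suc X} D>0 (s≤s D≤X) with ℕₚ.m≤n⇒m<n∨m≡n D≤X
... | inj₁ D<X  = ℕₚ.≤-trans (divisors≤max D>0 D<X) (ℕₚ.m≤m⊔n (maxDivisors X) _)
... | inj₂ refl = ℕₚ.m≤n⊔m (maxDivisors X) _

maxDivisors-bound : ∀ q → ∃[ c ] ∀ X → maxDivisors X ^ suc q ≤ c * X
maxDivisors-bound q = let c , h = divisor-bound (suc q) in c , go c h
  where
  go : ∀ c → (∀ D → 0 < D → length (divisors D) ^ suc q ≤ c * D) → ∀ X → maxDivisors X ^ suc q ≤ c * X
  go c h zero    = z≤n
  go c h (suc X) with ℕₚ.⊔-sel (maxDivisors X) (length (divisors (suc X)))
  ... | inj₁ e = subst (λ t → t ^ suc q ≤ c * suc X) (sym e) (ℕₚ.≤-trans (go c h X) (ℕₚ.*-monoʳ-≤ c (ℕₚ.n≤1+n X)))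
  ... | inj₂ e = subst (λ t → t ^ suc q ≤ c * suc X) (sym e) (h (suc X) (s≤s z≤n))

sub-maxDivisors : ∀ b k → Subpolynomial (λ H → maxDivisors (b * H ^ k))
sub-maxDivisors b k zero    = 1 , λ H H≥ → H≥
sub-maxDivisors b k (suc q) =
  -- The successor of this argument is `suc q * suc k`. The extra power `suc k` brings the bound to
  -- `c * b * H ^ k`, at most H^(k + 1) once H ≥ c b.
  let c , h = maxDivisors-bound (k + q * suc k) in
  c * b , λ H H≥ → ^-reflects-≤ k (begin
    (maxDivisors (b * H ^ k) ^ suc q) ^ suc k     ≡⟨ ℕₚ.^-*-assoc (maxDivisors (b * H ^ k)) (suc q) (suc k) ⟩
    maxDivisors (b * H ^ k) ^ (suc q * suc k)     ≤⟨ h (b * H ^ k) ⟩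
    c * (b * H ^ k)                               ≡⟨ ℕₚ.*-assoc c b (H ^ k) ⟨
    c * b * H ^ k                                 ≤⟨ ℕₚ.*-monoˡ-≤ (H ^ k) H≥ ⟩
    H ^ suc k                                     ∎)
  where open ℕₚ.≤-Reasoning

log-exists : ∀ H → ∃[ h ] 2 * suc H < 2 ^ h × 2 ^ h ≤ 4 * suc H
log-exists zero    = 2 , s≤s (s≤s (s≤s z≤n)) , ℕₚ.≤-refl
log-exists (suc H) with log-exists H
... | h , lo , hi with 2 * suc (suc H) ℕₚ.<? 2 ^ h
... | yes lt = h , lt , ℕₚ.≤-trans hi (ℕₚ.*-monoʳ-≤ 4 (ℕₚ.n≤1+n (suc H)))
... | no ≥  = suc h , (begin-strict
    2 * suc (suc H)          <⟨ s≤s (ℕₚ.m≤m+n (2 * suc (suc H)) (2 * H + 1)) ⟩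
    suc (2 * suc (suc H) + (2 * H + 1)) ≡⟨ eq H ⟩
    2 * suc (2 * suc H)      ≤⟨ ℕₚ.*-monoʳ-≤ 2 lo ⟩
    2 ^ suc h                ∎) ,
    ℕₚ.≤-trans (ℕₚ.*-monoʳ-≤ 2 (ℕₚ.≮⇒≥ ≥)) (ℕₚ.≤-reflexive (eq′ (suc (suc H))))
  where
  open ℕₚ.≤-Reasoning
  eq : ∀ H → suc (2 * suc (suc H) + (2 * H + 1)) ≡ 2 * suc (2 * suc H)
  eq = solve-∀ℕ
  eq′ : ∀ x → 2 * (2 * x) ≡ 4 * x
  eq′ = solve-∀ℕ

level : ℕ → ℕ
level zero    = 0
level (suc H) = proj₁ (log-exists H)

2H≤θ : ∀ H → 2 * H ≤ θ (level H)
2H≤θ zero    = z≤n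
2H≤θ (suc H) = s≤s⁻¹ (subst (2 * suc H <_) (sym (suc-θ (level (suc H)))) (proj₁ (proj₂ (log-exists H))))

2^level≤4H : ∀ H → 1 ≤ H → 2 ^ level H ≤ 4 * H
2^level≤4H (suc H) _ = proj₂ (proj₂ (log-exists H))

level-unbounded : ∀ k H → 2 ^ k ≤ H → k ≤ level H
level-unbounded k zero    h = ⊥-elim (ℕₚ.<⇒≱ (ℕₚ.m^n>0 2 k) h)
level-unbounded k (suc H) h = ℕₚ.≮⇒≥ λ l<k → ℕₚ.<⇒≱ (begin-strict
  2 ^ level (suc H)       <⟨ ℕₚ.^-monoʳ-< 2 ℕₚ.≤-refl l<k ⟩
  2 ^ k                   ≤⟨ h ⟩
  suc H                   ≤⟨ ℕₚ.m≤n*m (suc H) 2 ⟩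
  2 * suc H               ∎) (ℕₚ.<⇒≤ (proj₁ (proj₂ (log-exists H))))
  where open ℕₚ.≤-Reasoning

sub-level : Subpolynomial (λ H → suc (level H))
-- From here on `level H` is at least `4 * c`, so the one surplus power of the logarithm in the
-- exponent `suc q` pays for the constant.
sub-level q = 2 ^ (4 * c) , λ H H≥ → ℕₚ.*-cancelʳ-≤ (suc (level H) ^ q) H (4 * c) {{>-nonZero 4c>0}} (begin
    suc (level H) ^ q * (4 * c)            ≤⟨ ℕₚ.*-monoʳ-≤ (suc (level H) ^ q) (ℕₚ.m≤n⇒m≤1+n (level-unbounded (4 * c) H H≥)) ⟩
    suc (level H) ^ q * suc (level H)      ≡⟨ ℕₚ.*-comm (suc (level H) ^ q) (suc (level H)) ⟩
    suc (level H) ^ suc q                  ≤⟨ power≤exponential (level H) (suc q) ⟩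
    c * 2 ^ level H                        ≤⟨ ℕₚ.*-monoʳ-≤ c (2^level≤4H H (ℕₚ.≤-trans (ℕₚ.m^n>0 2 (4 * c)) H≥)) ⟩
    c * (4 * H)                            ≡⟨ eq c H ⟩
    H * (4 * c)                            ∎)
  where
  open ℕₚ.≤-Reasoning
  c = κ₂ (suc q)
  4c>0 : 0 < 4 * c
  4c>0 = ℕₚ.≤-trans (κ₂>0 (suc q)) (ℕₚ.m≤n*m c 4)
  eq : ∀ c H → c * (4 * H) ≡ H * (4 * c)
  eq = solve-∀ℕ

-- Asymptotics

Factorisation : ∀ {n} m → ℕ → (Vec ℤ n → Vec ℤ n) → Vec (Matrix n) m → Set
Factorisation m H C As = VAll.All (BoundedMatrix H) As × (∀ v → actAll As v ≡ C v)

prodMats≡⇒actAll≡ : ∀ {n m} {As : Vec (Matrix n) m} {C} → prodMats As ≡ C → ∀ v → actAll As v ≡ act C v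
prodMats≡⇒actAll≡ {As = As} refl v = sym (act-prodMats As v)

actAll≡⇒prodMats≡ : ∀ {n m} {As : Vec (Matrix n) m} {C} → (∀ v → actAll As v ≡ act C v) → prodMats As ≡ C
actAll≡⇒prodMats≡ {As = As} {C} h = act-ext (prodMats As) C λ j → trans (act-prodMats As (unit j)) (h (unit j))

∈-boundedMats⁻ : ∀ {n H} {A : Matrix n} → A ∈ boundedMats n H → BoundedMatrix H A
∈-boundedMats⁻ {A = A} A∈ = VAll.map ∈-box⁻ (∈-vecsOf⁻ A A∈)

countT≤ : ∀ m n H C {N} → Atmost (Factorisation m H (act C)) N → countT m n H C ≤ N
countT≤ m n H C h = h solutions
  (Uniqueₚ.filter⁺ _ (vecsOf-unique m (vecsOf-unique n (vecsOf-unique n (range-unique H)))))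
  (All.tabulate λ {As} As∈ → let As∈′ , eq = ∈ₚ.∈-filter⁻ (λ As → prodMats As ≟M C) {xs = vecsOf m (boundedMats n H)} As∈ in
    VAll.map ∈-boundedMats⁻ (∈-vecsOf⁻ As As∈′) , prodMats≡⇒actAll≡ {As = As} eq)
  where solutions = List.filter (λ As → prodMats As ≟M C) (vecsOf m (boundedMats n H))

zero-count≥ : ∀ m n H → H ^ (m * (n * n)) ≤ countT (suc m) n H (zeroMat n)
zero-count≥ m n H = begin
  H ^ (m * (n * n))                                            ≤⟨ ℕₚ.^-monoˡ-≤ (m * (n * n)) (ℕₚ.m≤n⇒m≤1+n (ℕₚ.m≤n*m H 2)) ⟩
  suc (2 * H) ^ (m * (n * n))                                  ≡⟨ cong (suc (2 * H) ^_) (ℕₚ.*-comm m (n * n)) ⟩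
  suc (2 * H) ^ (n * n * m)                                    ≡⟨ ℕₚ.^-*-assoc (suc (2 * H)) (n * n) m ⟨
  (suc (2 * H) ^ (n * n)) ^ m                                  ≡⟨ cong (_^ m) (ℕₚ.^-*-assoc (suc (2 * H)) n n) ⟨
  ((suc (2 * H) ^ n) ^ n) ^ m                                  ≡⟨ cong (λ t → (t ^ n) ^ m) (length-box n H) ⟨
  (length (vecsOf n (range H)) ^ n) ^ m                        ≡⟨ cong (_^ m) (length-vecsOf n (vecsOf n (range H))) ⟨
  length (boundedMats n H) ^ m                                 ≡⟨ length-vecsOf m (boundedMats n H) ⟨
  length (vecsOf m (boundedMats n H))                          ≡⟨ Listₚ.length-map (zeroMat n ∷_) (vecsOf m (boundedMats n H)) ⟨
  length (List.map (zeroMat n ∷_) (vecsOf m (boundedMats n H)))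
    ≤⟨ atmost-list {P = _∈ solutions} solutions (λ p → p) _
         (Uniqueₚ.map⁺ Vecₚ.∷-injectiveʳ (vecsOf-unique m (vecsOf-unique n (vecsOf-unique n (range-unique H)))))
         (Allₚ.map⁺ (All.tabulate λ {As} As∈ → ∈ₚ.∈-filter⁺ (λ As → prodMats As ≟M zeroMat n)
           (∈-vecsOf⁺ (zeroMat n ∷ As) (zeroMat∈ ∷ ∈-vecsOf⁻ As As∈)) (zero-product As))) ⟩
  countT (suc m) n H (zeroMat n)                               ∎
  where
  open ℕₚ.≤-Reasoning
  solutions = List.filter (λ As → prodMats As ≟M zeroMat n) (vecsOf (suc m) (boundedMats n H))
  zeroMat∈ : zeroMat n ∈ boundedMats n H
  zeroMat∈ = ∈-vecsOf⁺ (zeroMat n) (VAllₚ.lookup⁻ λ i → subst (_∈ vecsOf n (range H)) (sym (Vecₚ.lookup∘tabulate _ i))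
    (∈-box⁺ (VAllₚ.lookup⁻ λ j → subst (λ t → ∣ t ∣ ≤ H) (sym (Vecₚ.lookup∘tabulate _ j)) z≤n)))
  zero-product : (As : Vec (Matrix n) m) → prodMats (zeroMat n ∷ As) ≡ zeroMat n
  zero-product As = actAll≡⇒prodMats≡ {As = zeroMat n ∷ As} λ v → trans (act-zeroMat (actAll As v)) (sym (act-zeroMat v))

-- Here ε is (p + 1) / (q + 1), and 1 / (q + 1) of it already suffices. `N` comes after `H₀`, which
-- makes the threshold uniform in `C`.
asymptotic : ∀ {f} → Subpolynomial f → ∀ e p q → ∃[ H₀ ] ∀ H → H ≥ H₀ → ∀ N → N ≤ f H * H ^ e → N ^ suc q ≤ H ^ (e * suc q + suc p)
asymptotic {f} F e p q = let H₀ , h = F (suc q) in H₀ ⊔ 1 , λ H H≥ N N≤ → begin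
    N ^ suc q                            ≤⟨ ℕₚ.^-monoˡ-≤ (suc q) N≤ ⟩
    (f H * H ^ e) ^ suc q                ≡⟨ ^-distribʳ-* (f H) (H ^ e) (suc q) ⟩
    f H ^ suc q * (H ^ e) ^ suc q        ≤⟨ ℕₚ.*-mono-≤ (h H (ℕₚ.≤-trans (ℕₚ.m≤m⊔n H₀ 1) H≥)) (ℕₚ.≤-reflexive (ℕₚ.^-*-assoc H e (suc q))) ⟩
    H * H ^ (e * suc q)                  ≤⟨ ℕₚ.*-monoˡ-≤ (H ^ (e * suc q)) (ℕₚ.m≤m*n H (H ^ p) {{ℕₚ.m^n≢0 H p {{>-nonZero (ℕₚ.≤-trans (ℕₚ.m≤n⊔m H₀ 1) H≥)}}}}) ⟩
    H ^ suc p * H ^ (e * suc q)          ≡⟨ ℕₚ.^-distribˡ-+-* H (suc p) (e * suc q) ⟨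
    H ^ (suc p + e * suc q)              ≡⟨ cong (H ^_) (ℕₚ.+-comm (suc p) (e * suc q)) ⟩
    H ^ (e * suc q + suc p)              ∎
  where open ℕₚ.≤-Reasoning

ζ : ℕ → ℕ
ζ n = 4 * 2 ^ (n + 2)

Q≤ : ∀ n k H → 1 ≤ H → Q (level H) n ^ k ≤ ζ n ^ (n * k) * H ^ (n * k)
Q≤ n k H 1≤H = begin
  ((2 ^ (level H + (n + 2))) ^ n) ^ k            ≡⟨ ℕₚ.^-*-assoc (2 ^ (level H + (n + 2))) n k ⟩
  (2 ^ (level H + (n + 2))) ^ (n * k)            ≤⟨ ℕₚ.^-monoˡ-≤ (n * k) step ⟩
  (ζ n * H) ^ (n * k)                            ≡⟨ ^-distribʳ-* (ζ n) H (n * k) ⟩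
  ζ n ^ (n * k) * H ^ (n * k)                    ∎
  where
  open ℕₚ.≤-Reasoning
  step : 2 ^ (level H + (n + 2)) ≤ ζ n * H
  step = begin
    2 ^ (level H + (n + 2))          ≡⟨ ℕₚ.^-distribˡ-+-* 2 (level H) (n + 2) ⟩
    2 ^ level H * 2 ^ (n + 2)        ≤⟨ ℕₚ.*-monoˡ-≤ (2 ^ (n + 2)) (2^level≤4H H 1≤H) ⟩
    4 * H * 2 ^ (n + 2)              ≡⟨ eq H (2 ^ (n + 2)) ⟩
    ζ n * H                          ∎
    where
    eq : ∀ H x → 4 * H * x ≡ 4 * x * H
    eq = solve-∀ℕ

sub-W : ∀ n → Subpolynomial (λ H → suc n * suc (level H) ^ n)
sub-W n = sub-* (sub-const (suc n)) (sub-^ sub-level n)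

two-factors : ∀ n p q → ∃[ H₀ ] ∀ H → H ≥ H₀ → ∀ C → countT 2 n H C ^ suc q ≤ H ^ ((n * n) * suc q + suc p)
two-factors n p q =
  let H₀ , h = asymptotic (sub-* (sub-* (sub-const (suc n)) (sub-W n)) (sub-const (ζ n ^ (n * n)))) (n * n) p q
  in H₀ ⊔ 1 , λ H H≥ C → h H (ℕₚ.≤-trans (ℕₚ.m≤m⊔n H₀ 1) H≥) _
       (ℕₚ.≤-trans (countT≤ 2 n H C (Counts.atmost-two-factors n (level H) H (2H≤θ H) (act C)))
         (bound H (ℕₚ.≤-trans (ℕₚ.m≤n⊔m H₀ 1) H≥)))
  where
  open ℕₚ.≤-Reasoning
  bound : ∀ H → 1 ≤ H → suc n * (suc n * suc (level H) ^ n * Q (level H) n ^ n)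
    ≤ suc n * (suc n * suc (level H) ^ n) * ζ n ^ (n * n) * H ^ (n * n)
  bound H 1≤H = begin
    suc n * (W * Q (level H) n ^ n)                         ≤⟨ ℕₚ.*-monoʳ-≤ (suc n) (ℕₚ.*-monoʳ-≤ W (Q≤ n n H 1≤H)) ⟩
    suc n * (W * (ζ n ^ (n * n) * H ^ (n * n)))             ≡⟨ eq (suc n) W (ζ n ^ (n * n)) (H ^ (n * n)) ⟩
    suc n * W * ζ n ^ (n * n) * H ^ (n * n)                 ∎
    where
    W = suc n * suc (level H) ^ n
    eq : ∀ a b c d → a * (b * (c * d)) ≡ a * b * c * d
    eq = solve-∀ℕ

zero-products : ∀ m n p q → ∃[ H₀ ] ∀ H → H ≥ H₀ → countT (suc m) n H (zeroMat n) ^ suc q ≤ H ^ ((m * (n * n)) * suc q + suc p)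
zero-products m n p q =
  let H₀ , h = asymptotic (sub-* (sub-* (sub-const (suc n ^ suc m)) (sub-^ (sub-W n) (suc m))) (sub-const (ζ n ^ (m * (n * n))))) (m * (n * n)) p q
  in H₀ ⊔ 1 , λ H H≥ → h H (ℕₚ.≤-trans (ℕₚ.m≤m⊔n H₀ 1) H≥) _
       (ℕₚ.≤-trans (countT≤ (suc m) n H (zeroMat n) (atmost-⊆ (λ { (b , p) → b , λ v → trans (p v) (act-zeroMat v) })
           (Counts.atmost-zero-products n (level H) H (2H≤θ H) m)))
         (bound H (ℕₚ.≤-trans (ℕₚ.m≤n⊔m H₀ 1) H≥)))
  where
  open ℕₚ.≤-Reasoning
  exponent : n * (m * n) ≡ m * (n * n)
  exponent = eq n m
    where
    eq : ∀ n m → n * (m * n) ≡ m * (n * n)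
    eq = solve-∀ℕ
  bound : ∀ H → 1 ≤ H → suc n ^ suc m * ((suc n * suc (level H) ^ n) ^ suc m * Q (level H) n ^ (m * n))
    ≤ suc n ^ suc m * (suc n * suc (level H) ^ n) ^ suc m * ζ n ^ (m * (n * n)) * H ^ (m * (n * n))
  bound H 1≤H = begin
    N * (W * Q (level H) n ^ (m * n))                            ≤⟨ ℕₚ.*-monoʳ-≤ N (ℕₚ.*-monoʳ-≤ W (Q≤ n (m * n) H 1≤H)) ⟩
    N * (W * (ζ n ^ (n * (m * n)) * H ^ (n * (m * n))))          ≡⟨ cong (λ t → N * (W * (ζ n ^ t * H ^ t))) exponent ⟩
    N * (W * (ζ n ^ (m * (n * n)) * H ^ (m * (n * n))))          ≡⟨ eq N W (ζ n ^ (m * (n * n))) (H ^ (m * (n * n))) ⟩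
    N * W * ζ n ^ (m * (n * n)) * H ^ (m * (n * n))              ∎
    where
    N = suc n ^ suc m
    W = (suc n * suc (level H) ^ n) ^ suc m
    eq : ∀ a b c d → a * (b * (c * d)) ≡ a * b * c * d
    eq = solve-∀ℕ

sub-suc : ∀ {f} → Subpolynomial f → Subpolynomial (λ H → suc (f H))
sub-suc {f} F q = let H₀ , h = sub-* {λ _ → 2} {λ H → f H} (sub-const 2) F q in
  H₀ ⊔ 1 , λ H H≥ → bound H (f H) (ℕₚ.≤-trans (ℕₚ.m≤n⊔m H₀ 1) H≥) (h H (ℕₚ.≤-trans (ℕₚ.m≤m⊔n H₀ 1) H≥))
  where
  bound : ∀ H x → 1 ≤ H → (2 * x) ^ q ≤ H → suc x ^ q ≤ H
  bound H zero    1≤H _ = subst (_≤ H) (sym (ℕₚ.^-zeroˡ q)) 1≤H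
  bound H (suc x) 1≤H h = ℕₚ.≤-trans (ℕₚ.^-monoˡ-≤ q (s≤s (ℕₚ.≤-trans (ℕₚ.m≤n+m (suc x) x) (ℕₚ.≤-reflexive (cong (λ t → x + suc t) (sym (ℕₚ.+-identityʳ x))))))) h

nonzero-products : ∀ m n″ → let n = suc (suc n″) in
  ∃[ H₀ ] ∀ H → H ≥ H₀ → ∀ C → C ≢ zeroMat n → countT (suc m) n H C ≤ H ^ (suc m * (n * n) ∸ n)
nonzero-products m n″ =
  let H₀ , h = F 1 in
  H₀ ⊔ 1 , λ H H≥ C C≢0 → let 1≤H = ℕₚ.≤-trans (ℕₚ.m≤n⊔m H₀ 1) H≥ in
    ℕₚ.≤-trans (countT≤ (suc m) n H C (NonzeroProducts.atmost-nonzero-products n″ (level H) H (2H≤θ H) m (act C)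
        λ z → C≢0 (act-ext C (zeroMat n) λ j → trans (z (unit j)) (sym (act-zeroMat (unit j))))))
      (bound H 1≤H (ℕₚ.≤-trans (ℕₚ.≤-reflexive (sym (ℕₚ.^-identityʳ (f H)))) (h H (ℕₚ.≤-trans (ℕₚ.m≤m⊔n H₀ 1) H≥))))
  where
  open ℕₚ.≤-Reasoning
  n = suc (suc n″)
  e = n * (n * m + n″)
  f : ℕ → ℕ
  f H = suc (m * (n * (suc n * suc (level H) ^ n))) * ζ n ^ e
  F : Subpolynomial f
  F = sub-* (sub-suc (sub-* (sub-const m) (sub-* (sub-const n) (sub-W n)))) (sub-const (ζ n ^ e))
  -- The right side is e + n. One of the spare powers of `H` absorbs the constants and logarithms
  -- collected in `f`.
  exponent : suc e ≤ suc m * (n * n) ∸ n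
  exponent = ℕₚ.≤-trans (ℕₚ.m≤m+n (suc e) (suc n″)) (ℕₚ.≤-reflexive (sym (trans (cong (_∸ n) (eq m n″)) (ℕₚ.m+n∸n≡m (suc e + suc n″) n))))
    where
    eq : ∀ m k → suc m * (suc (suc k) * suc (suc k)) ≡ suc (suc (suc k) * (suc (suc k) * m + k)) + suc k + suc (suc k)
    eq = solve-∀ℕ
  bound : ∀ H → 1 ≤ H → f H ≤ H → suc (m * (n * (suc n * suc (level H) ^ n))) * Q (level H) n ^ (n * m + n″) ≤ H ^ (suc m * (n * n) ∸ n)
  bound H 1≤H f≤H = begin
    V * Q (level H) n ^ (n * m + n″)        ≤⟨ ℕₚ.*-monoʳ-≤ V (Q≤ n (n * m + n″) H 1≤H) ⟩
    V * (ζ n ^ e * H ^ e)                   ≡⟨ ℕₚ.*-assoc V (ζ n ^ e) (H ^ e) ⟨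
    f H * H ^ e                             ≤⟨ ℕₚ.*-monoˡ-≤ (H ^ e) f≤H ⟩
    H ^ suc e                               ≤⟨ ℕₚ.^-monoʳ-≤ H {{>-nonZero 1≤H}} exponent ⟩
    H ^ (suc m * (n * n) ∸ n)               ∎
    where V = suc (m * (n * (suc n * suc (level H) ^ n)))

rows-weight : ∀ {n k M} {bs : Vec (Vec ℤ n) k} → VAll.All (Bounded M) bs → Weight (k * M) bs
rows-weight []       R [] [] = bounded-𝟘
rows-weight {bs = b ∷ bs} (p ∷ ps) = weight-∷ {b = b} {bs} p (rows-weight ps)

prodMats-bounded : ∀ {n m H} (As : Vec (Matrix n) m) → VAll.All (BoundedMatrix H) As → BoundedMatrix ((H * n) ^ m) (prodMats As)
prodMats-bounded {n} [] [] = VAllₚ.lookup⁻ λ i → VAllₚ.lookup⁻ λ j → entry≤1 i j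
  where
  entry≤1 : ∀ i j → ∣ entry (identity n) i j ∣ ≤ 1
  entry≤1 i j with j Fin.≟ i
  ... | yes e = subst (λ t → ∣ t ∣ ≤ 1) (sym (proj₁ (entry-identity i j) e)) ℕₚ.≤-refl
  ... | no ne = subst (λ t → ∣ t ∣ ≤ 1) (sym (proj₂ (entry-identity i j) ne)) z≤n
prodMats-bounded {n} {suc m} {H} (A ∷ As) (bA ∷ bAs) = VAllₚ.lookup⁻ λ i →
  subst (Bounded (H * n * (H * n) ^ m)) (sym (lookup-⊗ A (prodMats As) i))
    (bounded-≤ (ℕₚ.≤-reflexive (sym (ℕₚ.*-assoc H n ((H * n) ^ m))))
      (rows-weight (prodMats-bounded As bAs) H (lookup A i) (VAllₚ.lookup⁺ bA i)))

signedDivisors : ℤ → List ℤ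
signedDivisors d = List.map +_ (divisors ∣ d ∣) List.++ List.map (λ t → - + t) (divisors ∣ d ∣)

length-signedDivisors : ∀ d → length (signedDivisors d) ≡ 2 * length (divisors ∣ d ∣)
length-signedDivisors d = trans (Listₚ.length-++ (List.map +_ (divisors ∣ d ∣)))
  (cong₂ _+_ (Listₚ.length-map +_ (divisors ∣ d ∣))
    (trans (Listₚ.length-map (λ t → - + t) (divisors ∣ d ∣)) (sym (ℕₚ.+-identityʳ (length (divisors ∣ d ∣))))))

∈-signedDivisors : ∀ d → d ≢ 0ℤ → ∀ t u → d ≡ t ℤ.* u → t ∈ signedDivisors d
∈-signedDivisors d d≢0 t u eq = go t (∈-divisors (ℕₚ.n≢0⇒n>0 λ e → d≢0 (ℤₚ.∣i∣≡0⇒i≡0 e))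
  (divides (∣ u ∣) (trans (cong ∣_∣ eq) (trans (ℤₚ.∣i*j∣≡∣i∣*∣j∣ t u) (ℕₚ.*-comm (∣ t ∣) (∣ u ∣))))))
  where
  go : ∀ t → ∣ t ∣ ∈ divisors ∣ d ∣ → t ∈ signedDivisors d
  go (+ t)       p = ∈ₚ.∈-++⁺ˡ (∈ₚ.∈-map⁺ +_ p)
  go ℤ.-[1+ t ]  p = ∈ₚ.∈-++⁺ʳ (List.map +_ (divisors ∣ d ∣)) (∈ₚ.∈-map⁺ (λ t → - + t) p)

nonsingular-products : ∀ m n′ p q → let n = suc n′ in
  ∃[ H₀ ] ∀ H → H ≥ H₀ → ∀ C → det C ≢ 0ℤ → countT (suc m) n H C ^ suc q ≤ H ^ ((m * (n * n ∸ n)) * suc q + suc p)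
nonsingular-products m n′ p q =
  let H₀ , h = asymptotic (sub-^ G m) (m * (n * n ∸ n)) p q in
  H₀ ⊔ 1 , λ H H≥ C d≢0 → h H (ℕₚ.≤-trans (ℕₚ.m≤m⊔n H₀ 1) H≥) _
    (countT≤ (suc m) n H C (atmost H (ℕₚ.≤-trans (ℕₚ.m≤n⊔m H₀ 1) H≥) C d≢0))
  where
  open ℕₚ.≤-Reasoning
  n = suc n′
  k = suc m * n
  b = n ! * n ^ k
  g : ℕ → ℕ
  g H = suc n′ * (suc (level H) ^ n′ * (2 * maxDivisors (b * H ^ k) * ζ n ^ (n * n′)))
  G : Subpolynomial g
  G = sub-* (sub-const (suc n′)) (sub-* (sub-^ sub-level n′) (sub-* (sub-* (sub-const 2) (sub-maxDivisors b k)) (sub-const (ζ n ^ (n * n′)))))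
  n*n′ : n * n′ ≡ n * n ∸ n
  n*n′ = trans (ℕₚ.*-comm n n′) (sym (ℕₚ.m+n∸m≡n n (n′ * n)))
  -- This gives uniformity in `C`: every `C` with a factorisation has its determinant below one
  -- polynomial in `H`, to which `maxDivisors` is applied.
  det-bound : ∀ H C As → Factorisation (suc m) H (act C) As → ∣ det C ∣ ≤ b * H ^ k
  det-bound H C As (bAs , p) with actAll≡⇒prodMats≡ {As = As} {C} p
  ... | refl = begin
    ∣ det (prodMats As) ∣                        ≤⟨ ∣det∣≤ n (entry (prodMats As)) (λ i j → VAllₚ.lookup⁺ (VAllₚ.lookup⁺ (prodMats-bounded As bAs) i) j) ⟩
    n ! * ((H * n) ^ suc m) ^ n                  ≡⟨ cong (n ! *_) (trans (ℕₚ.^-*-assoc (H * n) (suc m) n) (^-distribʳ-* H n k)) ⟩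
    n ! * (H ^ k * n ^ k)                        ≡⟨ eq (n !) (H ^ k) (n ^ k) ⟩
    b * H ^ k                                    ∎
    where
    eq : ∀ a x y → a * (x * y) ≡ a * y * x
    eq = solve-∀ℕ
  M : ℕ → ℤ → ℕ
  M H d = suc n′ * (suc (level H) ^ n′ * (length (signedDivisors d) * Q (level H) n ^ n′))
  M≤ : ∀ H d → 1 ≤ H → d ≢ 0ℤ → ∣ d ∣ ≤ b * H ^ k → M H d ≤ g H * H ^ (n * n ∸ n)
  M≤ H d 1≤H d≢0 d≤ = begin
    suc n′ * (L * (length (signedDivisors d) * Q (level H) n ^ n′))
      ≤⟨ ℕₚ.*-monoʳ-≤ (suc n′) (ℕₚ.*-monoʳ-≤ L (ℕₚ.*-mono-≤
           (ℕₚ.≤-trans (ℕₚ.≤-reflexive (length-signedDivisors d)) (ℕₚ.*-monoʳ-≤ 2 (divisors≤max (ℕₚ.n≢0⇒n>0 λ e → d≢0 (ℤₚ.∣i∣≡0⇒i≡0 e)) d≤)))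
           (Q≤ n n′ H 1≤H))) ⟩
    suc n′ * (L * (2 * T * (ζ n ^ (n * n′) * H ^ (n * n′))))
      ≡⟨ eq (suc n′) L (2 * T) (ζ n ^ (n * n′)) (H ^ (n * n′)) ⟩
    g H * H ^ (n * n′)
      ≡⟨ cong (λ t → g H * H ^ t) n*n′ ⟩
    g H * H ^ (n * n ∸ n) ∎
    where
    L = suc (level H) ^ n′
    T = maxDivisors (b * H ^ k)
    eq : ∀ a l t z h → a * (l * (t * (z * h))) ≡ a * (l * (t * z)) * h
    eq = solve-∀ℕ
  atmost : ∀ H → 1 ≤ H → ∀ C → det C ≢ 0ℤ → Atmost (Factorisation (suc m) H (act C)) (g H ^ m * H ^ (m * (n * n ∸ n)))
  atmost H 1≤H C d≢0 = atmost-inhabited λ As fact → atmost-≤ (begin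
      M H (det C) ^ m                              ≤⟨ ℕₚ.^-monoˡ-≤ m (M≤ H (det C) 1≤H d≢0 (det-bound H C As fact)) ⟩
      (g H * H ^ (n * n ∸ n)) ^ m                  ≡⟨ ^-distribʳ-* (g H) (H ^ (n * n ∸ n)) m ⟩
      g H ^ m * (H ^ (n * n ∸ n)) ^ m              ≡⟨ cong (g H ^ m *_) (trans (ℕₚ.^-*-assoc H (n * n ∸ n) m) (cong (H ^_) (ℕₚ.*-comm (n * n ∸ n) m))) ⟩
      g H ^ m * H ^ (m * (n * n ∸ n))              ∎)
    (atmost-factorisations d≢0
      (atmost-invertible (level H) H (2H≤θ H) (det C) d≢0 (signedDivisors (det C)) (∈-signedDivisors (det C) d≢0))
      m (act C) (λ v → comb v (adjugate C)) (comb-linear (adjugate C)) (act-adjugate C))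

singular-1×1 : ∀ (C : Matrix 1) → det C ≡ 0ℤ → C ≡ zeroMat 1
singular-1×1 ((c ∷ []) ∷ []) d = cong (λ t → (t ∷ []) ∷ []) (trans (eq c) d)
  where
  eq : ∀ c → c ≡ 1ℤ ℤ.* (c ℤ.* 1ℤ) ℤ.+ 0ℤ
  eq = solve-∀

theorem2p1 : (m n : ℕ) → 1 ≤ m → 1 ≤ n →
    ((p q : ℕ) → ∃[ H₀ ] ((H : ℕ) → H ≥ H₀ → (C : Matrix n) → det C ≢ + 0 →
    countT m n H C ^ suc q ≤ H ^ (((m ∸ 1) * (n * n ∸ n)) * suc q + suc p)))
    ×
    (m ≡ 2 → (p q : ℕ) → ∃[ H₀ ] ((H : ℕ) → H ≥ H₀ → (C : Matrix n) → C ≢ zeroMat n → det C ≡ + 0 →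
    countT m n H C ^ suc q ≤ H ^ ((n * n) * suc q + suc p)))
    ×
    (m ≥ 3 → ∃[ H₀ ] ((H : ℕ) → H ≥ H₀ → (C : Matrix n) → C ≢ zeroMat n → det C ≡ + 0 →
    countT m n H C ≤ H ^ (m * (n * n) ∸ n)))
    ×
    (∃[ c ] ((H : ℕ) → H ≥ 1 → H ^ ((m ∸ 1) * (n * n)) ≤ c * countT m n H (zeroMat n)))
    ×
    ((p q : ℕ) → ∃[ H₀ ] ((H : ℕ) → H ≥ H₀ →
    countT m n H (zeroMat n) ^ suc q ≤ H ^ (((m ∸ 1) * (n * n)) * suc q + suc p)))
theorem2p1 (suc m) (suc n′) 1≤m 1≤n =
    nonsingular-products m n′
  , (λ { refl p q → let H₀ , h = two-factors (suc n′) p q in H₀ , λ H H≥ C _ _ → h H H≥ C })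
  , (λ _ → singular n′)
  , (1 , λ H _ → ℕₚ.≤-trans (zero-count≥ m (suc n′) H) (ℕₚ.≤-reflexive (sym (ℕₚ.*-identityˡ _))))
  , zero-products m (suc n′)
  where
  singular : ∀ n′ → let n = suc n′ in ∃[ H₀ ] ((H : ℕ) → H ≥ H₀ → (C : Matrix n) → C ≢ zeroMat n → det C ≡ + 0 →
    countT (suc m) n H C ≤ H ^ (suc m * (n * n) ∸ n))
  singular zero     = 0 , λ H _ C C≢0 d≡0 → ⊥-elim (C≢0 (singular-1×1 C d≡0))
  singular (suc n″) = let H₀ , h = nonzero-products m n″ in H₀ , λ H H≥ C C≢0 _ → h H H≥ C C≢0
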